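{- There exists $n_0 \in \mathbb{N}$ such that the following holds for all integers $n \ge n_0$ that are divisible by $3$. Let $H$ be a $3$-uniform hypergraph on $n$ vertices with no isolated vertex. If $\sigma_2'(H) > \frac{2}{3}n^2 - \frac{8}{3}n + 2$, then $H$ contains a perfect matching.
   Context: A $3$-uniform hypergraph ($3$-graph) $H=(V,E)$ has edges that are $3$-element subsets of $V$. The degree $\deg(v)$ of a vertex $v$ is the number of edges containing $v$; a vertex is isolated if its degree is $0$. Two distinct vertices $u,v$ are adjacent if some edge of $H$ contains both. $\sigma_2'(H) = \min\{\deg(u)+\deg(v) : u, v \text{ adjacent in } H\}$. A perfect matching is a set of pairwise disjoint edges covering all vertices. (The value $\frac{2}{3}n^2 - \frac{8}{3}n + 2$ equals $\sigma_2'(H^*)$, where $H^*$ has vertex set partitioned into $S,T$ with $|S|=n/3+1$, $|T|=2n/3-1$, and edges all triples with at least two vertices in $T$.) -}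

module Defs where

open import Data.Nat using (ℕ; _+_; _*_; _<_; _>_)
open import Data.Fin using (Fin)
open import Data.Product using (_×_; _,_; Σ; ∃-syntax)
open import Data.List using (List; length; filter)
open import Data.List.Membership.Propositional using (_∈_)
open import Data.List.Relation.Unary.All using (All)
open import Data.List.Relation.Unary.Unique.Propositional using (Unique)
open import Data.List.Relation.Binary.Sublist.Propositional using (_⊆_)
open import Data.Sum using (_⊎_)
open import Relation.Binary.PropositionalEquality using (_≡_; _≢_)
open import Relation.Nullary using (¬_)
open import Relation.Nullary.Decidable using (_⊎-dec_)
open import Data.Fin using (_≟_) renaming (_<_ to _<ᶠ_)

-- An edge is a 3-element subset {a,b,c} of Fin n, represented canonically
-- as a triple with a < b < c.
Triple : ℕ → Set
Triple n = Fin n × Fin n × Fin n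

_∈ₑ_ : ∀ {n} → Fin n → Triple n → Set
v ∈ₑ (a , b , c) = (v ≡ a) ⊎ (v ≡ b) ⊎ (v ≡ c)

record Hypergraph3 (n : ℕ) : Set where
  field
    edges   : List (Triple n)
    ordered : All (λ { (a , b , c) → (a <ᶠ b) × (b <ᶠ c) }) edges
    unique  : Unique edges
open Hypergraph3 public

deg : ∀ {n} → Hypergraph3 n → Fin n → ℕ
deg H v = length (filter (λ { (a , b , c) → (v ≟ a) ⊎-dec ((v ≟ b) ⊎-dec (v ≟ c)) }) (edges H))

Isolated : ∀ {n} → Hypergraph3 n → Fin n → Set
Isolated H v = deg H v ≡ 0

Adjacent : ∀ {n} → Hypergraph3 n → Fin n → Fin n → Set
Adjacent H u v = (u ≢ v) × ∃[ e ] (e ∈ edges H × u ∈ₑ e × v ∈ₑ e)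

-- σ₂'(H) > (2/3)n² − (8/3)n + 2, multiplied by 3 and with the subtraction
-- moved to the other side: for all adjacent u,v,
--   3(deg u + deg v) + 8n > 2n² + 6.
-- (For the empty hypergraph σ₂' is a minimum over the empty set; with the
-- hypothesis "no isolated vertex" and n ≥ 1 edges always exist.)
σ₂'-large : ∀ {n} → Hypergraph3 n → Set
σ₂'-large {n} H = ∀ u v → Adjacent H u v →
  3 * (deg H u + deg H v) + 8 * n > 2 * (n * n) + 6

Disjoint : ∀ {n} → Triple n → Triple n → Set
Disjoint e f = ∀ v → v ∈ₑ e → ¬ (v ∈ₑ f)

data PairwiseDisjoint {n : ℕ} : List (Triple n) → Set where
  []  : PairwiseDisjoint Data.List.[]
  _∷_ : ∀ {e es} → All (Disjoint e) es → PairwiseDisjoint es → PairwiseDisjoint (e Data.List.∷ es)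

record PerfectMatching {n : ℕ} (H : Hypergraph3 n) : Set where
  field
    M        : List (Triple n)
    sub      : M ⊆ edges H
    disjoint : PairwiseDisjoint M
    covers   : ∀ v → ∃[ e ] (e ∈ M × v ∈ₑ e)

{-# OPTIONS --safe #-}
module Submission where

open import Defs
open import Data.Bool using (Bool; true; false; not; _∧_; _∨_) renaming (_≟_ to _≟ᵇ_)
open import Data.Empty using (⊥; ⊥-elim)
open import Data.Fin using (Fin; zero; suc; toℕ; fromℕ<; _↑ˡ_; _↑ʳ_; opposite; splitAt; join; combine; remQuot; finToFun; funToFin) renaming (_≟_ to _≟ᶠ_; _<_ to _<ᶠ_)
open import Data.Fin.Patterns using (0F; 1F; 2F)
open import Data.Fin.Permutation using (Permutation′; _⟨$⟩ʳ_; _⟨$⟩ˡ_; inverseˡ; inverseʳ; _∘ₚ_; permutation) renaming (id to idₚ)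
open import Data.Fin.Properties using (any?; all?; toℕ-injective; toℕ<n; toℕ-↑ˡ; toℕ-↑ʳ; ↑ˡ-injective; ↑ʳ-injective; opposite-prop; opposite-involutive; splitAt-↑ˡ; splitAt-↑ʳ; join-splitAt; combine-remQuot; remQuot-combine; finToFun-funToFin)
open import Data.List using (List; []; _∷_; length; filter)
open import Data.List.Membership.Propositional using (_∈_; find)
open import Data.List.Membership.Propositional.Properties using (∈-filter⁺; ∈-filter⁻)
open import Data.List.Relation.Binary.Sublist.Propositional.Properties using (filter-⊆)
open import Data.List.Relation.Unary.All as All using (All; []; _∷_)
open import Data.List.Relation.Unary.AllPairs using ([]; _∷_)
open import Data.List.Relation.Unary.Any as Any using (Any; here; there)
open import Data.List.Relation.Unary.Unique.Propositional using (Unique)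
open import Data.List.Relation.Unary.Unique.Propositional.Properties using () renaming (filter⁺ to unique-filter⁺)
open import Data.Nat using (ℕ; zero; suc; _+_; _*_; _∸_; _^_; _≤_; _<_; _≥_; _>_; z≤n; s≤s; _≤?_; _<?_)
open import Data.Nat.Divisibility using (_∣_; divides)
open import Data.Nat.Induction using (<-wellFounded)
open import Data.Nat.Properties hiding (_≤?_; _<?_)
open import Data.Nat.Tactic.RingSolver using (solve-∀)
open import Data.Product using (_×_; _,_; proj₁; proj₂; ∃; ∃-syntax)
open import Data.Sum using (_⊎_; inj₁; inj₂)
open import Function using (_∘_; id)
open import Induction.WellFounded using (Acc; acc)
open import Relation.Binary using (tri<; tri≈; tri>)
open import Relation.Binary.PropositionalEquality
open import Relation.Nullary using (¬_; Dec; yes; no; does)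
open import Relation.Nullary.Decidable using (from-yes; ¬?; _×-dec_; _⊎-dec_; _→-dec_)
open import Relation.Unary using (Decidable)
open import Algebra.Properties.CommutativeMonoid.Sum +-0-commutativeMonoid using (sum; sum-cong-≗; ∑-distrib-+; ∑-comm; sum-permute)

-- Write n = 3p and let L be the set of vertices of degree below half the bound, U its complement.
-- The vertices of L are pairwise non-adjacent, and comparing the degree of a vertex of L with that
-- of a neighbour gives |L| ≤ p. The links of the vertices of L are graphs on U with so many edges
-- that, by shifting, they have a rainbow matching: L is covered by disjoint edges with two ends in
-- U. (For |L| = p one vertex is treated separately, by an exchange with three blocks.) Grouping the
-- rest of U into arbitrary fake triples, V is covered by blocks that are edges or fake.
--
-- It remains to lower the number of fake blocks. Let x₀, x₁, x₂ be one of them. As in Daykin and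
-- Häggkvist, for two other blocks e, f the cells (k, a, b) with {xₖ, eₐ, f_b} a non-edge must meet
-- all 36 diagonals of the 3 × 3 × 3 cube, so there are at least nine of them; by the degrees of the
-- xₖ the total excess over nine is only O(p). Nine non-edges form a plane of the cube, and each of
-- them can take over the role of {x₀, x₁, x₂} by an exchange inside x, e, f. For four blocks all of
-- whose pairs are tight in every such state, this leaves only the case that opposite pairs miss the
-- same xₖ. So for almost all pairs of disjoint pairs the same xₖ is missed, against the degrees.

-- The final contradiction is one of thirds. The degree of `xₖ` is at least about two thirds of the
-- maximum, so at most about a third of the pairs of blocks can miss it completely. If opposite
-- pairs of blocks miss the same `xₖ`, the `p⁴` quadruples of blocks must be made up by three
-- squares of size `(p²/3)²`, which give only `p⁴/3`. The obstacle is that an exchange may bring a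
-- vertex of low degree into the leftover triple, and then the excess need not be `O(p)`. Such
-- vertices share no edge with the original `xₖ`, so two blocks that both contain one are never
-- tight. Hence only `O(√p)` blocks contain one, and the quadruples meeting these blocks are
-- negligible. The sharpness of the hypothesis is felt in `|L| ≤ p`, where `H*` is the borderline
-- case. Existence is proved as a refuted negation throughout; candidate covers form a finite set,
-- so a search at the very end produces one. Degrees and sizes count ordered pairs and are twice the
-- usual ones.

∑-mono : ∀ {n} {f g : Fin n → ℕ} → (∀ i → f i ≤ g i) → sum f ≤ sum g
∑-mono {zero}  le = z≤n
∑-mono {suc n} le = +-mono-≤ (le zero) (∑-mono (le ∘ suc))

∑-mono-< : ∀ {n} {f g : Fin n → ℕ} → (∀ i → f i ≤ g i) → ∀ j → f j < g j → sum f < sum g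
∑-mono-< le zero    lt = +-mono-<-≤ lt (∑-mono (le ∘ suc))
∑-mono-< le (suc j) lt = +-mono-≤-< (le zero) (∑-mono-< (le ∘ suc) j lt)

∑-const : ∀ n c → sum {n} (λ _ → c) ≡ n * c
∑-const zero    c = refl
∑-const (suc n) c = cong (c +_) (∑-const n c)

∑-≤-const : ∀ {n} {f : Fin n → ℕ} c → (∀ i → f i ≤ c) → sum f ≤ n * c
∑-≤-const {n} c le = ≤-trans (∑-mono le) (≤-reflexive (∑-const n c))

∑-zero : ∀ {n} {f : Fin n → ℕ} → (∀ i → f i ≡ 0) → sum f ≡ 0
∑-zero {n} eq = trans (sum-cong-≗ eq) (trans (∑-const n 0) (*-zeroʳ n))

term≤∑ : ∀ {n} (f : Fin n → ℕ) j → f j ≤ sum f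
term≤∑ f zero    = m≤m+n _ _
term≤∑ f (suc j) = ≤-trans (term≤∑ (f ∘ suc) j) (m≤n+m _ (f zero))

∑≡0⇒ : ∀ {n} (f : Fin n → ℕ) → sum f ≡ 0 → ∀ j → f j ≡ 0
∑≡0⇒ f eq j = n≤0⇒n≡0 (≤-trans (term≤∑ f j) (≤-reflexive eq))

∑-positive : ∀ {n} (f : Fin n → ℕ) → 0 < sum f → ∃ λ j → 0 < f j
∑-positive {suc n} f lt with f zero in eq
... | suc k = zero , subst (0 <_) (sym eq) (s≤s z≤n)
... | zero  = let (j , p) = ∑-positive (f ∘ suc) lt in suc j , p

∑-*ˡ : ∀ {n} c (f : Fin n → ℕ) → sum (λ i → c * f i) ≡ c * sum f
∑-*ˡ {zero}  c f = sym (*-zeroʳ c)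
∑-*ˡ {suc n} c f = trans (cong (c * f zero +_) (∑-*ˡ c (f ∘ suc))) (sym (*-distribˡ-+ c (f zero) _))

∑-*ʳ : ∀ {n} c (f : Fin n → ℕ) → sum (λ i → f i * c) ≡ sum f * c
∑-*ʳ c f = trans (sum-cong-≗ (λ i → *-comm (f i) c)) (trans (∑-*ˡ c f) (*-comm c (sum f)))

∑-prod : ∀ {m n} (f : Fin m → ℕ) (g : Fin n → ℕ) → sum (λ i → sum (λ j → f i * g j)) ≡ sum f * sum g
∑-prod f g = trans (sum-cong-≗ (λ i → ∑-*ˡ (f i) g)) (∑-*ʳ (sum g) f)

# : Bool → ℕ
# true  = 1
# false = 0

#≤1 : ∀ b → # b ≤ 1
#≤1 true  = ≤-refl
#≤1 false = z≤n

#-not : ∀ b → # b + # (not b) ≡ 1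
#-not true  = refl
#-not false = refl

#-positive : ∀ {b} → 0 < # b → b ≡ true
#-positive {true} _ = refl

#-zero : ∀ b → # (not b) ≡ 0 → b ≡ true
#-zero true _ = refl

δ : ∀ {n} → Fin n → Fin n → ℕ
δ i j = # (does (i ≟ᶠ j))

δ-refl : ∀ {n} (i : Fin n) → δ i i ≡ 1
δ-refl i with i ≟ᶠ i
... | yes _ = refl
... | no ¬p = ⊥-elim (¬p refl)

δ-≢ : ∀ {n} {i j : Fin n} → i ≢ j → δ i j ≡ 0
δ-≢ {_} {i} {j} ne with i ≟ᶠ j
... | yes p = ⊥-elim (ne p)
... | no _  = refl

δ≡0⇒≢ : ∀ {n} {i j : Fin n} → δ i j ≡ 0 → i ≢ j
δ≡0⇒≢ {i = i} eq refl with trans (sym (δ-refl i)) eq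
... | ()

δ-suc : ∀ {n} (i j : Fin n) → δ (suc i) (suc j) ≡ δ i j
δ-suc i j with i ≟ᶠ j
... | yes _ = refl
... | no _  = refl

∑-δ : ∀ {n} (g : Fin n → ℕ) j → sum (λ i → δ i j * g i) ≡ g j
∑-δ g zero    = trans (cong₂ _+_ (*-identityˡ (g zero)) (∑-zero {f = λ i → δ (suc i) zero * g (suc i)} (λ i → refl))) (+-identityʳ (g zero))
∑-δ g (suc j) = trans (sum-cong-≗ (λ i → cong (_* g (suc i)) (δ-suc i j))) (∑-δ (g ∘ suc) j)

∑-δ1 : ∀ {n} (j : Fin n) → sum (λ i → δ i j) ≡ 1
∑-δ1 j = trans (sum-cong-≗ (λ i → sym (*-identityʳ (δ i j)))) (∑-δ (λ _ → 1) j)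

δ-comm : ∀ {n} (i j : Fin n) → δ i j ≡ δ j i
δ-comm i j with i ≟ᶠ j
... | yes refl = sym (δ-refl i)
... | no ne    = sym (δ-≢ (ne ∘ sym))

∑-δʳ : ∀ {n} (j : Fin n) → sum (λ i → δ j i) ≡ 1
∑-δʳ j = trans (sum-cong-≗ (δ-comm j)) (∑-δ1 j)

∑∑-δ : ∀ n → sum {n} (λ i → sum {n} (δ i)) ≡ n
∑∑-δ n = trans (sum-cong-≗ {n} ∑-δʳ) (trans (∑-const n 1) (*-identityʳ n))

∑∑-cong : ∀ {m n} {f g : Fin m → Fin n → ℕ} → (∀ i j → f i j ≡ g i j) → sum (λ i → sum (f i)) ≡ sum (λ i → sum (g i))
∑∑-cong eq = sum-cong-≗ (λ i → sum-cong-≗ (eq i))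

∑∑-mono : ∀ {m n} {f g : Fin m → Fin n → ℕ} → (∀ i j → f i j ≤ g i j) → sum (λ i → sum (f i)) ≤ sum (λ i → sum (g i))
∑∑-mono le = ∑-mono (λ i → ∑-mono (le i))

∑∑-+ : ∀ {m n} (f g : Fin m → Fin n → ℕ) →
       sum (λ i → sum (λ j → f i j + g i j)) ≡ sum (λ i → sum (f i)) + sum (λ i → sum (g i))
∑∑-+ f g = trans (sum-cong-≗ (λ i → ∑-distrib-+ (f i) (g i))) (∑-distrib-+ (λ i → sum (f i)) (λ i → sum (g i)))

∑∑-const : ∀ m n c → sum {m} (λ _ → sum {n} (λ _ → c)) ≡ m * (n * c)
∑∑-const m n c = trans (sum-cong-≗ {m} (λ _ → ∑-const n c)) (∑-const m (n * c))

term≤∑∑ : ∀ {m n} (f : Fin m → Fin n → ℕ) i j → f i j ≤ sum (λ i → sum (f i))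
term≤∑∑ f i j = ≤-trans (term≤∑ (f i) j) (term≤∑ (λ i → sum (f i)) i)

-- Linear arithmetic: a ≤ b follows from l ≤ r once a + r + k and b + l agree as polynomials.
lin : ∀ {a b l r} k → l ≤ r → a + r + k ≡ b + l → a ≤ b
lin {a} {b} {l} {r} k le eq = +-cancelʳ-≤ r a b (≤-trans (m≤m+n (a + r) k) (≤-trans (≤-reflexive eq) (+-monoʳ-≤ b le)))

true≢false : ∀ {b : Bool} → b ≡ true → b ≡ false → ⊥
true≢false refl ()

swap : ∀ {n} → Fin n → Fin n → Fin n → Fin n
swap a b k with k ≟ᶠ a | k ≟ᶠ b
... | yes _ | _     = b
... | no _  | yes _ = a
... | no _  | no _  = k

swap-left : ∀ {n} (a b : Fin n) → swap a b a ≡ b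
swap-left a b with a ≟ᶠ a
... | yes _ = refl
... | no ne = ⊥-elim (ne refl)

swap-right : ∀ {n} (a b : Fin n) → swap a b b ≡ a
swap-right a b with b ≟ᶠ a | b ≟ᶠ b
... | yes p | _     = p
... | no _  | yes _ = refl
... | no _  | no ne = ⊥-elim (ne refl)

swap-other : ∀ {n} (a b k : Fin n) → k ≢ a → k ≢ b → swap a b k ≡ k
swap-other a b k p q with k ≟ᶠ a | k ≟ᶠ b
... | yes r | _     = ⊥-elim (p r)
... | no _  | yes r = ⊥-elim (q r)
... | no _  | no _  = refl

swap-involutive : ∀ {n} (a b k : Fin n) → swap a b (swap a b k) ≡ k
swap-involutive a b k with k ≟ᶠ a | k ≟ᶠ b
... | yes refl | _        = swap-right k b
... | no _     | yes refl = swap-left a k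
... | no p     | no q     = swap-other a b k p q

swapₚ : ∀ {n} → Fin n → Fin n → Permutation′ n
swapₚ a b = permutation (swap a b) (swap a b) (swap-involutive a b) (swap-involutive a b)

∑-swap : ∀ {n} (a b : Fin n) (f : Fin n → ℕ) → sum (λ i → f (swap a b i)) ≡ sum f
∑-swap a b f = sym (sum-permute f (swapₚ a b))

∑∑-swap : ∀ {n} (a b : Fin n) (f : Fin n → Fin n → ℕ) →
          sum (λ i → sum (λ j → f (swap a b i) (swap a b j))) ≡ sum (λ i → sum (f i))
∑∑-swap a b f = trans (sum-cong-≗ (λ i → ∑-swap a b (f (swap a b i)))) (∑-swap a b (λ i → sum (f i)))

-- Shifting

Graph : ℕ → Set
Graph N = Fin N → Fin N → Bool

SymG IrrG : ∀ {N} → Graph N → Set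
SymG f = ∀ u v → f u v ≡ f v u
IrrG f = ∀ u → f u u ≡ false

size : ∀ {N} → Graph N → ℕ
size f = sum (λ u → sum (λ v → # (f u v)))

wt : ∀ {N} → Fin N → Fin N → ℕ
wt u v = toℕ u + toℕ v

potential : ∀ {N} → Graph N → ℕ
potential f = sum (λ u → sum (λ v → # (f u v) * wt u v))

-- x and y are the values at a pair of weight w and at its image of weight w′:
-- of the two pairs, the lighter one is filled first.
shiftVal : Bool → Bool → ℕ → ℕ → Bool
shiftVal x y w w′ with <-cmp w w′
... | tri< _ _ _ = x ∨ y
... | tri≈ _ _ _ = x
... | tri> _ _ _ = x ∧ y

-- The usual compression replacing `b` by `a`, written pointwise: the transposition matches each
-- pair with its image, and the weights tell which of the two is filled first. Pairs whose image has
-- the same weight, such as `{a, b}` itself, keep their value.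
shift : ∀ {N} → Fin N → Fin N → Graph N → Graph N
shift a b f u v = shiftVal (f u v) (f (swap a b u) (swap a b v)) (wt u v) (wt (swap a b u) (swap a b v))

∨∧-sum : ∀ x y → # (x ∨ y) + # (y ∧ x) ≡ # x + # y
∨∧-sum true  true  = refl
∨∧-sum true  false = refl
∨∧-sum false true  = refl
∨∧-sum false false = refl

∧∨-sum : ∀ x y → # (x ∧ y) + # (y ∨ x) ≡ # x + # y
∧∨-sum true  true  = refl
∧∨-sum true  false = refl
∧∨-sum false true  = refl
∧∨-sum false false = refl

shiftVal-sum : ∀ x y w w′ → # (shiftVal x y w w′) + # (shiftVal y x w′ w) ≡ # x + # y
shiftVal-sum x y w w′ with <-cmp w w′ | <-cmp w′ w
... | tri< _ _ _  | tri> _ _ _  = ∨∧-sum x y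
... | tri≈ _ _ _  | tri≈ _ _ _  = refl
... | tri> _ _ _  | tri< _ _ _  = ∧∨-sum x y
... | tri< p _ _  | tri< _ _ q  = ⊥-elim (q p)
... | tri< p q _  | tri≈ _ r _  = ⊥-elim (q (sym r))
... | tri≈ _ p _  | tri< _ q _  = ⊥-elim (q (sym p))
... | tri≈ _ p _  | tri> _ q _  = ⊥-elim (q (sym p))
... | tri> _ q _  | tri≈ _ r _  = ⊥-elim (q (sym r))
... | tri> _ _ p  | tri> q _ _  = ⊥-elim (q p)

shiftVal-weight : ∀ x y w w′ → # (shiftVal x y w w′) * w + # (shiftVal y x w′ w) * w′ ≤ # x * w + # y * w′
shiftVal-weight x y w w′ with <-cmp w w′ | <-cmp w′ w
... | tri≈ _ _ _  | tri≈ _ _ _  = ≤-refl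
... | tri< p _ _  | tri< _ _ q  = ⊥-elim (q p)
... | tri< p q _  | tri≈ _ r _  = ⊥-elim (q (sym r))
... | tri≈ _ p _  | tri< _ q _  = ⊥-elim (q (sym p))
... | tri≈ _ p _  | tri> _ q _  = ⊥-elim (q (sym p))
... | tri> _ q _  | tri≈ _ r _  = ⊥-elim (q (sym r))
... | tri> _ _ p  | tri> q _ _  = ⊥-elim (q p)
shiftVal-weight true  true  w w′ | tri< _ _ _ | tri> _ _ _ = ≤-refl
shiftVal-weight true  false w w′ | tri< _ _ _ | tri> _ _ _ = ≤-refl
shiftVal-weight false true  w w′ | tri< p _ _ | tri> _ _ _ = ≤-trans (≤-reflexive (+-identityʳ (1 * w))) (*-monoʳ-≤ 1 (<⇒≤ p))
shiftVal-weight false false w w′ | tri< _ _ _ | tri> _ _ _ = ≤-refl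
shiftVal-weight true  true  w w′ | tri> _ _ _ | tri< _ _ _ = ≤-refl
shiftVal-weight true  false w w′ | tri> _ _ p | tri< _ _ _ = ≤-trans (*-monoʳ-≤ 1 (<⇒≤ p)) (≤-reflexive (sym (+-identityʳ (1 * w))))
shiftVal-weight false true  w w′ | tri> _ _ _ | tri< _ _ _ = ≤-refl
shiftVal-weight false false w w′ | tri> _ _ _ | tri< _ _ _ = ≤-refl

shiftVal-weight-< : ∀ w w′ → w′ < w →
  # (shiftVal true false w w′) * w + # (shiftVal false true w′ w) * w′ < # true * w + # false * w′
shiftVal-weight-< w w′ lt with <-cmp w w′ | <-cmp w′ w
... | tri> _ _ _ | tri< _ _ _  = ≤-trans (s≤s (≤-reflexive (*-identityˡ w′))) (≤-trans lt (≤-reflexive (sym (trans (+-identityʳ (1 * w)) (*-identityˡ w)))))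
... | tri< p _ _ | _           = ⊥-elim (<-asym p lt)
... | tri≈ _ p _ | _           = ⊥-elim (<-irrefl (sym p) lt)
... | tri> _ _ _ | tri≈ q _ _  = ⊥-elim (q lt)
... | tri> _ _ _ | tri> q _ _  = ⊥-elim (q lt)

shiftVal-new : ∀ x y w w′ → shiftVal x y w w′ ≡ true → x ≡ false → y ≡ true × w < w′
shiftVal-new false y w w′ new refl with <-cmp w w′
shiftVal-new false y w w′ new refl | tri< p _ _ = new , p
shiftVal-new false y w w′ ()  refl | tri≈ _ _ _
shiftVal-new false y w w′ ()  refl | tri> _ _ _

shiftVal-heavy : ∀ x y w w′ → w′ < w → shiftVal x y w w′ ≡ true → y ≡ true
shiftVal-heavy x y w w′ lt new with <-cmp w w′
shiftVal-heavy x y w w′ lt new | tri< p _ _ = ⊥-elim (<-asym p lt)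
shiftVal-heavy x y w w′ lt new | tri≈ _ p _ = ⊥-elim (<-irrefl (sym p) lt)
shiftVal-heavy true y w w′ lt new | tri> _ _ _ = new

shiftVal-≈ : ∀ x y w w′ → w ≡ w′ → shiftVal x y w w′ ≡ x
shiftVal-≈ x y w w′ eq with <-cmp w w′
... | tri< _ q _ = ⊥-elim (q eq)
... | tri≈ _ _ _ = refl
... | tri> _ q _ = ⊥-elim (q eq)

module _ {N} (a b : Fin N) (f : Graph N) where

  private
    τ : Fin N → Fin N
    τ = swap a b

  shift-τ : ∀ u v → shift a b f (τ u) (τ v) ≡ shiftVal (f (τ u) (τ v)) (f u v) (wt (τ u) (τ v)) (wt u v)
  shift-τ u v rewrite swap-involutive a b u | swap-involutive a b v = refl

  -- Summing over every pair together with its image counts everything twice and lets `shiftVal-sum`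
  -- act term by term.
  shift-size : size (shift a b f) ≡ size f
  shift-size = *-cancelˡ-≡ _ _ 2 (begin
      2 * size f′
        ≡⟨ double (size f′) ⟩
      size f′ + size f′
        ≡⟨ cong (size f′ +_) (sym (∑∑-swap a b (λ u v → # (f′ u v)))) ⟩
      size f′ + sum (λ u → sum (λ v → # (f′ (τ u) (τ v))))
        ≡⟨ sym (∑∑-+ (λ u v → # (f′ u v)) (λ u v → # (f′ (τ u) (τ v)))) ⟩
      sum (λ u → sum (λ v → # (f′ u v) + # (f′ (τ u) (τ v))))
        ≡⟨ ∑∑-cong (λ u v → trans (cong (λ z → # (f′ u v) + # z) (shift-τ u v)) (shiftVal-sum (f u v) (f (τ u) (τ v)) (wt u v) (wt (τ u) (τ v)))) ⟩
      sum (λ u → sum (λ v → # (f u v) + # (f (τ u) (τ v))))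
        ≡⟨ ∑∑-+ (λ u v → # (f u v)) (λ u v → # (f (τ u) (τ v))) ⟩
      size f + sum (λ u → sum (λ v → # (f (τ u) (τ v))))
        ≡⟨ cong (size f +_) (∑∑-swap a b (λ u v → # (f u v))) ⟩
      size f + size f
        ≡⟨ sym (double (size f)) ⟩
      2 * size f ∎)
    where
      open ≡-Reasoning
      f′ = shift a b f
      double : ∀ x → 2 * x ≡ x + x
      double = solve-∀

  private
    g g′ : Fin N → Fin N → ℕ
    g u v = # (f u v) * wt u v
    g′ u v = # (shift a b f u v) * wt u v

    pointwise : ∀ u v → g′ u v + g′ (τ u) (τ v) ≤ g u v + g (τ u) (τ v)
    pointwise u v = ≤-trans (≤-reflexive (cong (λ z → g′ u v + # z * wt (τ u) (τ v)) (shift-τ u v)))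
                            (shiftVal-weight (f u v) (f (τ u) (τ v)) (wt u v) (wt (τ u) (τ v)))

    fold : ∀ k → sum (λ u → sum (λ v → k u v + k (τ u) (τ v))) ≡ sum (λ u → sum (k u)) + sum (λ u → sum (k u))
    fold k = trans (∑∑-+ k (λ u v → k (τ u) (τ v))) (cong (sum (λ u → sum (k u)) +_) (∑∑-swap a b k))

    halve-≤ : ∀ {x y} → x + x ≤ y + y → x ≤ y
    halve-≤ {x} {y} le with x ≤? y
    ... | yes p = p
    ... | no ¬p = ⊥-elim (<-irrefl refl (<-≤-trans (+-mono-< (≰⇒> ¬p) (≰⇒> ¬p)) le))

    halve-< : ∀ {x y} → x + x < y + y → x < y
    halve-< {x} {y} lt with x <? y
    ... | yes p = p
    ... | no ¬p = ⊥-elim (<-irrefl refl (<-≤-trans lt (+-mono-≤ (≮⇒≥ ¬p) (≮⇒≥ ¬p))))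

  shift-potential : potential (shift a b f) ≤ potential f
  shift-potential = halve-≤ (subst₂ _≤_ (fold g′) (fold g) (∑∑-mono pointwise))

  shift-potential-< : ∀ c → toℕ a < toℕ b → c ≢ a → c ≢ b → f b c ≡ true → f a c ≡ false →
                      potential (shift a b f) < potential f
  shift-potential-< c lt c≢a c≢b fbc fac =
    halve-< (subst₂ _<_ (fold g′) (fold g)
      (∑-mono-< (λ u → ∑-mono (pointwise u)) b (∑-mono-< (pointwise b) c strict)))
    where
      lighter : wt (τ b) (τ c) < wt b c
      lighter = subst₂ (λ x y → wt x y < wt b c) (sym (swap-right a b)) (sym (swap-other a b c c≢a c≢b)) (+-monoˡ-< (toℕ c) lt)
      fτ : f (τ b) (τ c) ≡ false
      fτ = trans (cong₂ f (swap-right a b) (swap-other a b c c≢a c≢b)) fac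
      strict : g′ b c + g′ (τ b) (τ c) < g b c + g (τ b) (τ c)
      strict = ≤-<-trans (≤-reflexive (cong (λ z → g′ b c + # z * wt (τ b) (τ c)) (shift-τ b c)))
        (subst₂ (λ x y → # (shiftVal x y (wt b c) (wt (τ b) (τ c))) * wt b c
                         + # (shiftVal y x (wt (τ b) (τ c)) (wt b c)) * wt (τ b) (τ c)
                         < # x * wt b c + # y * wt (τ b) (τ c))
                (sym fbc) (sym fτ) (shiftVal-weight-< (wt b c) (wt (τ b) (τ c)) lighter))

  shift-sym : SymG f → SymG (shift a b f)
  shift-sym s u v rewrite s u v | s (τ u) (τ v) | +-comm (toℕ u) (toℕ v) | +-comm (toℕ (τ u)) (toℕ (τ v)) = refl

  shift-irr : IrrG f → IrrG (shift a b f)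
  shift-irr irr u rewrite irr u | irr (τ u) with <-cmp (wt u u) (wt (τ u) (τ u))
  ... | tri< _ _ _ = refl
  ... | tri≈ _ _ _ = refl
  ... | tri> _ _ _ = refl

  -- An edge is created only at a pair lighter than its image, and the transposition cannot raise
  -- the weight of a pair that avoids `a`.
  shift-new : toℕ a < toℕ b → ∀ u v → u ≢ v → shift a b f u v ≡ true → f u v ≡ false →
              (u ≡ a ⊎ v ≡ a) × f (τ u) (τ v) ≡ true
  shift-new lt u v u≢v new old = which (u ≟ᶠ a) (v ≟ᶠ a) (u ≟ᶠ b) (v ≟ᶠ b) , proj₁ y,w
    where
      y,w = shiftVal-new _ _ _ _ new old
      p = proj₂ y,w
      absurd : ∀ {u′ v′} → τ u ≡ u′ → τ v ≡ v′ → wt u′ v′ ≤ wt u v → ⊥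
      absurd refl refl le = <-irrefl refl (<-≤-trans p le)
      which : Dec (u ≡ a) → Dec (v ≡ a) → Dec (u ≡ b) → Dec (v ≡ b) → u ≡ a ⊎ v ≡ a
      which (yes q) _       _          _          = inj₁ q
      which (no _)  (yes q) _          _          = inj₂ q
      which (no r)  (no s)  (yes refl) (yes refl) = ⊥-elim (u≢v refl)
      which (no r)  (no s)  (yes refl) (no t)     =
        ⊥-elim (absurd (swap-right a u) (swap-other a u v s t) (<⇒≤ (+-monoˡ-< (toℕ v) lt)))
      which (no r)  (no s)  (no t)     (yes refl) =
        ⊥-elim (absurd (swap-other a v u r t) (swap-right a v) (<⇒≤ (+-monoʳ-< (toℕ u) lt)))
      which (no r)  (no s)  (no t)     (no t′)    =
        ⊥-elim (absurd (swap-other a b u r t) (swap-other a b v s t′) ≤-refl)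

  -- A pair containing `b` but not `a` is heavier than its image, so it survives only if both were
  -- present; a pair avoiding both is its own image.
  shift-swapped : toℕ a < toℕ b → ∀ u v → u ≢ v → u ≢ a → v ≢ a → shift a b f u v ≡ true → f (τ u) (τ v) ≡ true
  shift-swapped lt u v u≢v u≢a v≢a new = go (u ≟ᶠ b) (v ≟ᶠ b)
    where
      heavy : ∀ {u′ v′} → τ u ≡ u′ → τ v ≡ v′ → wt u′ v′ < wt u v → f (τ u) (τ v) ≡ true
      heavy refl refl p = shiftVal-heavy _ _ _ _ p new
      go : Dec (u ≡ b) → Dec (v ≡ b) → f (τ u) (τ v) ≡ true
      go (yes refl) (yes refl) = ⊥-elim (u≢v refl)
      go (yes refl) (no v≢b) = heavy (swap-right a u) (swap-other a u v v≢a v≢b) (+-monoˡ-< (toℕ v) lt)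
      go (no u≢b) (yes refl) = heavy (swap-other a v u u≢a u≢b) (swap-right a v) (+-monoʳ-< (toℕ u) lt)
      go (no u≢b) (no v≢b) = trans (cong₂ f τu τv) (trans (sym (shiftVal-≈ _ _ _ _ (sym (cong₂ wt τu τv)))) new)
        where
          τu = swap-other a b u u≢a u≢b
          τv = swap-other a b v v≢a v≢b

Stable : ∀ {N} → Graph N → Set
Stable f = ∀ a b c → toℕ a < toℕ b → c ≢ a → c ≢ b → f b c ≡ true → f a c ≡ true

stable-down : ∀ {N} {f : Graph N} → SymG f → IrrG f → Stable f → ∀ i k u v → toℕ i < toℕ k →
              toℕ i ≤ toℕ u → toℕ k ≤ toℕ v → f u v ≡ true → f i k ≡ true
stable-down {f = f} symf irr st i k u v i<k i≤u k≤v fuv = go (u ≟ᶠ k)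
  where
    u≢v : u ≢ v
    u≢v refl = true≢false fuv (irr u)
    ≤⇒< : ∀ {x y : Fin _} → toℕ x ≤ toℕ y → x ≢ y → toℕ x < toℕ y
    ≤⇒< le ne = ≤∧≢⇒< le (ne ∘ toℕ-injective)
    k≢i : k ≢ i
    k≢i refl = <-irrefl refl i<k
    lower-v : u ≢ k → f u k ≡ true
    lower-v u≢k with v ≟ᶠ k
    ... | yes refl = fuv
    ... | no v≢k = trans (symf u k) (st k v u (≤⇒< k≤v (v≢k ∘ sym)) u≢k u≢v (trans (symf v u) fuv))
    go : Dec (u ≡ k) → f i k ≡ true
    go (yes refl) = st i v k (<-≤-trans i<k k≤v) k≢i u≢v (trans (symf v k) fuv)
    go (no u≢k) with u ≟ᶠ i
    ... | yes refl = lower-v u≢k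
    ... | no u≢i   = st i u k (≤⇒< i≤u (u≢i ∘ sym)) k≢i (u≢k ∘ sym) (lower-v u≢k)

indicator : ∀ {A : Set} → Dec A → ℕ
indicator (yes _) = 1
indicator (no _)  = 0

below : ∀ {N} → ℕ → Fin N → ℕ
below K u = indicator (toℕ u <? K)

∑-below : ∀ {N} K → K ≤ N → sum {N} (below K) ≡ K
∑-below {N} zero le = ∑-zero {N} {below 0} (λ _ → refl)
∑-below {suc N} (suc K) (s≤s le) = cong suc (trans (sum-cong-≗ {N} tail-below) (∑-below {N} K le))
  where
    tail-below : ∀ (u : Fin N) → below (suc K) (suc u) ≡ below K u
    tail-below u with toℕ u <? K | suc (toℕ u) <? suc K
    ... | yes _ | yes _ = refl
    ... | no _  | no _  = refl
    ... | yes p | no q  = ⊥-elim (q (s≤s p))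
    ... | no p  | yes (s≤s q) = ⊥-elim (p q)

-- By `stable-down`, every edge has an end below `i` or both ends below `k`; there are
-- `k² + 2i(N − k)` ordered pairs of this kind.
stable-size : ∀ {N} {f : Graph N} → SymG f → IrrG f → Stable f → ∀ i k → toℕ i < toℕ k → f i k ≡ false →
              size f + 2 * (toℕ i * toℕ k) ≤ toℕ k * toℕ k + 2 * (toℕ i * N)
stable-size {N} {f} symf irr st i k i<k fik = begin
    size f + 2 * (I * K)
      ≡⟨ cong (size f +_) (cong₂ (λ x y → 2 * (x * y)) (sym ∑ι) (sym ∑κ)) ⟩
    size f + 2 * (sum ι * sum κ)
      ≡⟨ cong (size f +_) (trans (solve₁ (sum ι) (sum κ)) (cong₂ _+_ (sym (∑-prod ι κ)) (sym (∑-prod κ ι)))) ⟩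
    size f + (sum (λ u → sum (λ v → ι u * κ v)) + sum (λ u → sum (λ v → κ u * ι v)))
      ≡⟨ cong (size f +_) (sym (∑∑-+ (λ u v → ι u * κ v) (λ u v → κ u * ι v))) ⟩
    size f + sum (λ u → sum (λ v → ι u * κ v + κ u * ι v))
      ≡⟨ sym (∑∑-+ (λ u v → # (f u v)) (λ u v → ι u * κ v + κ u * ι v)) ⟩
    sum (λ u → sum (λ v → # (f u v) + (ι u * κ v + κ u * ι v)))
      ≤⟨ ∑∑-mono pointwise ⟩
    sum (λ u → sum (λ v → κ u * κ v + (ι u * 1 + 1 * ι v)))
      ≡⟨ ∑∑-+ (λ u v → κ u * κ v) (λ u v → ι u * 1 + 1 * ι v) ⟩
    sum (λ u → sum (λ v → κ u * κ v)) + sum (λ u → sum {N} (λ v → ι u * 1 + 1 * ι v))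
      ≡⟨ cong₂ _+_ (∑-prod κ κ) (trans (∑∑-+ (λ u (v : Fin N) → ι u * 1) (λ (u : Fin N) v → 1 * ι v)) (cong₂ _+_ (∑-prod {N} {N} ι (λ _ → 1)) (∑-prod {N} {N} (λ _ → 1) ι))) ⟩
    sum κ * sum κ + (sum ι * sum {N} (λ _ → 1) + sum {N} (λ _ → 1) * sum ι)
      ≡⟨ cong₂ (λ x y → x * x + (y * sum {N} (λ _ → 1) + sum {N} (λ _ → 1) * y)) ∑κ ∑ι ⟩
    K * K + (I * sum {N} (λ _ → 1) + sum {N} (λ _ → 1) * I)
      ≡⟨ cong (λ x → K * K + (I * x + x * I)) (trans (∑-const N 1) (*-identityʳ N)) ⟩
    K * K + (I * N + N * I)
      ≡⟨ solve₂ K I N ⟩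
    K * K + 2 * (I * N) ∎
  where
    open ≤-Reasoning
    I K : ℕ
    I = toℕ i
    K = toℕ k
    ι κ : Fin N → ℕ
    ι = below I
    κ = below K
    ∑ι : sum ι ≡ I
    ∑ι = ∑-below I (<⇒≤ (toℕ<n i))
    ∑κ : sum κ ≡ K
    ∑κ = ∑-below K (<⇒≤ (toℕ<n k))
    solve₁ : ∀ x y → 2 * (x * y) ≡ x * y + y * x
    solve₁ = solve-∀
    solve₂ : ∀ x y z → x * x + (y * z + z * y) ≡ x * x + 2 * (y * z)
    solve₂ = solve-∀
    no-edge : ∀ u v → I ≤ toℕ u → K ≤ toℕ v → f u v ≡ true → ⊥
    no-edge u v p q fuv = true≢false (stable-down symf irr st i k u v i<k p q fuv) fik
    pointwise : ∀ u v → # (f u v) + (ι u * κ v + κ u * ι v) ≤ κ u * κ v + (ι u * 1 + 1 * ι v)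
    pointwise u v with f u v in fuv | toℕ u <? I | toℕ v <? I | toℕ u <? K | toℕ v <? K
    ... | _ | yes p | _ | no q | _ = ⊥-elim (q (<-trans p i<k))
    ... | _ | _ | yes p | _ | no q = ⊥-elim (q (<-trans p i<k))
    ... | true | no p | _ | _ | no q = ⊥-elim (no-edge u v (≮⇒≥ p) (≮⇒≥ q) fuv)
    ... | true | _ | no p | no q | _ = ⊥-elim (no-edge v u (≮⇒≥ p) (≮⇒≥ q) (trans (symf v u) fuv))
    ... | true | yes _ | yes _ | yes _ | yes _ = ≤-refl
    ... | true | yes _ | no _ | yes _ | yes _ = ≤-refl
    ... | true | no _ | yes _ | yes _ | yes _ = ≤-refl
    ... | true | no _ | no _ | yes _ | yes _ = ≤-refl
    ... | true | yes _ | no _ | yes _ | no _ = ≤-refl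
    ... | true | no _ | yes _ | no _ | yes _ = ≤-refl
    ... | false | yes _ | yes _ | yes _ | yes _ = s≤s (s≤s z≤n)
    ... | false | yes _ | no _ | yes _ | yes _ = s≤s z≤n
    ... | false | no _ | yes _ | yes _ | yes _ = s≤s z≤n
    ... | false | no _ | no _ | yes _ | yes _ = z≤n
    ... | false | yes _ | no _ | yes _ | no _ = z≤n
    ... | false | no _ | no _ | yes _ | no _ = z≤n
    ... | false | no _ | yes _ | no _ | yes _ = z≤n
    ... | false | no _ | no _ | no _ | yes _ = z≤n
    ... | false | no _ | no _ | no _ | no _ = z≤n

-- Rainbow matchings in families of graphs

permutation-injective : ∀ {N} (π : Permutation′ N) {x y} → π ⟨$⟩ʳ x ≡ π ⟨$⟩ʳ y → x ≡ y
permutation-injective π eq = trans (sym (inverseˡ π)) (trans (cong (π ⟨$⟩ˡ_) eq) (inverseˡ π))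

-- A rainbow matching is a permutation of the vertices: the slots lo i and hi i receive
-- the ends of the i-th edge, the other slots the unmatched vertices.
module Rainbow {N k} (lo hi : Fin k → Fin N) (lo<hi : ∀ i → toℕ (lo i) < toℕ (hi i))
  (lo-inj : ∀ {i j} → lo i ≡ lo j → i ≡ j) (hi-inj : ∀ {i j} → hi i ≡ hi j → i ≡ j) (lo≢hi : ∀ i j → lo i ≢ hi j) where

  NoRainbow : (Fin k → Graph N) → Set
  NoRainbow F = ∀ (π : Permutation′ N) → ¬ (∀ i → F i (π ⟨$⟩ʳ lo i) (π ⟨$⟩ʳ hi i) ≡ true)

  -- Take a rainbow matching of the shifted family. If none of its edges is new, it is one for `F`.
  -- If the `i`-th edge is new, it contains `a`, so all the others avoid `a`, and transposing the
  -- entire matching yields one for `F`.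
  shift-noRainbow : ∀ a b → toℕ a < toℕ b → ∀ F → NoRainbow F → NoRainbow (λ i → shift a b (F i))
  shift-noRainbow a b lt F none π ok = none π (λ i → ¬false (λ old → none (π ∘ₚ swapₚ a b) (swapped i old)))
    where
      ¬false : ∀ {x} → (x ≡ false → ⊥) → x ≡ true
      ¬false {true}  _ = refl
      ¬false {false} r = ⊥-elim (r refl)
      swapped : ∀ i → F i (π ⟨$⟩ʳ lo i) (π ⟨$⟩ʳ hi i) ≡ false → ∀ j → F j (swap a b (π ⟨$⟩ʳ lo j)) (swap a b (π ⟨$⟩ʳ hi j)) ≡ true
      swapped i old j = go (j ≟ᶠ i)
        where
          new = shift-new a b (F i) lt _ _ (lo≢hi i i ∘ permutation-injective π) (ok i) old
          only : ∀ {x} → lo i ≢ x → hi i ≢ x → π ⟨$⟩ʳ x ≢ a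
          only p q eq with proj₁ new
          ... | inj₁ r = p (permutation-injective π (trans r (sym eq)))
          ... | inj₂ r = q (permutation-injective π (trans r (sym eq)))
          go : Dec (j ≡ i) → F j (swap a b (π ⟨$⟩ʳ lo j)) (swap a b (π ⟨$⟩ʳ hi j)) ≡ true
          go (yes refl) = proj₂ new
          go (no j≢i) = shift-swapped a b (F j) lt _ _ (lo≢hi j j ∘ permutation-injective π)
            (only (j≢i ∘ sym ∘ lo-inj) (λ eq → lo≢hi j i (sym eq)))
            (only (lo≢hi i j) (j≢i ∘ sym ∘ hi-inj)) (ok j)

  -- Induction on the total potential. A graph that is not stable admits a shift that lowers the
  -- potential and keeps all sizes. If all are stable, the size condition and `stable-size` make
  -- `lo i`, `hi i` an edge of `F i`, and the identity permutation is a rainbow matching.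
  rainbow : ∀ (F : Fin k → Graph N) → (∀ i → SymG (F i)) → (∀ i → IrrG (F i)) →
            (∀ i → toℕ (hi i) * toℕ (hi i) + 2 * (toℕ (lo i) * N) < size (F i) + 2 * (toℕ (lo i) * toℕ (hi i))) →
            ¬ NoRainbow F
  rainbow F = go F (<-wellFounded _)
    where
      Φ : (Fin k → Graph N) → ℕ
      Φ F = sum (λ i → potential (F i))
      go : ∀ F → Acc _<_ (Φ F) → (∀ i → SymG (F i)) → (∀ i → IrrG (F i)) →
           (∀ i → toℕ (hi i) * toℕ (hi i) + 2 * (toℕ (lo i) * N) < size (F i) + 2 * (toℕ (lo i) * toℕ (hi i))) →
           ¬ NoRainbow F
      go F (acc rec) symF irrF big none = none idₚ edge
        where
          stable : ∀ i → Stable (F i)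
          stable i a b c lt c≢a c≢b fbc with F i a c in fac
          ... | true  = refl
          ... | false = ⊥-elim (go (λ j → shift a b (F j))
                  (rec (∑-mono-< (λ j → shift-potential a b (F j)) i (shift-potential-< a b (F i) c lt c≢a c≢b fbc fac)))
                  (λ j → shift-sym a b (F j) (symF j)) (λ j → shift-irr a b (F j) (irrF j))
                  (λ j → subst (λ s → toℕ (hi j) * toℕ (hi j) + 2 * (toℕ (lo j) * N) < s + 2 * (toℕ (lo j) * toℕ (hi j))) (sym (shift-size a b (F j))) (big j))
                  (shift-noRainbow a b lt F none))
          edge : ∀ i → F i (lo i) (hi i) ≡ true
          edge i with F i (lo i) (hi i) in eq
          ... | true  = refl
          ... | false = ⊥-elim (<-irrefl refl (<-≤-trans (big i) (stable-size (symF i) (irrF i) (stable i) (lo i) (hi i) (lo<hi i) eq)))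

-- Tight pairs of blocks

-- perm o s, for s in ℤ/3, is k ↦ s + k (o = 0) or k ↦ s − k (o = 1): all six permutations.
perm : Fin 2 → Fin 3 → Fin 3 → Fin 3
perm 0F 0F k  = k
perm 0F 1F 0F = 1F
perm 0F 1F 1F = 2F
perm 0F 1F 2F = 0F
perm 0F 2F 0F = 2F
perm 0F 2F 1F = 0F
perm 0F 2F 2F = 1F
perm 1F 0F 0F = 0F
perm 1F 0F 1F = 2F
perm 1F 0F 2F = 1F
perm 1F 1F 0F = 1F
perm 1F 1F 1F = 0F
perm 1F 1F 2F = 2F
perm 1F 2F 0F = 2F
perm 1F 2F 1F = 1F
perm 1F 2F 2F = 0F

-- The remaining index for distinct arguments. On equal ones the value is chosen so that `k`,
-- `third k k`, `third k (third k k)` always exhaust `Fin 3`.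
third : Fin 3 → Fin 3 → Fin 3
third 0F 0F = 1F
third 0F 1F = 2F
third 0F 2F = 1F
third 1F 0F = 2F
third 1F 1F = 2F
third 1F 2F = 0F
third 2F 0F = 1F
third 2F 1F = 0F
third 2F 2F = 0F

abstract
  third≢ˡ : ∀ i j → third i j ≢ i
  third≢ˡ = from-yes (all? λ i → all? λ j → ¬? (third i j ≟ᶠ i))

  third≢ʳ : ∀ i j → third i j ≢ j
  third≢ʳ = from-yes (all? λ i → all? λ j → ¬? (third i j ≟ᶠ j))

  third-comm : ∀ i j → third i j ≡ third j i
  third-comm = from-yes (all? λ i → all? λ j → third i j ≟ᶠ third j i)

  perm-surjective : ∀ o s a → ∃ λ k → perm o s k ≡ a
  perm-surjective = from-yes (all? λ o → all? λ s → all? λ a → any? λ k → perm o s k ≟ᶠ a)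

  perm-through : ∀ i j a b → i ≢ j → a ≢ b → ∃ λ o → ∃ λ s → perm o s i ≡ a × perm o s j ≡ b × perm o s (third i j) ≡ third a b
  perm-through = from-yes (all? λ i → all? λ j → all? λ a → all? λ b → ¬? (i ≟ᶠ j) →-dec (¬? (a ≟ᶠ b) →-dec
    any? λ o → any? λ s → (perm o s i ≟ᶠ a) ×-dec ((perm o s j ≟ᶠ b) ×-dec (perm o s (third i j) ≟ᶠ third a b))))

private
  sum3₁ : ∀ x y z → y + (z + (x + 0)) ≡ x + (y + (z + 0))
  sum3₁ = solve-∀
  sum3₂ : ∀ x y z → z + (x + (y + 0)) ≡ x + (y + (z + 0))
  sum3₂ = solve-∀
  sum3₃ : ∀ x y z → x + (z + (y + 0)) ≡ x + (y + (z + 0))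
  sum3₃ = solve-∀
  sum3₄ : ∀ x y z → y + (x + (z + 0)) ≡ x + (y + (z + 0))
  sum3₄ = solve-∀
  sum3₅ : ∀ x y z → z + (y + (x + 0)) ≡ x + (y + (z + 0))
  sum3₅ = solve-∀

∑-perm : ∀ o k (f : Fin 3 → ℕ) → sum (λ s → f (perm o s k)) ≡ sum f
∑-perm 0F 0F f = refl
∑-perm 0F 1F f = sum3₁ (f 0F) (f 1F) (f 2F)
∑-perm 0F 2F f = sum3₂ (f 0F) (f 1F) (f 2F)
∑-perm 1F 0F f = refl
∑-perm 1F 1F f = sum3₂ (f 0F) (f 1F) (f 2F)
∑-perm 1F 2F f = sum3₁ (f 0F) (f 1F) (f 2F)

∑-third : ∀ i j → i ≢ j → (f : Fin 3 → ℕ) → f i + (f j + (f (third i j) + 0)) ≡ sum f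
∑-third 0F 0F ne f = ⊥-elim (ne refl)
∑-third 0F 1F ne f = refl
∑-third 0F 2F ne f = sum3₃ (f 0F) (f 1F) (f 2F)
∑-third 1F 0F ne f = sum3₄ (f 0F) (f 1F) (f 2F)
∑-third 1F 1F ne f = ⊥-elim (ne refl)
∑-third 1F 2F ne f = sum3₁ (f 0F) (f 1F) (f 2F)
∑-third 2F 0F ne f = sum3₂ (f 0F) (f 1F) (f 2F)
∑-third 2F 1F ne f = sum3₅ (f 0F) (f 1F) (f 2F)
∑-third 2F 2F ne f = ⊥-elim (ne refl)

-- Cells of the 3 × 3 × 3 cube that meet every diagonal

Cube : Set
Cube = Fin 3 → Fin 3 → Fin 3 → Bool

volume : Cube → ℕ
volume Z = sum (λ k → sum (λ a → sum (λ b → # (Z k a b))))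

diagonal : Cube → Fin 2 → Fin 2 → Fin 3 → Fin 3 → ℕ
diagonal Z o o′ s t = sum (λ k → # (Z k (perm o s k) (perm o′ t k)))

-- The 36 diagonals split into four partitions of the 27 cells into nine diagonals.
∑-diagonal : ∀ Z o o′ → sum (λ s → sum (λ t → diagonal Z o o′ s t)) ≡ volume Z
∑-diagonal Z o o′ = begin
    sum (λ s → sum (λ t → sum (λ k → c k (perm o s k) (perm o′ t k))))
      ≡⟨ sum-cong-≗ (λ s → ∑-comm (λ t k → c k (perm o s k) (perm o′ t k))) ⟩
    sum (λ s → sum (λ k → sum (λ t → c k (perm o s k) (perm o′ t k))))
      ≡⟨ ∑-comm (λ s k → sum (λ t → c k (perm o s k) (perm o′ t k))) ⟩
    sum (λ k → sum (λ s → sum (λ t → c k (perm o s k) (perm o′ t k))))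
      ≡⟨ ∑∑-cong (λ k s → ∑-perm o′ k (c k (perm o s k))) ⟩
    sum (λ k → sum (λ s → sum (λ b → c k (perm o s k) b)))
      ≡⟨ sum-cong-≗ (λ k → ∑-perm o k (λ a → sum (c k a))) ⟩
    volume Z ∎
  where
    open ≡-Reasoning
    c : Fin 3 → Fin 3 → Fin 3 → ℕ
    c k a b = # (Z k a b)

Hit : Cube → Set
Hit Z = ∀ o o′ s t → 1 ≤ diagonal Z o o′ s t

hit-volume : ∀ Z → Hit Z → 9 ≤ volume Z
hit-volume Z hit = subst (9 ≤_) (∑-diagonal Z 0F 0F) (∑∑-mono {3} {3} {λ _ _ → 1} (λ s t → hit 0F 0F s t))

-- Each of the four partitions has nine diagonals, all of them hit; nine cells leave none for a
-- second hit.
hit-once : ∀ Z → Hit Z → volume Z ≤ 9 → ∀ o o′ s t → diagonal Z o o′ s t ≡ 1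
hit-once Z hit small o o′ s t with diagonal Z o o′ s t ≤? 1
... | yes le = ≤-antisym le (hit o o′ s t)
... | no ¬le = ⊥-elim (<-irrefl refl (<-≤-trans (subst (9 <_) (∑-diagonal Z o o′)
        (∑-mono-< {f = λ _ → 3} (λ s → ∑-mono {f = λ _ → 1} (hit o o′ s)) s (∑-mono-< {f = λ _ → 1} (hit o o′ s) t (≰⇒> ¬le)))) small))

data Plane : Set where
  colour rowˡ rowʳ : Fin 3 → Plane

on : Plane → Cube
on (colour i) k a b = does (k ≟ᶠ i)
on (rowˡ i)   k a b = does (a ≟ᶠ i)
on (rowʳ i)   k a b = does (b ≟ᶠ i)

does-refl : ∀ {n} (i : Fin n) → does (i ≟ᶠ i) ≡ true
does-refl i with i ≟ᶠ i
... | yes _ = refl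
... | no ne = ⊥-elim (ne refl)

does-≢ : ∀ {n} {i j : Fin n} → i ≢ j → does (i ≟ᶠ j) ≡ false
does-≢ {i = i} {j} ne with i ≟ᶠ j
... | yes p = ⊥-elim (ne p)
... | no _  = refl

private
  one₁ : ∀ {x y z} → # x + (# y + (# z + 0)) ≡ 1 → x ≡ true → y ≡ false × z ≡ false
  one₁ {true} {false} {false} _ refl = refl , refl
  one₁ {true} {true}  {true}  () refl
  one₁ {true} {true}  {false} () refl
  one₁ {true} {false} {true}  () refl

  one₂ : ∀ {x y z} → # x + (# y + (# z + 0)) ≡ 1 → x ≡ false → z ≡ false → y ≡ true
  one₂ {false} {true} _ refl refl = refl
  one₂ {false} {false} () refl refl

  one₃ : ∀ {x y z} → # x + (# y + (# z + 0)) ≡ 1 → y ≡ false → z ≡ false → x ≡ true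
  one₃ {true} _ refl refl = refl
  one₃ {false} () refl refl

module ExactCube (Z : Cube) (once : ∀ o o′ s t → diagonal Z o o′ s t ≡ 1) where

  exact : ∀ i j a a′ b b′ → i ≢ j → a ≢ a′ → b ≢ b′ →
          # (Z i a b) + (# (Z j a′ b′) + (# (Z (third i j) (third a a′) (third b b′)) + 0)) ≡ 1
  exact i j a a′ b b′ ij aa bb
    with perm-through i j a a′ ij aa | perm-through i j b b′ ij bb
  ... | o , s , refl , refl , p | o′ , t , refl , refl , q
    rewrite sym p | sym q =
      trans (∑-third i j ij (λ k → # (Z k (perm o s k) (perm o′ t k)))) (once o o′ s t)

  -- Two diagonals that share their third cell are compared. The one through `(i, a, b)` already has
  -- its cell, so it excludes `(j, a′, b′)` and the third cell; the one through the empty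
  -- `(j, a, b)` must then use `(i, a′, b′)`.
  propagate : ∀ i j a b a′ b′ → i ≢ j → a ≢ a′ → b ≢ b′ → Z i a b ≡ true → Z j a b ≡ false →
              Z i a′ b′ ≡ true × Z j a′ b′ ≡ false
  propagate i j a b a′ b′ ij aa bb zi zj =
      one₂ (exact j i a a′ b b′ (ij ∘ sym) aa bb) zj (trans (cong (λ k → Z k (third a a′) (third b b′)) (third-comm j i)) (proj₂ r))
    , proj₁ r
    where r = one₁ (exact i j a a′ b b′ ij aa bb) zi

  -- A detour through coordinates different from both ends also reaches the cells that share a
  -- coordinate with the start.
  everywhere : ∀ i j a b a′ b′ → i ≢ j → Z i a b ≡ true → Z j a b ≡ false →
               Z i a′ b′ ≡ true × Z j a′ b′ ≡ false
  everywhere i j a b a′ b′ ij zi zj =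
    let (zi′ , zj′) = propagate i j a b (third a a′) (third b b′) ij (third≢ˡ a a′ ∘ sym) (third≢ˡ b b′ ∘ sym) zi zj
    in propagate i j (third a a′) (third b b′) a′ b′ ij (third≢ʳ a a′) (third≢ʳ b b′) zi′ zj′

  colour-case : ∀ i j a b → Z i a b ≡ true → Z j a b ≡ false → ∀ k c d → Z k c d ≡ on (colour i) k c d
  colour-case i j a b zi zj k c d = go (k ≟ᶠ i)
    where
      i≢j : i ≢ j
      i≢j refl = true≢false zi zj
      full : ∀ c d → Z i c d ≡ true
      full c d = proj₁ (everywhere i j a b c d i≢j zi zj)
      go : Dec (k ≡ i) → Z k c d ≡ does (k ≟ᶠ i)
      go (yes refl) = trans (full c d) (sym (does-refl k))
      go (no k≢i)   = trans (proj₁ (one₁ (exact i k (third c c) c (third d d) d (k≢i ∘ sym) (third≢ˡ c c) (third≢ˡ d d)) (full _ _)))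
                            (sym (does-≢ k≢i))

  module _ (same : ∀ i j a b → Z i a b ≡ Z j a b) where
    private
      z : Fin 3 → Fin 3 → Bool
      z = Z 0F

      exact-z : ∀ a a′ b b′ → a ≢ a′ → b ≢ b′ → # (z a b) + (# (z a′ b′) + (# (z (third a a′) (third b b′)) + 0)) ≡ 1
      exact-z a a′ b b′ aa bb =
        trans (cong₂ (λ x y → # (z a b) + (# x + (# y + 0))) (same 0F 1F a′ b′) (same 0F 2F (third a a′) (third b b′)))
              (exact 0F 1F a a′ b b′ (λ ()) aa bb)

      -- A 3 × 3 matrix with exactly one entry on each of its six transversals is a row or a column.
      -- The value at a second cell of row `a` decides which.
      row-case : ∀ a b → z a b ≡ true → (∀ c d → z c d ≡ does (c ≟ᶠ a)) ⊎ (∀ c d → z c d ≡ does (d ≟ᶠ b))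
      row-case a b zab = go (z a b⁺) refl
        where
          a⁺ = third a a
          b⁺ = third b b
          off : ∀ c d → c ≢ a → d ≢ b → z c d ≡ false
          off c d ca db = proj₁ (one₁ (exact-z a c b d (ca ∘ sym) (db ∘ sym)) zab)
          cross : ∀ c d → c ≢ a → d ≢ b → # (z a d) + (# (z c b) + (# (z (third a c) (third d b)) + 0)) ≡ 1
          cross c d ca db = exact-z a c d b (ca ∘ sym) db
          corner : ∀ c d → z (third a c) (third d b) ≡ false
          corner c d = off _ _ (third≢ˡ a c) (third≢ʳ d b)
          go : ∀ x → z a b⁺ ≡ x → (∀ c d → z c d ≡ does (c ≟ᶠ a)) ⊎ (∀ c d → z c d ≡ does (d ≟ᶠ b))
          go true zab⁺ = inj₁ row
            where
              column : ∀ c → c ≢ a → z c b ≡ false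
              column c ca = proj₁ (one₁ (cross c b⁺ ca (third≢ˡ b b)) zab⁺)
              row : ∀ c d → z c d ≡ does (c ≟ᶠ a)
              row c d with c ≟ᶠ a | d ≟ᶠ b
              ... | yes refl | yes refl = zab
              ... | yes refl | no db    = one₃ (cross a⁺ d (third≢ˡ c c) db) (column a⁺ (third≢ˡ c c)) (corner a⁺ d)
              ... | no ca    | yes refl = column c ca
              ... | no ca    | no db    = off c d ca db
          go false zab⁺ = inj₂ col
            where
              column : ∀ c → c ≢ a → z c b ≡ true
              column c ca = one₂ (cross c b⁺ ca (third≢ˡ b b)) zab⁺ (corner c b⁺)
              row : ∀ d → d ≢ b → z a d ≡ false
              row d db with z a d in eq
              ... | false = refl
              ... | true = ⊥-elim (true≢false (column a⁺ (third≢ˡ a a)) (proj₁ (one₁ (cross a⁺ d (third≢ˡ a a) db) eq)))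
              col : ∀ c d → z c d ≡ does (d ≟ᶠ b)
              col c d with c ≟ᶠ a | d ≟ᶠ b
              ... | yes refl | yes refl = zab
              ... | yes refl | no db    = row d db
              ... | no ca    | yes refl = column c ca
              ... | no ca    | no db    = off c d ca db

    common-plane : ∃ λ τ → ∀ k c d → Z k c d ≡ on τ k c d
    -- The main diagonal contains exactly one entry, and `row-case` starts from it.
    common-plane = scan (z 0F 0F) refl (z 1F 1F) refl
      where
        pack : ∀ a b → z a b ≡ true → ∃ λ τ → ∀ k c d → Z k c d ≡ on τ k c d
        pack a b zab with row-case a b zab
        ... | inj₁ r = rowˡ a , λ k c d → trans (same k 0F c d) (r c d)
        ... | inj₂ r = rowʳ b , λ k c d → trans (same k 0F c d) (r c d)
        scan : ∀ x → z 0F 0F ≡ x → ∀ y → z 1F 1F ≡ y → ∃ λ τ → ∀ k c d → Z k c d ≡ on τ k c d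
        scan true  p _     _ = pack 0F 0F p
        scan false _ true  q = pack 1F 1F q
        scan false p false q = pack 2F 2F (one₃ (exact-z 2F 0F 2F 0F (λ ()) (λ ())) p q)

  plane : ∃ λ τ → ∀ k c d → Z k c d ≡ on τ k c d
  plane with any? (λ i → any? (λ j → any? (λ a → any? (λ b → (Z i a b ≟ᵇ true) ×-dec (Z j a b ≟ᵇ false)))))
  ... | yes (i , j , a , b , zi , zj) = colour i , colour-case i j a b zi zj
  ... | no none = common-plane same
    where
      same : ∀ i j a b → Z i a b ≡ Z j a b
      same i j a b with Z i a b in p | Z j a b in q
      ... | true  | true  = refl
      ... | false | false = refl
      ... | true  | false = ⊥-elim (none (i , j , a , b , p , q))
      ... | false | true  = ⊥-elim (none (j , i , a , b , q , p))

tri : ∀ {V : Set} → V → V → V → Fin 3 → V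
tri x y z 0F = x
tri x y z 1F = y
tri x y z 2F = z

private
  clash : ∀ (i : Fin 3) (f : Fin 3 → Bool) x → (∀ c → does (c ≟ᶠ i) ≡ f c) → (∀ c → f c ≡ x) → ⊥
  clash i f x p q = true≢false (trans (sym (trans (p i) (q i))) (does-refl i))
                               (trans (sym (trans (p (third i i)) (q (third i i)))) (does-≢ (third≢ˡ i i)))

  does≢const : ∀ (i : Fin 3) x → ¬ (∀ c → does (c ≟ᶠ i) ≡ x)
  does≢const i x p = clash i (λ _ → x) x p (λ _ → refl)

-- This and the next two lemmas recognise a plane by its slice `0F`. In the applications that slice
-- belongs to the vertex `x k` kept in the new leftover, so it is known from the old one.
on-full : ∀ τ → (∀ c d → on τ 0F c d ≡ true) → τ ≡ colour 0F
on-full (colour 0F) p = refl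
on-full (colour 1F) p = ⊥-elim (true≢false (p 0F 0F) refl)
on-full (colour 2F) p = ⊥-elim (true≢false (p 0F 0F) refl)
on-full (rowˡ i) p = ⊥-elim (does≢const i true (λ c → p c 0F))
on-full (rowʳ i) p = ⊥-elim (does≢const i true (λ c → p 0F c))

on-empty : ∀ τ → (∀ c d → on τ 0F c d ≡ false) → τ ≡ colour 1F ⊎ τ ≡ colour 2F
on-empty (colour 0F) p = ⊥-elim (true≢false refl (p 0F 0F))
on-empty (colour 1F) p = inj₁ refl
on-empty (colour 2F) p = inj₂ refl
on-empty (rowˡ i) p = ⊥-elim (does≢const i false (λ c → p c 0F))
on-empty (rowʳ i) p = ⊥-elim (does≢const i false (λ c → p 0F c))

on-row : ∀ τ i → (∀ c d → on τ 0F c d ≡ does (c ≟ᶠ i)) → τ ≡ rowˡ i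
on-row (colour j) i p = ⊥-elim (does≢const i _ (λ c → sym (p c 0F)))
on-row (rowˡ j) i p with i ≟ᶠ j
... | yes refl = refl
... | no ne = ⊥-elim (true≢false (trans (p i 0F) (does-refl i)) (does-≢ ne))
on-row (rowʳ j) i p = ⊥-elim (clash i (λ c → does (0F ≟ᶠ j)) _ (λ c → sym (p c 0F)) (λ _ → refl))

private
  ≢-≢-≢ : ∀ {x y z : Bool} → x ≡ not y → z ≡ not y → x ≡ not z → ⊥
  ≢-≢-≢ {y = true}  refl refl ()
  ≢-≢-≢ {y = false} refl refl ()

-- Four blocks whose pairs are tight in every relevant state

module FourBlocks {V : Set} (N : V → V → V → Bool)
  (N12 : ∀ a b c → N a b c ≡ N b a c) (N23 : ∀ a b c → N a b c ≡ N a c b) (x : Fin 3 → V) where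

  Block : Set
  Block = Fin 3 → V

  Flat : Block → Block → Block → Set
  Flat y p q = ∃ λ τ → ∀ k a b → N (y k) (p a) (q b) ≡ on τ k a b

  -- Each non-edge of `x × p × q` becomes the leftover in turn, and the cube over the untouched
  -- blocks `r`, `s` must again be a plane.
  Follow : Block → Block → Block → Block → Set
  Follow p q r s = ∀ k a b → N (x k) (p a) (q b) ≡ true → Flat (tri (x k) (p a) (q b)) r s

  record Good (p q r s : Block) : Set where
    constructor good
    field
      flat₁   : Flat x p q
      flat₂   : Flat x r s
      follow₁ : Follow p q r s
      follow₂ : Follow r s p q
  open Good

  flat-flip : ∀ {y p q} → Flat y p q → Flat y q p
  flat-flip {y} {p} {q} (colour i , eq) = colour i , λ k a b → trans (N23 (y k) (q a) (p b)) (eq k b a)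
  flat-flip {y} {p} {q} (rowˡ i , eq)   = rowʳ i   , λ k a b → trans (N23 (y k) (q a) (p b)) (eq k b a)
  flat-flip {y} {p} {q} (rowʳ i , eq)   = rowˡ i   , λ k a b → trans (N23 (y k) (q a) (p b)) (eq k b a)

  flat-swap12 : ∀ {u v w p q} → Flat (tri u v w) p q → Flat (tri u w v) p q
  flat-swap12 (colour 0F , eq) = colour 0F , λ { 0F → eq 0F ; 1F → eq 2F ; 2F → eq 1F }
  flat-swap12 (colour 1F , eq) = colour 2F , λ { 0F → eq 0F ; 1F → eq 2F ; 2F → eq 1F }
  flat-swap12 (colour 2F , eq) = colour 1F , λ { 0F → eq 0F ; 1F → eq 2F ; 2F → eq 1F }
  flat-swap12 (rowˡ i , eq)    = rowˡ i , λ { 0F → eq 0F ; 1F → eq 2F ; 2F → eq 1F }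
  flat-swap12 (rowʳ i , eq)    = rowʳ i , λ { 0F → eq 0F ; 1F → eq 2F ; 2F → eq 1F }

  follow-flipʳ : ∀ {p q r s} → Follow p q r s → Follow p q s r
  follow-flipʳ st k a b eq = flat-flip (st k a b eq)

  follow-flipˡ : ∀ {p q r s} → Follow p q r s → Follow q p r s
  follow-flipˡ {p} {q} st k a b eq = flat-swap12 (st k b a (trans (N23 (x k) (p b) (q a)) eq))

  flipˡ : ∀ {p q r s} → Good p q r s → Good q p r s
  flipˡ (good a b c d) = good (flat-flip a) b (follow-flipˡ c) (follow-flipʳ d)

  flipʳ : ∀ {p q r s} → Good p q r s → Good p q s r
  flipʳ (good a b c d) = good a (flat-flip b) (follow-flipʳ c) (follow-flipˡ d)

  exchange : ∀ {p q r s} → Good p q r s → Good r s p q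
  exchange (good a b c d) = good b a d c

  Coloured : Fin 3 → Block → Block → Set
  Coloured i p q = ∀ k a b → N (x k) (p a) (q b) ≡ does (k ≟ᶠ i)

  -- A row plane read as an orientation: all its non-edges pass through one vertex of the source
  -- `p`. This turns the case analysis into one about orientations of the six pairs among four
  -- blocks.
  Arrow : Block → Block → Set
  Arrow p q = ∃ λ i → ∀ k a b → N (x k) (p a) (q b) ≡ does (a ≟ᶠ i)

  Arrows : Block → Block → Set
  Arrows p q = Arrow p q ⊎ Arrow q p

  turn-around : ∀ {p q} → Arrows p q → Arrows q p
  turn-around (inj₁ a) = inj₂ a
  turn-around (inj₂ a) = inj₁ a

  classify : ∀ {p q} → Flat x p q → (∃ λ i → Coloured i p q) ⊎ Arrows p q
  classify (colour i , eq) = inj₁ (i , eq)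
  classify (rowˡ i , eq)   = inj₂ (inj₁ (i , eq))
  classify {p} {q} (rowʳ i , eq) = inj₂ (inj₂ (i , λ k a b → trans (N23 (x k) (q a) (p b)) (eq k b a)))

  colour-flip : ∀ {i p q} → Coloured i p q → Coloured i q p
  colour-flip {i} {p} {q} eq k a b = trans (N23 (x k) (q a) (p b)) (eq k b a)

  arrow-antisym : ∀ {p q} → Arrow p q → Arrow q p → ⊥
  arrow-antisym {p} {q} (i , eq) (j , eq′) =
    does≢const i _ (λ a → trans (sym (eq 0F a 0F)) (trans (N23 (x 0F) (p a) (q 0F)) (eq′ 0F 0F a)))

  colour-arrow : ∀ {i p q} → Coloured i p q → Arrows p q → ⊥
  colour-arrow c (inj₁ (j , eq)) = does≢const j _ (λ a → trans (sym (eq 0F a 0F)) (c 0F a 0F))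
  colour-arrow c (inj₂ (j , eq)) = does≢const j _ (λ a → trans (sym (eq 0F a 0F)) (colour-flip c 0F a 0F))

  -- All three {xₖ, pᵢ, q₀} are leftovers; on r × s the one with k = j forces full links of pᵢ
  -- and q₀, the other two forbid them.
  arrow∦colour : ∀ {p q r s j} → Good p q r s → Arrow p q → Coloured j r s → ⊥
  arrow∦colour {p} {q} {r} {s} {j} G (i , arr) col = contra (follow₁ G j i 0F (hit j)) (follow₁ G (third j j) i 0F (hit (third j j)))
    where
      hit : ∀ k → N (x k) (p i) (q 0F) ≡ true
      hit k = trans (arr k i 0F) (does-refl i)
      contra : Flat (tri (x j) (p i) (q 0F)) r s → Flat (tri (x (third j j)) (p i) (q 0F)) r s → ⊥
      contra (τ , eq) (τ′ , eq′)
        with on-full τ (λ c d → trans (sym (eq 0F c d)) (trans (col j c d) (does-refl j)))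
           | on-empty τ′ (λ c d → trans (sym (eq′ 0F c d)) (trans (col (third j j) c d) (does-≢ (third≢ˡ j j))))
      ... | refl | inj₁ refl = true≢false (eq′ 1F 0F 0F) (eq 1F 0F 0F)
      ... | refl | inj₂ refl = true≢false (eq′ 2F 0F 0F) (eq 2F 0F 0F)

  -- With `{x₀, pᵢ, q_b}` as leftover, the slice of `x₀` on `r × s` is a row. Only a `rowˡ` plane
  -- has such a slice, so the slice of `q b` is the same row.
  arrow-link : ∀ {p q r s} → Good p q r s → Arrow p q → (rs : Arrow r s) →
               ∀ b c d → N (q b) (r c) (s d) ≡ does (c ≟ᶠ proj₁ rs)
  arrow-link {p} {q} {r} {s} G (i , arr) (j , arr′) b c d
    with follow₁ G 0F i b (trans (arr 0F i b) (does-refl i))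
  ... | τ , eq with on-row τ j (λ c d → trans (sym (eq 0F c d)) (arr′ 0F c d))
  ...   | refl = eq 2F c d

  -- Take `{xᵢ, p_a, q_b}` as leftover. On `r × s` the slice of `xᵢ` is full if `i ≡ j` and empty
  -- otherwise. If full, it is the entire plane, so the slices of `p a` and `q b` are empty. If
  -- empty, the plane is the slice of one of these two; varying `a` and `b` separately shows that
  -- the choice is always the same.
  colour-links : ∀ {p q r s i j} → Good p q r s → Coloured i p q → Coloured j r s →
    (i ≡ j × (∀ a c d → N (p a) (r c) (s d) ≡ false) × (∀ b c d → N (q b) (r c) (s d) ≡ false))
    ⊎ (i ≢ j × ∃ λ t → (∀ a c d → N (p a) (r c) (s d) ≡ t) × (∀ b c d → N (q b) (r c) (s d) ≡ not t))
  colour-links {p} {q} {r} {s} {i} {j} G cp cr = go (i ≟ᶠ j)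
    where
      st : ∀ a b → Flat (tri (x i) (p a) (q b)) r s
      st a b = follow₁ G i a b (trans (cp i a b) (does-refl i))
      full : i ≡ j → ∀ a b c d → N (p a) (r c) (s d) ≡ false × N (q b) (r c) (s d) ≡ false
      full refl a b c d with st a b
      ... | τ , eq with on-full τ (λ c d → trans (sym (eq 0F c d)) (trans (cr i c d) (does-refl i)))
      ...   | refl = eq 1F c d , eq 2F c d
      split : i ≢ j → ∀ a b → ∃ λ t → (∀ c d → N (p a) (r c) (s d) ≡ t) × (∀ c d → N (q b) (r c) (s d) ≡ not t)
      split ne a b with st a b
      ... | τ , eq with on-empty τ (λ c d → trans (sym (eq 0F c d)) (trans (cr i c d) (does-≢ ne)))
      ...   | inj₁ refl = true  , eq 1F , eq 2F
      ...   | inj₂ refl = false , eq 1F , eq 2F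
      not-inj : ∀ {u v} → not u ≡ not v → u ≡ v
      not-inj {true}  {true}  _ = refl
      not-inj {false} {false} _ = refl
      go : Dec (i ≡ j) → _
      go (yes e) = inj₁ (e , (λ a c d → proj₁ (full e a 0F c d)) , (λ b c d → proj₂ (full e 0F b c d)))
      go (no ne) = inj₂ (ne , t , left , right)
        where
          t = proj₁ (split ne 0F 0F)
          right : ∀ b c d → N (q b) (r c) (s d) ≡ not t
          right b c d = let (u , pu , qu) = split ne 0F b
                        in trans (qu c d) (cong not (trans (sym (pu 0F 0F)) (proj₁ (proj₂ (split ne 0F 0F)) 0F 0F)))
          left : ∀ a c d → N (p a) (r c) (s d) ≡ t
          left a c d = let (u , pu , qu) = split ne a 0F
                       in trans (pu c d) (not-inj (trans (sym (qu 0F 0F)) (right 0F 0F 0F)))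

  colour-const : ∀ {p q r s i j} → Good p q r s → Coloured i p q → Coloured j r s →
                 ∃ λ t → ∀ b c d → N (q b) (r c) (s d) ≡ t
  colour-const G cp cr with colour-links G cp cr
  ... | inj₁ (_ , _ , e)     = false , e
  ... | inj₂ (_ , t , _ , e) = not t , e

  record Quad (e f g h : Block) : Set where
    constructor quad
    field
      ef : Good e f g h
      eg : Good e g f h
      eh : Good e h f g
  open Quad

  swap₁₂ : ∀ {e f g h} → Quad e f g h → Quad f e g h
  swap₁₂ Q = quad (flipˡ (ef Q)) (exchange (eh Q)) (exchange (eg Q))

  swap₂₃ : ∀ {e f g h} → Quad e f g h → Quad e g f h
  swap₂₃ Q = quad (eg Q) (ef Q) (flipʳ (eh Q))

  swap₃₄ : ∀ {e f g h} → Quad e f g h → Quad e f h g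
  swap₃₄ Q = quad (flipʳ (ef Q)) (eh Q) (eg Q)

  facing-arrow : ∀ {p q r s} → Good p q r s → Arrow p q → Arrows r s
  facing-arrow G arr with classify (flat₂ G)
  ... | inj₂ a       = a
  ... | inj₁ (_ , c) = ⊥-elim (arrow∦colour G arr c)

  facing-arrows : ∀ {p q r s} → Good p q r s → Arrows p q → Arrows r s
  facing-arrows G (inj₁ a) = facing-arrow G a
  facing-arrows G (inj₂ a) = facing-arrow (flipˡ G) a

  facing-colour : ∀ {p q r s i} → Good p q r s → Coloured i p q → ∃ λ j → Coloured j r s
  facing-colour G c with classify (flat₂ G)
  ... | inj₁ c′ = c′
  ... | inj₂ a  = ⊥-elim (colour-arrow c (facing-arrows (exchange G) a))

  -- An arrow makes f × g × h nonconstant, a colour on e × g makes it constant.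
  spread : ∀ {e f g h} → Quad e f g h → Arrow e f → Arrows e g
  spread {e} {f} {g} {h} Q arr with classify (flat₁ (eg Q))
  ... | inj₂ a       = a
  ... | inj₁ (_ , c) = ⊥-elim (go (facing-arrow (ef Q) arr))
    where
      t = colour-const (eg Q) c (proj₂ (facing-colour (eg Q) c))
      flat : ∀ b c d → N (f b) (g c) (h d) ≡ proj₁ t
      flat b c d = trans (N12 (f b) (g c) (h d)) (proj₂ t c b d)
      go : Arrows g h → ⊥
      go (inj₁ a) = does≢const (proj₁ a) (proj₁ t) (λ c → trans (sym (arrow-link (ef Q) arr a 0F c 0F)) (flat 0F c 0F))
      go (inj₂ a) = does≢const (proj₁ a) (proj₁ t) (λ d → trans (sym (arrow-link (flipʳ (ef Q)) arr a 0F d 0F)) (trans (N23 (f 0F) (h d) (g 0F)) (flat 0F 0F d)))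

  -- By `arrow-link`, the non-edges of `f × g × h` depend only on the source of the arrow between
  -- `g` and `h`, and equally only on the source of the arrow between `f` and `h`. The two sources
  -- must be the same block, hence `h`.
  fork : ∀ {e f g h} → Quad e f g h → Arrow e f → Arrow e g → Arrow h f × Arrow h g
  fork {e} {f} {g} {h} Q e→f e→g with facing-arrow (ef Q) e→f | facing-arrow (eg Q) e→g
  ... | inj₂ h→g | inj₂ h→f = h→f , h→g
  ... | inj₁ g→h | inj₁ f→h = ⊥-elim (does≢const (proj₁ g→h) _ (λ c →
          trans (sym (arrow-link (ef Q) e→f g→h 0F c 0F)) (trans (N12 (f 0F) (g c) (h 0F)) (arrow-link (eg Q) e→g f→h c 0F 0F))))
  ... | inj₁ g→h | inj₂ h→f = ⊥-elim (does≢const (proj₁ g→h) _ (λ c →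
          trans (sym (arrow-link (ef Q) e→f g→h 0F c 0F)) (trans (N12 (f 0F) (g c) (h 0F))
            (trans (N23 (g c) (f 0F) (h 0F)) (arrow-link (flipʳ (eg Q)) e→g h→f c 0F 0F)))))
  ... | inj₂ h→g | inj₁ f→h = ⊥-elim (does≢const (proj₁ h→g) _ (λ d →
          trans (sym (arrow-link (flipʳ (ef Q)) e→f h→g 0F d 0F)) (trans (N23 (f 0F) (h d) (g 0F))
            (trans (N12 (f 0F) (g 0F) (h d)) (arrow-link (eg Q) e→g f→h 0F 0F d)))))

  -- If `e → h`, a second fork yields `g → h` against `h → g`. If `h → e`, then `h → e` and `h → f`
  -- form a fork at `h`, which yields `g → e` against `e → g`.
  no-fork : ∀ {e f g h} → Quad e f g h → Arrow e f → Arrow e g → Arrows e h → ⊥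
  no-fork Q e→f e→g (inj₁ e→h) =
    arrow-antisym (proj₂ (fork Q e→f e→g)) (proj₂ (fork (swap₃₄ Q) e→f e→h))
  no-fork Q e→f e→g (inj₂ h→e) =
    arrow-antisym e→g (proj₁ (fork (swap₁₂ (swap₂₃ (swap₃₄ Q))) h→e (proj₁ (fork Q e→f e→g))))

  -- One arrow forces all six pairs to be arrows, hence a tournament on four
  -- blocks, which always has a vertex of out-degree two.
  no-arrow : ∀ {e f g h} → Quad e f g h → Arrow e f → ⊥
  no-arrow {e} {f} {g} {h} Q e→f = go (spread Q e→f) (spread (swap₃₄ Q) e→f)
    where
      Qg : Quad g e f h
      Qg = swap₁₂ (swap₂₃ Q)
      Qh : Quad h e f g
      Qh = swap₁₂ (swap₂₃ (swap₃₄ Q))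
      go : Arrows e g → Arrows e h → ⊥
      go (inj₁ e→g) eh′ = no-fork Q e→f e→g eh′
      go (inj₂ g→e) (inj₁ e→h) = no-fork (swap₃₄ Q) e→f e→h (inj₂ g→e)
      go (inj₂ g→e) (inj₂ h→e) with facing-arrow (ef Q) e→f | facing-arrows (eg Q) (inj₂ g→e) | facing-arrows (eh Q) (inj₂ h→e)
      ... | inj₁ g→h | _ | fg = no-fork (swap₃₄ Qg) g→e g→h (turn-around fg)
      ... | inj₂ h→g | fh | _ = no-fork (swap₃₄ Qh) h→e h→g (turn-around fh)

  no-arrows : ∀ {e f g h} → Quad e f g h → ¬ Arrows e f
  no-arrows Q (inj₁ a) = no-arrow Q a
  no-arrows Q (inj₂ a) = no-arrow (swap₁₂ Q) a

  coloured : ∀ {e f g h} → Quad e f g h → ∃ λ i → Coloured i e f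
  coloured Q with classify (flat₁ (ef Q))
  ... | inj₁ c = c
  ... | inj₂ a = ⊥-elim (no-arrows Q a)

  facing-parity : ∀ {p q r s i j} → Good p q r s → Coloured i p q → Coloured j r s →
    (i ≡ j × N (p 0F) (r 0F) (s 0F) ≡ false × N (q 0F) (r 0F) (s 0F) ≡ false
           × N (r 0F) (p 0F) (q 0F) ≡ false × N (s 0F) (p 0F) (q 0F) ≡ false)
    ⊎ (N (p 0F) (r 0F) (s 0F) ≡ not (N (q 0F) (r 0F) (s 0F))
       × N (r 0F) (p 0F) (q 0F) ≡ not (N (s 0F) (p 0F) (q 0F)))
  facing-parity G cp cr with colour-links G cp cr | colour-links (exchange G) cr cp
  ... | inj₁ (e , a , b) | inj₁ (_ , c , d) = inj₁ (e , a 0F 0F 0F , b 0F 0F 0F , c 0F 0F 0F , d 0F 0F 0F)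
  ... | inj₁ (e , _) | inj₂ (ne , _) = ⊥-elim (ne (sym e))
  ... | inj₂ (ne , _) | inj₁ (e , _) = ⊥-elim (ne (sym e))
  ... | inj₂ (_ , t , a , b) | inj₂ (_ , u , c , d) = inj₂ (differ (a 0F 0F 0F) (b 0F 0F 0F) , differ (c 0F 0F 0F) (d 0F 0F 0F))
    where
      differ : ∀ {v w t} → v ≡ t → w ≡ not t → v ≡ not w
      differ {true}  refl refl = refl
      differ {false} refl refl = refl

  -- With different colours on ef and gh, the truth values of fgh, egh and efh
  -- would be pairwise different.
  same-colour : ∀ {e f g h} → Quad e f g h → ∃ λ i → Coloured i e f × Coloured i g h
  same-colour {e} {f} {g} {h} Q = go (facing-parity (ef Q) (proj₂ c₁) (proj₂ d₁))
                                     (facing-parity (eg Q) (proj₂ c₂) (proj₂ d₂))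
                                     (facing-parity (eh Q) (proj₂ c₃) (proj₂ d₃))
    where
      c₁ = coloured Q
      d₁ = facing-colour (ef Q) (proj₂ c₁)
      c₂ = coloured (swap₂₃ Q)
      d₂ = facing-colour (eg Q) (proj₂ c₂)
      c₃ = coloured (swap₂₃ (swap₃₄ Q))
      d₃ = facing-colour (eh Q) (proj₂ c₃)
      gfh : N (g 0F) (f 0F) (h 0F) ≡ N (f 0F) (g 0F) (h 0F)
      gfh = N12 (g 0F) (f 0F) (h 0F)
      feh : N (f 0F) (e 0F) (h 0F) ≡ N (e 0F) (f 0F) (h 0F)
      feh = N12 (f 0F) (e 0F) (h 0F)
      geh : N (g 0F) (e 0F) (h 0F) ≡ N (e 0F) (g 0F) (h 0F)
      geh = N12 (g 0F) (e 0F) (h 0F)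
      heg : N (h 0F) (e 0F) (g 0F) ≡ N (e 0F) (g 0F) (h 0F)
      heg = trans (N12 (h 0F) (e 0F) (g 0F)) (N23 (e 0F) (h 0F) (g 0F))
      hfg : N (h 0F) (f 0F) (g 0F) ≡ N (f 0F) (g 0F) (h 0F)
      hfg = trans (N12 (h 0F) (f 0F) (g 0F)) (N23 (f 0F) (h 0F) (g 0F))
      absurd : ∀ {u v} → u ≡ not v → u ≡ false → v ≡ false → ⊥
      absurd refl () refl
      go : _ → _ → _ → ∃ λ i → Coloured i e f × Coloured i g h
      go (inj₁ (eq , _)) _ _ = proj₁ c₁ , proj₂ c₁ , subst (λ j → Coloured j g h) (sym eq) (proj₂ d₁)
      go (inj₂ (p , _)) (inj₁ (_ , _ , a , _ , b)) _ = ⊥-elim (absurd p (trans (sym heg) b) (trans (sym gfh) a))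
      go (inj₂ (p , _)) (inj₂ _) (inj₁ (_ , _ , a , _ , b)) = ⊥-elim (absurd p (trans (sym geh) b) (trans (sym hfg) a))
      go (inj₂ (p , _)) (inj₂ (q , _)) (inj₂ (_ , r)) =
        ⊥-elim (≢-≢-≢ p (trans q (cong not gfh)) (trans (not-sym (trans (sym feh) (trans r (cong not geh)))) refl))
        where
          not-sym : ∀ {u v} → u ≡ not v → v ≡ not u
          not-sym {v = true}  refl = refl
          not-sym {v = false} refl = refl

-- Covers by triples and exchanges between blocks

Cover : ∀ {n k} → (Fin k → Fin 3 → Fin n) → Set
Cover B = ∀ v → ∃ λ i → ∃ λ a → B i a ≡ v

cover-sum : ∀ {n k} {B : Fin k → Fin 3 → Fin n} → Cover B → ∀ (g : Fin n → ℕ) → sum g ≤ sum (λ i → sum (λ a → g (B i a)))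
cover-sum {n} {k} {B} cov g = begin
    sum g
      ≤⟨ ∑-mono pointwise ⟩
    sum (λ v → sum (λ i → sum (λ a → δ v (B i a) * g v)))
      ≡⟨ ∑-comm (λ v i → sum (λ a → δ v (B i a) * g v)) ⟩
    sum (λ i → sum (λ v → sum (λ a → δ v (B i a) * g v)))
      ≡⟨ sum-cong-≗ (λ i → ∑-comm (λ v a → δ v (B i a) * g v)) ⟩
    sum (λ i → sum (λ a → sum (λ v → δ v (B i a) * g v)))
      ≡⟨ ∑∑-cong (λ i a → ∑-δ g (B i a)) ⟩
    sum (λ i → sum (λ a → g (B i a))) ∎
  where
    open ≤-Reasoning
    pointwise : ∀ v → g v ≤ sum (λ i → sum (λ a → δ v (B i a) * g v))
    pointwise v with cov v
    ... | i , a , refl = ≤-trans (≤-reflexive (sym (trans (cong (_* g (B i a)) (δ-refl (B i a))) (*-identityˡ _))))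
                                 (term≤∑∑ (λ i′ a′ → δ (B i a) (B i′ a′) * g (B i a)) i a)

slot : ∀ {m} → Fin m → Fin m → Fin 3 → Fin (suc m)
slot e f 0F = zero
slot e f 1F = suc e
slot e f 2F = suc f

module _ {A : Set} {m : ℕ} where

  update : (Fin (suc m) → A) → Fin m → Fin m → (Fin 3 → A) → Fin (suc m) → A
  update B e f T zero = T 0F
  update B e f T (suc i) with i ≟ᶠ e | i ≟ᶠ f
  ... | yes _ | _     = T 1F
  ... | no _  | yes _ = T 2F
  ... | no _  | no _  = B (suc i)

  update-slot : ∀ B {e f} → e ≢ f → ∀ T k → update B e f T (slot e f k) ≡ T k
  update-slot B e≢f T 0F = refl
  update-slot B {e} {f} e≢f T 1F with e ≟ᶠ e
  ... | yes _ = refl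
  ... | no ne = ⊥-elim (ne refl)
  update-slot B {e} {f} e≢f T 2F with f ≟ᶠ e | f ≟ᶠ f
  ... | yes p | _     = ⊥-elim (e≢f (sym p))
  ... | no _  | yes _ = refl
  ... | no _  | no ne = ⊥-elim (ne refl)

  update-other : ∀ B {e f i} → i ≢ e → i ≢ f → ∀ T → update B e f T (suc i) ≡ B (suc i)
  update-other B {e} {f} {i} p q T with i ≟ᶠ e | i ≟ᶠ f
  ... | yes r | _     = ⊥-elim (p r)
  ... | no _  | yes r = ⊥-elim (q r)
  ... | no _  | no _  = refl

  update-all : ∀ (P : Fin (suc m) → A → Set) B {e f} T → (∀ i → P (suc i) (B (suc i))) →
               P (suc e) (T 1F) → P (suc f) (T 2F) → ∀ i → P (suc i) (update B e f T (suc i))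
  update-all P B {e} {f} T old p₁ p₂ i with i ≟ᶠ e | i ≟ᶠ f
  ... | yes refl | _        = p₁
  ... | no _     | yes refl = p₂
  ... | no _     | no _     = old i

mix : ∀ {V : Set} → (Fin 3 → V) → (Fin 3 → V) → (Fin 3 → V) → (σ₀ σ₁ σ₂ : Fin 3 → Fin 3) → Fin 3 → Fin 3 → V
mix x e f σ₀ σ₁ σ₂ k = tri (x (σ₀ k)) (e (σ₁ k)) (f (σ₂ k))

Surj₃ : (Fin 3 → Fin 3) → Set
Surj₃ σ = ∀ a → ∃ λ k → σ k ≡ a

-- Only covering is carried through the exchanges. Disjointness of the blocks follows at the end by
-- counting, in `cover-injective`.
update-cover : ∀ {n m} {B : Fin (suc m) → Fin 3 → Fin n} {e f} → Cover B → e ≢ f → ∀ {σ₀ σ₁ σ₂} →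
               Surj₃ σ₀ → Surj₃ σ₁ → Surj₃ σ₂ →
               Cover (update B e f (mix (B zero) (B (suc e)) (B (suc f)) σ₀ σ₁ σ₂))
update-cover {n} {m} {B} {e} {f} cov e≢f {σ₀} {σ₁} {σ₂} s₀ s₁ s₂ v = go (cov v)
  where
    T = mix (B zero) (B (suc e)) (B (suc f)) σ₀ σ₁ σ₂
    B′ = update B e f T
    at : ∀ k a {w} → T k a ≡ w → ∃ λ i → ∃ λ a → B′ i a ≡ w
    at k a eq = slot e f k , a , trans (cong (λ t → t a) (update-slot B e≢f T k)) eq
    go : (∃ λ i → ∃ λ a → B i a ≡ v) → ∃ λ i → ∃ λ a → B′ i a ≡ v
    go (zero , a , refl) = at (proj₁ (s₀ a)) 0F (cong (B zero) (proj₂ (s₀ a)))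
    go (suc i , a , refl) = place (i ≟ᶠ e) (i ≟ᶠ f)
      where
        place : Dec (i ≡ e) → Dec (i ≡ f) → ∃ λ j → ∃ λ b → B′ j b ≡ B (suc i) a
        place (yes refl) _          = at (proj₁ (s₁ a)) 1F (cong (B (suc i)) (proj₂ (s₁ a)))
        place (no _)     (yes refl) = at (proj₁ (s₂ a)) 2F (cong (B (suc i)) (proj₂ (s₂ a)))
        place (no p)     (no q)     = suc i , a , cong (λ t → t a) (update-other B p q T)

-- A permutation starting at `k`: with `turn k`, `turn a`, `turn b` the triple `0F` of `mix` is the
-- cell `(k, a, b)`, which becomes the leftover.
turn : Fin 3 → Fin 3 → Fin 3
turn k = tri k (third k k) (third k (third k k))

abstract
  turn-surjective : ∀ k → Surj₃ (turn k)
  turn-surjective = from-yes (all? λ k → all? λ a → any? λ j → turn k j ≟ᶠ a)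

∸9-zero : ∀ {v} → v ∸ 9 ≡ 0 → v ≤ 9
∸9-zero {v} eq = m∸n≡0⇒m≤n eq

-- States with a leftover triple, and their degree sums

module Hypergraph {n m : ℕ} (h : Fin n → Fin n → Fin n → Bool)
  (h12 : ∀ a b c → h a b c ≡ h b a c) (h23 : ∀ a b c → h a b c ≡ h a c b) (U : Fin n → Set) where

  V : Set
  V = Fin n

  N : V → V → V → Bool
  N a b c = not (h a b c)

  N12 : ∀ a b c → N a b c ≡ N b a c
  N12 a b c = cong not (h12 a b c)

  N23 : ∀ a b c → N a b c ≡ N a c b
  N23 a b c = cong not (h23 a b c)

  deg₂ : V → ℕ
  deg₂ v = sum (λ a → sum (λ b → # (h v a b)))

  edge : (Fin 3 → V) → Bool
  edge t = h (t 0F) (t 1F) (t 2F)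

  fake : (Fin 3 → V) → ℕ
  fake t = # (not (edge t))

  Admissible : (Fin 3 → V) → Set
  Admissible t = edge t ≡ true ⊎ (∀ a → U (t a))

  NoCover : ℕ → Set
  NoCover q = ∀ (B : Fin (suc m) → Fin 3 → V) → Cover B → (∀ i → Admissible (B i)) → sum (λ i → fake (B i)) ≤ q → ⊥

  -- Block zero is the leftover triple. The other blocks are edges, except for at most q
  -- fake ones, which are arbitrary triples inside U.
  record State (q : ℕ) (B : Fin (suc m) → Fin 3 → V) : Set where
    constructor state
    field
      cover : Cover B
      adm   : ∀ i → Admissible (B (suc i))
      few   : sum (λ i → fake (B (suc i))) ≤ q

  cube : (x e f : Fin 3 → V) → Cube
  cube x e f k a b = N (x k) (e a) (f b)

  edge-fake : ∀ t → edge t ≡ true → fake t ≡ 0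
  edge-fake t eq = cong (λ b → # (not b)) eq

  step : (Fin (suc m) → Fin 3 → V) → Fin m → Fin m → (k a b : Fin 3) → Fin (suc m) → Fin 3 → V
  step B e f k a b = update B e f (mix (B zero) (B (suc e)) (B (suc f)) (turn k) (turn a) (turn b))

  -- The excess over the nine non-edges that `state-hit` forces. A block paired with itself spans no
  -- cube of an exchange and counts zero.
  loss : (Fin (suc m) → Fin 3 → V) → Fin m → Fin m → ℕ
  loss B i j with i ≟ᶠ j
  ... | yes _ = 0
  ... | no _  = volume (cube (B zero) (B (suc i)) (B (suc j))) ∸ 9

  loss-≢ : ∀ B {i j} → i ≢ j → loss B i j ≡ volume (cube (B zero) (B (suc i)) (B (suc j))) ∸ 9
  loss-≢ B {i} {j} ne with i ≟ᶠ j
  ... | yes p = ⊥-elim (ne p)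
  ... | no _  = refl

  e₂ : V → (Fin 3 → V) → (Fin 3 → V) → ℕ
  e₂ y s t = sum (λ a → sum (λ b → # (h y (s a) (t b))))

  e₂≤9 : ∀ y s t → e₂ y s t ≤ 9
  e₂≤9 y s t = ∑∑-mono {3} {3} {g = λ _ _ → 1} (λ a b → #≤1 (h y (s a) (t b)))

  e₂-volume : ∀ x s t → sum (λ k → e₂ (x k) s t) + volume (cube x s t) ≡ 27
  e₂-volume x s t = trans (sym (∑-distrib-+ (λ k → e₂ (x k) s t) (λ k → sum (λ a → sum (λ b → # (N (x k) (s a) (t b)))))))
    (sum-cong-≗ {3} {_} {λ _ → 9} (λ k → trans (sym (∑∑-+ (λ a b → # (h (x k) (s a) (t b))) (λ a b → # (N (x k) (s a) (t b)))))
      (∑∑-cong {3} {3} {_} {λ _ _ → 1} (λ a b → #-not (h (x k) (s a) (t b))))))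

  W : (Fin (suc m) → Fin 3 → V) → V → ℕ
  W B y = sum (λ i → sum (λ j → e₂ y (B (suc i)) (B (suc j))))

  deg₂≤W : ∀ {B} → Cover B → ∀ y → deg₂ y ≤ 9 + 18 * m + W B y
  deg₂≤W {B} cov y = begin
      deg₂ y
        ≤⟨ cover-sum cov (λ u → sum (λ v → # (h y u v))) ⟩
      sum (λ i → sum (λ a → sum (λ v → # (h y (B i a) v))))
        ≤⟨ ∑∑-mono (λ i a → cover-sum cov (λ v → # (h y (B i a) v))) ⟩
      sum (λ i → sum (λ a → sum (λ j → sum (λ b → # (h y (B i a) (B j b))))))
        ≡⟨ sum-cong-≗ (λ i → ∑-comm (λ a j → sum (λ b → # (h y (B i a) (B j b))))) ⟩
      sum (λ i → sum (λ j → e₂ y (B i) (B j)))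
        ≡⟨⟩
      (e₂ y (B zero) (B zero) + sum (λ j → e₂ y (B zero) (B (suc j)))) + sum (λ i → e₂ y (B (suc i)) (B zero) + sum (λ j → e₂ y (B (suc i)) (B (suc j))))
        ≡⟨ cong ((e₂ y (B zero) (B zero) + sum (λ j → e₂ y (B zero) (B (suc j)))) +_) (∑-distrib-+ (λ i → e₂ y (B (suc i)) (B zero)) (λ i → sum (λ j → e₂ y (B (suc i)) (B (suc j))))) ⟩
      (e₂ y (B zero) (B zero) + sum (λ j → e₂ y (B zero) (B (suc j)))) + (sum (λ i → e₂ y (B (suc i)) (B zero)) + W B y)
        ≤⟨ +-mono-≤ (+-mono-≤ (e₂≤9 y (B zero) (B zero)) (∑-≤-const {m} 9 (λ j → e₂≤9 y (B zero) (B (suc j))))) (+-monoˡ-≤ (W B y) (∑-≤-const {m} 9 (λ j → e₂≤9 y (B (suc j)) (B zero)))) ⟩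
      (9 + m * 9) + (m * 9 + W B y)
        ≡⟨ regroup m (W B y) ⟩
      9 + 18 * m + W B y ∎
    where
      open ≤-Reasoning
      regroup : ∀ m w → (9 + m * 9) + (m * 9 + w) ≡ 9 + 18 * m + w
      regroup = solve-∀

  module _ {q} (none : NoCover q) where

    -- A diagonal without non-edges consists of three edges replacing the leftover and both blocks.
    -- Block zero is then an edge as well, so the bound `q` for the other blocks holds for the whole
    -- cover.
    state-hit : ∀ {B} → State q B → ∀ {e f} → e ≢ f → Hit (cube (B zero) (B (suc e)) (B (suc f)))
    state-hit {B} (state cov adm few) {e} {f} e≢f o o′ s t with diagonal (cube (B zero) (B (suc e)) (B (suc f))) o o′ s t in eq
    ... | suc d = s≤s z≤n
    ... | zero = ⊥-elim (none B′
            (update-cover cov e≢f (λ a → a , refl) (perm-surjective o s) (perm-surjective o′ t)) adm′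
            (≤-trans (≤-reflexive (cong (_+ sum (λ i → fake (B′ (suc i)))) (edge-fake (T 0F) (new-edges 0F)))) (≤-trans (∑-mono fewer) few)))
      where
        T = mix (B zero) (B (suc e)) (B (suc f)) id (perm o s) (perm o′ t)
        B′ = update B e f T
        new-edges : ∀ k → edge (T k) ≡ true
        new-edges k = #-zero _ (∑≡0⇒ (λ k → # (cube (B zero) (B (suc e)) (B (suc f)) k (perm o s k) (perm o′ t k))) eq k)
        adm′ : ∀ i → Admissible (B′ i)
        adm′ zero = inj₁ (new-edges 0F)
        adm′ (suc i) = update-all (λ _ → Admissible) B T adm (inj₁ (new-edges 1F)) (inj₁ (new-edges 2F)) i
        fewer : ∀ i → fake (B′ (suc i)) ≤ fake (B (suc i))
        fewer = update-all (λ i t → fake t ≤ fake (B i)) B T (λ i → ≤-refl)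
          (≤-trans (≤-reflexive (edge-fake (T 1F) (new-edges 1F))) z≤n) (≤-trans (≤-reflexive (edge-fake (T 2F) (new-edges 2F))) z≤n)

    state-plane : ∀ {B} → State q B → ∀ {e f} → e ≢ f → volume (cube (B zero) (B (suc e)) (B (suc f))) ≤ 9 →
                  ∃ λ τ → ∀ k a b → N (B zero k) (B (suc e) a) (B (suc f) b) ≡ on τ k a b
    state-plane {B} st {e} {f} e≢f small = ExactCube.plane Z (hit-once Z (state-hit st e≢f) small)
      where Z = cube (B zero) (B (suc e)) (B (suc f))

    -- In a tight cube a diagonal has exactly one non-edge. If that one becomes the leftover, the
    -- two other triples on its diagonal are edges and replace `e` and `f`.
    state-step : ∀ {B} → State q B → ∀ {e f} → e ≢ f → volume (cube (B zero) (B (suc e)) (B (suc f))) ≤ 9 →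
                 ∀ k a b → N (B zero k) (B (suc e) a) (B (suc f) b) ≡ true → State q (step B e f k a b)
    state-step {B} st@(state cov adm few) {e} {f} e≢f small k a b nonedge =
      state (update-cover cov e≢f (turn-surjective k) (turn-surjective a) (turn-surjective b))
            (update-all (λ _ → Admissible) B T adm (inj₁ edge₁) (inj₁ edge₂))
            (≤-trans (∑-mono fewer) few)
      where
        T = mix (B zero) (B (suc e)) (B (suc f)) (turn k) (turn a) (turn b)
        two-false : ∀ {x y z} → # (not x) + (# (not y) + (# (not z) + 0)) ≡ 1 → not x ≡ true → y ≡ true × z ≡ true
        two-false {false} {true} {true} _ _ = refl , refl
        new-edges : edge (T 1F) ≡ true × edge (T 2F) ≡ true
        new-edges = two-false (ExactCube.exact (cube (B zero) (B (suc e)) (B (suc f))) (hit-once (cube (B zero) (B (suc e)) (B (suc f))) (state-hit st e≢f) small)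
                  k (third k k) a (third a a) b (third b b)
                  (third≢ˡ k k ∘ sym) (third≢ˡ a a ∘ sym) (third≢ˡ b b ∘ sym)) nonedge
        edge₁ = proj₁ new-edges
        edge₂ = proj₂ new-edges
        fewer : ∀ i → fake (update B e f T (suc i)) ≤ fake (B (suc i))
        fewer = update-all (λ i t → fake t ≤ fake (B i)) B T (λ i → ≤-refl)
          (≤-trans (≤-reflexive (edge-fake (T 1F) edge₁)) z≤n) (≤-trans (≤-reflexive (edge-fake (T 2F) edge₂)) z≤n)

    -- For distinct blocks, `9 + loss` of the 27 cells are non-edges, so edges and loss together
    -- make 18. A block paired with itself is bounded by `27 = 18 + 9`.
    W-loss : ∀ {B} → State q B → sum (λ k → W B (B zero k)) + sum (λ i → sum (loss B i)) ≤ 18 * (m * m) + 9 * m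
    W-loss {B} st = begin
        sum (λ k → W B (x k)) + sum (λ i → sum (loss B i))
          ≡⟨ cong (_+ sum (λ i → sum (loss B i))) (trans (∑-comm (λ k i → sum (λ j → e₂ (x k) (B (suc i)) (B (suc j)))))
               (sum-cong-≗ (λ i → ∑-comm (λ k j → e₂ (x k) (B (suc i)) (B (suc j)))))) ⟩
        sum (λ i → sum (λ j → total i j)) + sum (λ i → sum (loss B i))
          ≡⟨ sym (∑∑-+ total (loss B)) ⟩
        sum (λ i → sum (λ j → total i j + loss B i j))
          ≤⟨ ∑∑-mono pointwise ⟩
        sum (λ i → sum {m} (λ j → 18 + 9 * δ i j))
          ≡⟨ ∑∑-+ {m} {m} (λ _ _ → 18) (λ i j → 9 * δ i j) ⟩
        sum {m} (λ i → sum {m} (λ j → 18)) + sum (λ i → sum {m} (λ j → 9 * δ i j))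
          ≡⟨ cong₂ _+_ (∑∑-const m m 18) (trans (sum-cong-≗ {m} (λ i → trans (∑-*ˡ 9 (δ i)) (cong (9 *_) (∑-δʳ i)))) (∑-const m 9)) ⟩
        m * (m * 18) + m * 9
          ≡⟨ regroup m ⟩
        18 * (m * m) + 9 * m ∎
      where
        open ≤-Reasoning
        x = B zero
        total : Fin m → Fin m → ℕ
        total i j = sum (λ k → e₂ (x k) (B (suc i)) (B (suc j)))
        regroup : ∀ m → m * (m * 18) + m * 9 ≡ 18 * (m * m) + 9 * m
        regroup = solve-∀
        cancel : ∀ t v → t + v ≡ 27 → 9 ≤ v → t + (v ∸ 9) ≤ 18
        cancel t v eq le = +-cancelʳ-≤ 9 (t + (v ∸ 9)) 18
          (≤-reflexive (trans (+-assoc t (v ∸ 9) 9) (trans (cong (t +_) (m∸n+n≡m le)) eq)))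
        pointwise : ∀ i j → total i j + loss B i j ≤ 18 + 9 * δ i j
        pointwise i j with i ≟ᶠ j
        ... | yes _ = ≤-trans (≤-reflexive (+-identityʳ _)) (m+n≤o⇒m≤o (total i j) (≤-reflexive (e₂-volume x (B (suc i)) (B (suc j)))))
        ... | no ne = cancel (total i j) (volume Z) (e₂-volume x (B (suc i)) (B (suc j))) (hit-volume Z (state-hit st ne))
          where Z = cube x (B (suc i)) (B (suc j))

    -- Large degrees in the leftover leave little room for loss. The term `9 + 18m` from `deg₂≤W`
    -- pays, for each `xₖ`, for the pairs that meet the leftover itself.
    deg-loss : ∀ {B} → State q B →
               sum (λ k → deg₂ (B zero k)) + sum (λ i → sum (loss B i)) ≤ 18 * (m * m) + 63 * m + 27
    deg-loss {B} st = begin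
        sum (λ k → deg₂ (B zero k)) + sum (λ i → sum (loss B i))
          ≤⟨ +-monoˡ-≤ _ (∑-mono (λ k → deg₂≤W (State.cover st) (B zero k))) ⟩
        sum (λ k → 9 + 18 * m + W B (B zero k)) + sum (λ i → sum (loss B i))
          ≡⟨ cong (_+ sum (λ i → sum (loss B i))) (∑-distrib-+ {3} (λ _ → 9 + 18 * m) (λ k → W B (B zero k))) ⟩
        sum {3} (λ _ → 9 + 18 * m) + sum (λ k → W B (B zero k)) + sum (λ i → sum (loss B i))
          ≡⟨ +-assoc (sum {3} (λ _ → 9 + 18 * m)) (sum (λ k → W B (B zero k))) _ ⟩
        sum {3} (λ _ → 9 + 18 * m) + (sum (λ k → W B (B zero k)) + sum (λ i → sum (loss B i)))
          ≤⟨ +-monoʳ-≤ (sum {3} (λ _ → 9 + 18 * m)) (W-loss st) ⟩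
        sum {3} (λ _ → 9 + 18 * m) + (18 * (m * m) + 9 * m)
          ≡⟨ regroup m ⟩
        18 * (m * m) + 63 * m + 27 ∎
      where
        open ≤-Reasoning
        regroup : ∀ m → (9 + 18 * m + (9 + 18 * m + (9 + 18 * m + 0))) + (18 * (m * m) + 9 * m) ≡ 18 * (m * m) + 63 * m + 27
        regroup = solve-∀

-- Counting quadruples of blocks

module FourfoldSum {m : ℕ} where

  Weight : Set
  Weight = Fin m → Fin m → Fin m → Fin m → ℕ

  S4 : Weight → ℕ
  S4 F = sum (λ e → sum (λ f → sum (λ g → sum (λ h → F e f g h))))

  S4-mono : ∀ {F G : Weight} → (∀ e f g h → F e f g h ≤ G e f g h) → S4 F ≤ S4 G
  S4-mono le = ∑∑-mono (λ e f → ∑∑-mono (le e f))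

  S4-+ : ∀ (F G : Weight) → S4 (λ e f g h → F e f g h + G e f g h) ≡ S4 F + S4 G
  S4-+ F G = trans (∑∑-cong (λ e f → ∑∑-+ (F e f) (G e f)))
                   (∑∑-+ (λ e f → sum (λ g → sum (F e f g))) (λ e f → sum (λ g → sum (G e f g))))

  swap12 : ∀ (F : Weight) → S4 (λ e f g h → F f e g h) ≡ S4 F
  swap12 F = ∑-comm (λ e f → sum (λ g → sum (λ h → F f e g h)))

  swap23 : ∀ (F : Weight) → S4 (λ e f g h → F e g f h) ≡ S4 F
  swap23 F = sum-cong-≗ (λ e → ∑-comm (λ f g → sum (λ h → F e g f h)))

  swap34 : ∀ (F : Weight) → S4 (λ e f g h → F e f h g) ≡ S4 F
  swap34 F = ∑∑-cong (λ e f → ∑-comm (λ g h → F e f h g))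

  egfh : ∀ (F : Weight) → S4 (λ e f g h → F e g f h) ≡ S4 F
  egfh = swap23

  ehfg : ∀ (F : Weight) → S4 (λ e f g h → F e h f g) ≡ S4 F
  ehfg F = trans (swap34 (λ e f g h → F e g f h)) (egfh F)

  fgeh : ∀ (F : Weight) → S4 (λ e f g h → F f g e h) ≡ S4 F
  fgeh F = trans (swap12 (λ e f g h → F e g f h)) (egfh F)

  fheg : ∀ (F : Weight) → S4 (λ e f g h → F f h e g) ≡ S4 F
  fheg F = trans (swap12 (λ e f g h → F e h f g)) (ehfg F)

  ghef : ∀ (F : Weight) → S4 (λ e f g h → F g h e f) ≡ S4 F
  ghef F = trans (swap23 (λ e f g h → F f h e g)) (fheg F)

  S4-const₂ : ∀ (G : Fin m → Fin m → ℕ) → S4 (λ e f g h → G e f) ≡ m * (m * sum (λ e → sum (G e)))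
  S4-const₂ G = trans (∑∑-cong (λ e f → trans (∑∑-const m m (G e f)) (sym (*-assoc m m (G e f)))))
    (trans (sum-cong-≗ (λ e → ∑-*ˡ (m * m) (G e))) (trans (∑-*ˡ (m * m) (λ e → sum (G e))) (*-assoc m m _)))

  S4-prod : ∀ (G H : Fin m → Fin m → ℕ) → S4 (λ e f g h → G e f * H g h) ≡ sum (λ e → sum (G e)) * sum (λ g → sum (H g))
  S4-prod G H = trans (∑∑-cong (λ e f → trans (sum-cong-≗ (λ g → ∑-*ˡ (G e f) (H g))) (∑-*ˡ (G e f) (λ g → sum (H g)))))
    (trans (sum-cong-≗ (λ e → ∑-*ʳ (sum (λ g → sum (H g))) (G e))) (∑-*ʳ (sum (λ g → sum (H g))) (λ e → sum (G e))))

guard : ∀ {A : Set} → Dec A → ℕ → ℕ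
guard (yes _) v = v
guard (no _)  v = 0

guard-yes : ∀ {A : Set} (d : Dec A) → A → ∀ {v} → guard d v ≡ 0 → v ≡ 0
guard-yes (yes _) a eq = eq
guard-yes (no na) a eq = ⊥-elim (na a)

indicator-yes : ∀ {A : Set} (d : Dec A) → A → indicator d ≡ 1
indicator-yes (yes _) a = refl
indicator-yes (no na) a = ⊥-elim (na a)

indicator≡0 : ∀ {A : Set} (d : Dec A) → indicator d ≡ 0 → ¬ A
indicator≡0 (no na) _ = na

private
  arith-deg-loss : ∀ t p m → p ≡ suc m → t ≤ 18 * (m * m) + 63 * m + 27 → t ≤ 18 * (p * p) + 27 * p
  arith-deg-loss t .(suc m) m refl le = lin 18 le (eq t m)
    where
      eq : ∀ t m → t + (18 * (m * m) + 63 * m + 27) + 18 ≡ 18 * (suc m * suc m) + 27 * suc m + t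
      eq = solve-∀

  arith-loss-bound : ∀ a b c l p → a + (b + (c + 0)) + l ≤ 18 * (p * p) + 27 * p →
    6 * (p * p) ≤ a + 59 * p → 6 * (p * p) ≤ b + 59 * p → 6 * (p * p) ≤ c + 59 * p → l ≤ 204 * p
  arith-loss-bound a b c l p h₀ h₁ h₂ h₃ = lin 0 (+-mono-≤ h₀ (+-mono-≤ h₁ (+-mono-≤ h₂ h₃))) (eq a b c l p)
    where
      eq : ∀ a b c l p → l + (18 * (p * p) + 27 * p + (a + 59 * p + (b + 59 * p + (c + 59 * p)))) + 0
           ≡ 204 * p + (a + (b + (c + 0)) + l + (6 * (p * p) + (6 * (p * p) + 6 * (p * p))))
      eq = solve-∀

  arith-x-high : ∀ a p → 6 * (p * p) + 3 ≤ a + 8 * p → 6 * (p * p) ≤ a + 59 * p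
  arith-x-high a p h₀ = lin (3 + 51 * p) h₀ (eq a p)
    where
      eq : ∀ a p → 6 * (p * p) + (a + 8 * p) + (3 + 51 * p) ≡ a + 59 * p + (6 * (p * p) + 3)
      eq = solve-∀

  arith-x-deg : ∀ a b c p → a + (b + (c + 0)) ≤ 18 * (p * p) + 27 * p →
    6 * (p * p) + 3 ≤ b + 8 * p → 6 * (p * p) + 3 ≤ c + 8 * p → a ≤ 6 * (p * p) + 43 * p
  arith-x-deg a b c p h₀ h₁ h₂ = lin 6 (+-mono-≤ h₀ (+-mono-≤ h₁ h₂)) (eq a b c p)
    where
      eq : ∀ a b c p → a + (18 * (p * p) + 27 * p + (b + 8 * p + (c + 8 * p))) + 6
           ≡ 6 * (p * p) + 43 * p + (a + (b + (c + 0)) + (6 * (p * p) + 3 + (6 * (p * p) + 3)))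
      eq = solve-∀

  arith-low : ∀ a b p → 12 * (p * p) + 6 ≤ a + b + 16 * p → a ≤ 6 * (p * p) + 43 * p → 6 * (p * p) ≤ b + 59 * p
  arith-low a b p h₀ h₁ = lin 6 (+-mono-≤ h₀ h₁) (eq a b p)
    where
      eq : ∀ a b p → 6 * (p * p) + (a + b + 16 * p + (6 * (p * p) + 43 * p)) + 6 ≡ b + 59 * p + (12 * (p * p) + 6 + a)
      eq = solve-∀

  arith-∑Q : ∀ d q w p m → p ≡ suc m → d ≤ 9 + 18 * m + w → w + 9 * q ≤ m * (m * 9) →
    6 * (p * p) + 3 ≤ d + 8 * p → 9 * q ≤ 3 * (p * p) + 8 * p
  arith-∑Q d q w .(suc m) m refl h₀ h₁ h₂ = lin 3 (+-mono-≤ h₀ (+-mono-≤ h₁ h₂)) (eq d q w m)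
    where
      eq : ∀ d q w m → 9 * q + (9 + 18 * m + w + (m * (m * 9) + (d + 8 * suc m))) + 3
           ≡ 3 * (suc m * suc m) + 8 * suc m + (d + (w + 9 * q + (6 * (suc m * suc m) + 3)))
      eq = solve-∀

module Counting {n m : ℕ} (h : Fin n → Fin n → Fin n → Bool)
  (h12 : ∀ a b c → h a b c ≡ h b a c) (h23 : ∀ a b c → h a b c ≡ h a c b) (U : Fin n → Set)
  (p : ℕ) (p≡ : p ≡ suc m)
  (U-deg : ∀ v → U v → 6 * (p * p) + 3 ≤ Hypergraph.deg₂ {n} {m} h h12 h23 U v + 8 * p)
  (ore : ∀ u v w → h u v w ≡ true →
         12 * (p * p) + 6 ≤ Hypergraph.deg₂ {n} {m} h h12 h23 U u + Hypergraph.deg₂ {n} {m} h h12 h23 U v + 16 * p) where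

  open Hypergraph {n} {m} h h12 h23 U
  open FourfoldSum {m}

  -- 6p² − 59p is the degree sum of an edge minus the bound x-deg: neighbours of x are not low.
  Low : V → Set
  Low v = deg₂ v + 59 * p < 6 * (p * p)

  module _ {q} (none : NoCover q) where

    deg-loss′ : ∀ {B} → State q B → sum (λ k → deg₂ (B zero k)) + sum (λ i → sum (loss B i)) ≤ 18 * (p * p) + 27 * p
    deg-loss′ {B} st = arith-deg-loss _ p m p≡ (deg-loss none st)

    -- Three degrees of at least `6p² − 59p` are subtracted from `18p² + 27p`, and
    -- `204 = 27 + 3 · 59`.
    loss-bound : ∀ {B} → State q B → (∀ k → ¬ Low (B zero k)) → sum (λ i → sum (loss B i)) ≤ 204 * p
    loss-bound {B} st high = arith-loss-bound (deg₂ (B zero 0F)) (deg₂ (B zero 1F)) (deg₂ (B zero 2F)) (sum (λ i → sum (loss B i))) p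
      (deg-loss′ st) (≮⇒≥ (high 0F)) (≮⇒≥ (high 1F)) (≮⇒≥ (high 2F))

    module _ {B : Fin (suc m) → Fin 3 → V} (st : State q B) (inU : ∀ k → U (B zero k)) where

      x : Fin 3 → V
      x = B zero

      blk : Fin m → Fin 3 → V
      blk i = B (suc i)

      x-high : ∀ k → ¬ Low (x k)
      x-high k low = <-irrefl refl (<-≤-trans low (arith-x-high (deg₂ (x k)) p (U-deg (x k) (inU k))))

      -- The other two degrees are at least `6p² − 8p + 3` each, and `43 = 27 + 8 + 8`.
      x-deg : ∀ k → deg₂ (x k) ≤ 6 * (p * p) + 43 * p
      x-deg k = arith-x-deg (deg₂ (x k)) (deg₂ (x k₁)) (deg₂ (x k₂)) p total (U-deg (x k₁) (inU k₁)) (U-deg (x k₂) (inU k₂))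
        where
          k₁ = third k k
          k₂ = third k k₁
          total : deg₂ (x k) + (deg₂ (x k₁) + (deg₂ (x k₂) + 0)) ≤ 18 * (p * p) + 27 * p
          total = ≤-trans (≤-reflexive (∑-third k k₁ (third≢ˡ k k ∘ sym) (λ j → deg₂ (x j))))
                          (≤-trans (m≤m+n _ _) (deg-loss′ st))

      low-isolated : ∀ {v} → Low v → ∀ k w → N (x k) v w ≡ true
      low-isolated {v} low k w with h (x k) v w in eq
      ... | false = refl
      ... | true  = ⊥-elim (<-irrefl refl (<-≤-trans low (arith-low (deg₂ (x k)) (deg₂ v) p (ore (x k) v w eq) (x-deg k))))

      LowBlock : Fin m → Set
      LowBlock i = ∃ λ a → Low (blk i a)

      low? : ∀ i → Dec (LowBlock i)
      low? i = any? (λ a → (deg₂ (blk i a) + 59 * p) <? (6 * (p * p)))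

      lowᴮ : Fin m → ℕ
      lowᴮ i = indicator (low? i)

      s : ℕ
      s = sum lowᴮ

      ℓ : ℕ
      ℓ = sum (λ i → sum (loss B i))

      tight : ∀ {e f} → e ≢ f → loss B e f ≡ 0 → volume (cube x (blk e) (blk f)) ≤ 9
      tight e≢f eq = ∸9-zero (trans (sym (loss-≢ B e≢f)) eq)

      -- A low vertex of `e` makes a whole row of the cube non-edges, and a low vertex of `f` a
      -- whole row in the other direction. No single plane contains both.
      low-pair : ∀ {e f} → e ≢ f → LowBlock e → LowBlock f → loss B e f ≢ 0
      low-pair {e} {f} e≢f (a , lowa) (b , lowb) zero-loss with state-plane none st e≢f (tight e≢f zero-loss)
      ... | colour i , eq = true≢false (low-isolated lowa (third i i) (blk f 0F)) (trans (eq (third i i) a 0F) (does-≢ (third≢ˡ i i)))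
      ... | rowʳ i , eq = true≢false (low-isolated lowa 0F (blk f (third i i))) (trans (eq 0F a (third i i)) (does-≢ (third≢ˡ i i)))
      ... | rowˡ i , eq = true≢false (low-isolated lowb 0F (blk e (third i i)))
                            (trans (N23 (x 0F) (blk f b) (blk e (third i i))) (trans (eq 0F (third i i) b) (does-≢ (third≢ˡ i i))))

      s²-bound : s * s ≤ ℓ + m
      s²-bound = begin
          s * s
            ≡⟨ sym (∑-prod lowᴮ lowᴮ) ⟩
          sum (λ e → sum (λ f → lowᴮ e * lowᴮ f))
            ≤⟨ ∑∑-mono pointwise ⟩
          sum (λ e → sum (λ f → loss B e f + δ e f))
            ≡⟨ ∑∑-+ (loss B) δ ⟩
          ℓ + sum {m} (λ e → sum {m} (δ e))
            ≡⟨ cong (ℓ +_) (∑∑-δ m) ⟩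
          ℓ + m ∎
        where
          open ≤-Reasoning
          pointwise : ∀ e f → lowᴮ e * lowᴮ f ≤ loss B e f + δ e f
          pointwise e f with low? e | low? f
          ... | no _  | _     = z≤n
          ... | yes _ | no _  = z≤n
          ... | yes a | yes b with e ≟ᶠ f
          ...   | yes refl = ≤-refl
          ...   | no e≢f   = ≤-trans (n≢0⇒n>0 (low-pair e≢f a b ∘ trans (loss-≢ B e≢f))) (m≤m+n _ 0)

      Q? : ∀ i e f → Dec (∀ a b → N (x i) (blk e a) (blk f b) ≡ true)
      Q? i e f = all? (λ a → all? (λ b → N (x i) (blk e a) (blk f b) ≟ᵇ true))

      Q : Fin 3 → Fin m → Fin m → ℕ
      Q i e f = indicator (Q? i e f)

      ∑Q : Fin 3 → ℕ
      ∑Q i = sum (λ e → sum (Q i e))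

      -- Each pair counted by `Q` costs `xᵢ` nine of its at most `9m²` ordered pairs between blocks.
      -- A degree of about `6p²` leaves room for about `p²/3` such pairs.
      ∑Q-bound : ∀ i → 9 * ∑Q i ≤ 3 * (p * p) + 8 * p
      ∑Q-bound i = arith-∑Q (deg₂ (x i)) (∑Q i) W′ p m p≡ (deg₂≤W (State.cover st) (x i)) WQ (U-deg (x i) (inU i))
        where
          W′ = W B (x i)
          pointwise : ∀ e f → e₂ (x i) (blk e) (blk f) + 9 * Q i e f ≤ 9
          pointwise e f with Q? i e f
          ... | no _  = ≤-trans (≤-reflexive (+-identityʳ _)) (e₂≤9 (x i) (blk e) (blk f))
          ... | yes full = ≤-reflexive (cong (_+ 9) (∑-zero (λ a → ∑-zero (λ b → none-edge (full a b)))))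
            where
              none-edge : ∀ {y} → not y ≡ true → # y ≡ 0
              none-edge {false} _ = refl
          WQ : W′ + 9 * ∑Q i ≤ m * (m * 9)
          WQ = ≤-trans (≤-reflexive (trans (cong (W′ +_) (trans (sym (∑-*ˡ 9 (λ e → sum (Q i e)))) (sum-cong-≗ {m} (λ e → sym (∑-*ˡ 9 (Q i e))))))
                 (sym (∑∑-+ (λ e f → e₂ (x i) (blk e) (blk f)) (λ e f → 9 * Q i e f)))))
                 (≤-trans (∑∑-mono pointwise) (≤-reflexive (∑∑-const m m 9)))

      -- The exchanges after which the loss is still controlled. The new leftover takes a vertex
      -- from `e` and one from `f`, so excluding low blocks keeps `loss-bound` applicable.
      Core : Fin m → Fin m → (k a b : Fin 3) → Set
      Core e f k a b = (e ≢ f) × (volume (cube x (blk e) (blk f)) ≤ 9) × (N (x k) (blk e a) (blk f b) ≡ true)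
                       × (¬ LowBlock e) × (¬ LowBlock f)

      core? : ∀ e f k a b → Dec (Core e f k a b)
      core? e f k a b = ¬? (e ≟ᶠ f) ×-dec ((volume (cube x (blk e) (blk f)) ≤? 9) ×-dec ((N (x k) (blk e a) (blk f b) ≟ᵇ true)
                        ×-dec (¬? (low? e) ×-dec ¬? (low? f))))

      Apart : (e f g h : Fin m) → Set
      Apart e f g h = (g ≢ h) × (g ≢ e) × (g ≢ f) × (h ≢ e) × (h ≢ f)

      apart? : ∀ e f g h → Dec (Apart e f g h)
      apart? e f g h = ¬? (g ≟ᶠ h) ×-dec (¬? (g ≟ᶠ e) ×-dec (¬? (g ≟ᶠ f) ×-dec (¬? (h ≟ᶠ e) ×-dec ¬? (h ≟ᶠ f))))

      gap : (e f : Fin m) (k a b : Fin 3) (g h : Fin m) → ℕ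
      gap e f k a b g h = volume (cube (tri (x k) (blk e a) (blk f b)) (blk g) (blk h)) ∸ 9

      L : (e f : Fin m) (k a b : Fin 3) (g h : Fin m) → ℕ
      L e f k a b g h = guard (core? e f k a b) (guard (apart? e f g h) (gap e f k a b g h))

      core-state : ∀ {e f k a b} → Core e f k a b → State q (step B e f k a b)
      core-state {e} {f} {k} {a} {b} (e≢f , vol , nonedge , _) = state-step none st e≢f vol k a b nonedge

      core-high : ∀ {e f k a b} → Core e f k a b → ∀ j → ¬ Low (step B e f k a b zero j)
      core-high (_ , _ , _ , le , lf) 0F = x-high _
      core-high (_ , _ , _ , le , lf) 1F low = le (_ , low)
      core-high (_ , _ , _ , le , lf) 2F low = lf (_ , low)

      -- For an available exchange this is part of the total loss of the new state, whose leftover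
      -- has no low vertex. Hence the sum over quadruples has order `p³`.
      L-bound : ∀ e f k a b → sum (λ g → sum (λ h → L e f k a b g h)) ≤ 204 * p
      L-bound e f k a b = go (core? e f k a b)
        where
          B′ = step B e f k a b
          pointwise : ∀ g h → guard (apart? e f g h) (gap e f k a b g h) ≤ loss B′ g h
          pointwise g h = guarded (apart? e f g h)
            where
              guarded : ∀ d → guard d (gap e f k a b g h) ≤ loss B′ g h
              guarded (no _) = z≤n
              guarded (yes (g≢h , g≢e , g≢f , h≢e , h≢f)) = ≤-reflexive (trans
                  (cong₂ (λ s t → volume (cube (tri (x k) (blk e a) (blk f b)) s t) ∸ 9) (sym (update-other B g≢e g≢f _)) (sym (update-other B h≢e h≢f _)))
                  (sym (loss-≢ B′ g≢h)))
          go : ∀ d → sum (λ g → sum (λ h → guard d (guard (apart? e f g h) (gap e f k a b g h)))) ≤ 204 * p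
          go (no _)  = ≤-trans (≤-reflexive (∑-zero {m} (λ g → ∑-zero {m} (λ h → refl)))) z≤n
          go (yes c) = ≤-trans (∑∑-mono pointwise) (loss-bound (core-state c) (core-high c))

      -- If it vanishes, the first summand makes `e`, `f` tight and thereby opens the guard `Core`
      -- at each of their non-edges; the others then make `g`, `h` tight after each exchange. This
      -- is one half of `Good`, valid for distinct blocks with `e`, `f` not low.
      D4 : (e f g h : Fin m) → ℕ
      D4 e f g h = loss B e f + sum (λ k → sum (λ a → sum (λ b → L e f k a b g h)))

      open FourBlocks N N12 N23 x using (Flat; Follow; Good; good; Quad; quad; same-colour; Coloured)

      flat : ∀ {e f} → e ≢ f → loss B e f ≡ 0 → Flat x (blk e) (blk f)
      flat e≢f eq = state-plane none st e≢f (tight e≢f eq)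

      follow : ∀ {e f g h} → e ≢ f → Apart e f g h → ¬ LowBlock e → ¬ LowBlock f → D4 e f g h ≡ 0 →
               Follow (blk e) (blk f) (blk g) (blk h)
      follow {e} {f} {g} {h} e≢f ap@(g≢h , g≢e , g≢f , h≢e , h≢f) le lf eq k a b nonedge =
          subst₂ (λ s t → ∃ λ τ → ∀ j c d → N (y j) (s c) (t d) ≡ on τ j c d) eqg eqh
            (state-plane none (core-state c) g≢h (subst₂ (λ s t → volume (cube y s t) ≤ 9) (sym eqg) (sym eqh) (∸9-zero gap0)))
        where
          y = tri (x k) (blk e a) (blk f b)
          c : Core e f k a b
          c = e≢f , tight e≢f (m+n≡0⇒m≡0 _ eq) , nonedge , le , lf
          eqg : step B e f k a b (suc g) ≡ blk g
          eqg = update-other B g≢e g≢f _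
          eqh : step B e f k a b (suc h) ≡ blk h
          eqh = update-other B h≢e h≢f _
          L0 : L e f k a b g h ≡ 0
          L0 = ∑≡0⇒ (λ b → L e f k a b g h) (∑≡0⇒ (λ a → sum (λ b → L e f k a b g h))
                 (∑≡0⇒ (λ k → sum (λ a → sum (λ b → L e f k a b g h))) (m+n≡0⇒n≡0 (loss B e f) eq) k) a) b
          gap0 : gap e f k a b g h ≡ 0
          gap0 = guard-yes (apart? e f g h) ap (guard-yes (core? e f k a b) c L0)

      δ-sum low-sum bad-sum good-sum : (e f g h : Fin m) → ℕ
      δ-sum e f g h = δ e f + (δ e g + (δ e h + (δ f g + (δ f h + δ g h))))
      low-sum e f g h = lowᴮ e + (lowᴮ f + (lowᴮ g + lowᴮ h))
      bad-sum e f g h = D4 e f g h + (D4 g h e f + (D4 e g f h + (D4 f h e g + (D4 e h f g + D4 f g e h))))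
      good-sum e f g h = sum (λ i → Q i e f * Q i g h)

      -- Four distinct blocks, none of them low, between which nothing is lost form a Quad.
      accounted : ∀ e f g h → 1 ≤ δ-sum e f g h + low-sum e f g h + bad-sum e f g h + good-sum e f g h
      accounted e f g h = go (δ-sum e f g h + low-sum e f g h + bad-sum e f g h) refl
        where
          quad-colour : δ-sum e f g h + low-sum e f g h + bad-sum e f g h ≡ 0 →
                        ∃ λ i → Coloured i (blk e) (blk f) × Coloured i (blk g) (blk h)
          quad-colour eq = same-colour Qd
            where
              δ0 : δ-sum e f g h ≡ 0
              δ0 = m+n≡0⇒m≡0 _ (m+n≡0⇒m≡0 _ eq)
              l0 : low-sum e f g h ≡ 0
              l0 = m+n≡0⇒n≡0 (δ-sum e f g h) (m+n≡0⇒m≡0 _ eq)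
              b0 : bad-sum e f g h ≡ 0
              b0 = m+n≡0⇒n≡0 (δ-sum e f g h + low-sum e f g h) eq
              hd : ∀ {a b} → a + b ≡ 0 → a ≡ 0
              hd {a} = m+n≡0⇒m≡0 a
              tl : ∀ {a b} → a + b ≡ 0 → b ≡ 0
              tl {a} = m+n≡0⇒n≡0 a
              d1 = δ0
              d2 = tl {δ e f} d1
              d3 = tl {δ e g} d2
              d4 = tl {δ e h} d3
              d5 = tl {δ f g} d4
              d6 = tl {δ f h} d5
              ef : e ≢ f
              ef = δ≡0⇒≢ (hd d1)
              eg : e ≢ g
              eg = δ≡0⇒≢ (hd d2)
              eh : e ≢ h
              eh = δ≡0⇒≢ (hd d3)
              fg : f ≢ g
              fg = δ≡0⇒≢ (hd d4)
              fh : f ≢ h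
              fh = δ≡0⇒≢ (hd d5)
              gh : g ≢ h
              gh = δ≡0⇒≢ d6
              l2 = tl {lowᴮ e} l0
              l3 = tl {lowᴮ f} l2
              le = indicator≡0 (low? e) (hd l0)
              lf = indicator≡0 (low? f) (hd l2)
              lg = indicator≡0 (low? g) (hd l3)
              lh = indicator≡0 (low? h) (tl {lowᴮ g} l3)
              b1 = b0
              b2 = tl {D4 e f g h} b1
              b3 = tl {D4 g h e f} b2
              b4 = tl {D4 e g f h} b3
              b5 = tl {D4 f h e g} b4
              b6 = tl {D4 e h f g} b5
              pair : ∀ {e f g h} → e ≢ f → g ≢ h → e ≢ g → e ≢ h → f ≢ g → f ≢ h →
                     ¬ LowBlock e → ¬ LowBlock f → ¬ LowBlock g → ¬ LowBlock h → D4 e f g h ≡ 0 → D4 g h e f ≡ 0 →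
                     Good (blk e) (blk f) (blk g) (blk h)
              pair ef gh eg eh fg fh le lf lg lh p q =
                good (flat ef (hd p)) (flat gh (hd q))
                     (follow ef (gh , eg ∘ sym , fg ∘ sym , eh ∘ sym , fh ∘ sym) le lf p)
                     (follow gh (ef , eg , eh , fg , fh) lg lh q)
              Qd : Quad (blk e) (blk f) (blk g) (blk h)
              Qd = quad (pair ef gh eg eh fg fh le lf lg lh (hd b1) (hd b2))
                        (pair eg fh ef eh (fg ∘ sym) gh le lg lf lh (hd b3) (hd b4))
                        (pair eh fg ef eg (fh ∘ sym) (gh ∘ sym) le lh lf lg (hd b5) b6)
          go : ∀ t → t ≡ δ-sum e f g h + low-sum e f g h + bad-sum e f g h → 1 ≤ t + good-sum e f g h
          go (suc _) _ = s≤s z≤n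
          go zero eq = ≤-trans (≤-reflexive (sym (cong₂ _*_ (indicator-yes (Q? i e f) (λ a b → trans (proj₁ (proj₂ sc) i a b) (does-refl i)))
                                                        (indicator-yes (Q? i g h) (λ a b → trans (proj₂ (proj₂ sc) i a b) (does-refl i))))))
                           (term≤∑ (λ i → Q i e f * Q i g h) i)
            where
              sc = quad-colour (sym eq)
              i = proj₁ sc

-- c = 10 + 168 r collects all error terms of order p³.
module FinalArithmetic (m s ℓ r q₀ q₁ q₂ : ℕ)
  (count : m * (m * (m * (m * 1))) ≤ 6 * (m * (m * m)) + 4 * (m * (m * (m * s)))
           + 6 * (m * (m * ℓ) + m * (m * (27 * (r * suc m)))) + (q₀ * q₀ + (q₁ * q₁ + (q₂ * q₂ + 0))))
  (ℓ-bound : ℓ ≤ r * suc m) (s²-bound : s * s ≤ ℓ + m)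
  (q₀-bound : 9 * q₀ ≤ 3 * (suc m * suc m) + 8 * suc m)
  (q₁-bound : 9 * q₁ ≤ 3 * (suc m * suc m) + 8 * suc m)
  (q₂-bound : 9 * q₂ ≤ 3 * (suc m * suc m) + 8 * suc m)
  (c : ℕ) (c≡ : c ≡ 10 + 168 * r)
  (large₁ : 24 ≤ suc m) (large₂ : 729 * c ≤ 29 * suc m) (large₃ : 2916 * 2916 * (r + 1) < 400 * 400 * suc m) where

  p X : ℕ
  p = suc m
  X = p * (p * p)

  m≤p : m ≤ p
  m≤p = n≤1+n m

  cube≤ : ∀ y z → y ≤ z → m * (m * y) ≤ p * (p * z)
  cube≤ y z le = *-mono-≤ m≤p (*-mono-≤ m≤p le)

  count′ : m * (m * (m * (m * 1))) ≤ 6 * X + 4 * (p * (p * (p * s))) + 6 * (p * (p * (r * p)) + p * (p * (27 * (r * p))))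
           + (q₀ * q₀ + (q₁ * q₁ + (q₂ * q₂ + 0)))
  count′ = ≤-trans count (+-monoˡ-≤ _ (+-mono-≤
    (+-mono-≤ (*-monoʳ-≤ 6 (cube≤ m p m≤p)) (*-monoʳ-≤ 4 (cube≤ (m * s) (p * s) (*-monoˡ-≤ s m≤p))))
    (*-monoʳ-≤ 6 (+-mono-≤ (cube≤ ℓ (r * p) ℓ-bound) (cube≤ (27 * (r * p)) (27 * (r * p)) ≤-refl)))))

  fourth : p * X ≤ m * (m * (m * (m * 1))) + 4 * X
  fourth = lin {l = 0} {r = 0} (6 * (m * m) + 8 * m + 3) z≤n (eq m)
    where
      eq : ∀ m → suc m * (suc m * (suc m * suc m)) + 0 + (6 * (m * m) + 8 * m + 3) ≡ m * (m * (m * (m * 1))) + 4 * (suc m * (suc m * suc m)) + 0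
      eq = solve-∀

  -- For `p ≥ 24` the bound `q ≤ p²/3 + 8p/9` is relaxed to `27q ≤ 10p²`; the squares of 27 and 10
  -- are 729 and 100.
  square : ∀ q → 9 * q ≤ 3 * (p * p) + 8 * p → 729 * (q * q) ≤ 100 * (p * X)
  square q le = subst₂ _≤_ (eq₁ 27 q) (eq₂ 10 p) (*-mono-≤ le′ le′)
    where
      eq₀ : ∀ q p → 27 * q + (3 * (p * p) + 8 * p + (3 * (p * p) + 8 * p + (3 * (p * p) + 8 * p)) + p * p) + 0 ≡ 10 * (p * p) + (9 * q + (9 * q + 9 * q) + 24 * p)
      eq₀ = solve-∀
      le′ : 27 * q ≤ 10 * (p * p)
      le′ = lin 0 (+-mono-≤ (+-mono-≤ le (+-mono-≤ le le)) (*-monoˡ-≤ p large₁)) (eq₀ q p)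
      eq₁ : ∀ k q → k * q * (k * q) ≡ k * k * (q * q)
      eq₁ = solve-∀
      eq₂ : ∀ k p → k * (p * p) * (k * (p * p)) ≡ k * k * (p * (p * (p * p)))
      eq₂ = solve-∀

  private
    eliminate : ∀ u t v w p r s X m4 a b c → let k = u + 3 * t + v in
      p * X ≤ m4 + 4 * X → m4 ≤ (6 + 4 * s + w * r) * X + (a + (b + (c + 0))) →
      k * a ≤ t * (p * X) → k * b ≤ t * (p * X) → k * c ≤ t * (p * X) → k * (10 + w * r) * X ≤ v * p * X →
      u * p * X ≤ 4 * k * s * X
    eliminate u t v w p r s X m4 a b c h₀ h₁ h₂ h₃ h₄ h₅ =
      lin 0 (+-mono-≤ (*-monoʳ-≤ (u + 3 * t + v) h₀) (+-mono-≤ (*-monoʳ-≤ (u + 3 * t + v) h₁) (+-mono-≤ h₂ (+-mono-≤ h₃ (+-mono-≤ h₄ h₅))))) (eq u t v w p r s X m4 a b c)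
      where
        eq : ∀ u t v w p r s X m4 a b c → let k = u + 3 * t + v in
          u * p * X + (k * (m4 + 4 * X) + (k * ((6 + 4 * s + w * r) * X + (a + (b + (c + 0)))) + (t * (p * X) + (t * (p * X) + (t * (p * X) + v * p * X))))) + 0
          ≡ 4 * k * s * X + (k * (p * X) + (k * m4 + (k * a + (k * b + (k * c + k * (10 + w * r) * X)))))
        eq = solve-∀

    squared : ∀ k t p s r ℓ m → t * p ≤ k * s → s * s ≤ ℓ + m → ℓ ≤ r * p → m ≤ p → t * t * p * p ≤ k * k * (r + 1) * p
    squared k t p s r ℓ m h₀ h₁ h₂ h₃ = ≤-trans (≤-reflexive (eq₂ t p)) (≤-trans (*-mono-≤ h₀ h₀)
        (≤-trans (≤-reflexive (eq₃ k s)) (≤-trans (*-monoʳ-≤ (k * k) (≤-trans h₁ (+-mono-≤ h₂ h₃))) (≤-reflexive (eq₄ k r p)))))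
      where
        eq₂ : ∀ t p → t * t * p * p ≡ t * p * (t * p)
        eq₂ = solve-∀
        eq₃ : ∀ k s → k * s * (k * s) ≡ k * k * (s * s)
        eq₃ = solve-∀
        eq₄ : ∀ k r p → k * k * (r * p + p) ≡ k * k * (r + 1) * p
        eq₄ = solve-∀

  -- Of 729 parts of `p⁴`, the three squares account for at most 300 and the error terms for at most
  -- 29. The remaining 400 must come from quadruples with a low block, of which there are at most
  -- `4sp³`.
  linear : 400 * p ≤ 4 * 729 * s
  linear = *-cancelʳ-≤ (400 * p) (4 * 729 * s) X (eliminate 400 100 29 168 p r s X m4 (q₀ * q₀) (q₁ * q₁) (q₂ * q₂)
             fourth count″ (square q₀ q₀-bound) (square q₁ q₁-bound) (square q₂ q₂-bound)
             (subst (λ c → 729 * c * X ≤ 29 * p * X) c≡ (*-monoˡ-≤ X large₂)))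
    where
      m4 = m * (m * (m * (m * 1)))
      shape : ∀ p s r z → 6 * (p * (p * p)) + 4 * (p * (p * (p * s))) + 6 * (p * (p * (r * p)) + p * (p * (27 * (r * p)))) + z
              ≡ (6 + 4 * s + 168 * r) * (p * (p * p)) + z
      shape = solve-∀
      count″ : m4 ≤ (6 + 4 * s + 168 * r) * X + (q₀ * q₀ + (q₁ * q₁ + (q₂ * q₂ + 0)))
      count″ = ≤-trans count′ (≤-reflexive (shape p s r _))

  -- The number `s` of low blocks would be linear in `p`, but `s² ≤ (r + 1)p`.
  contradiction : ⊥
  contradiction = <-irrefl refl (<-≤-trans large₃ (*-cancelʳ-≤ (400 * 400 * p) (2916 * 2916 * (r + 1)) p
                    (squared 2916 400 p s r ℓ m linear s²-bound ℓ-bound m≤p)))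

∑∑-comm3 : ∀ {m k} (F : Fin m → Fin m → Fin k → ℕ) →
           sum (λ g → sum (λ h → sum (λ j → F g h j))) ≡ sum (λ j → sum (λ g → sum (λ h → F g h j)))
∑∑-comm3 F = trans (sum-cong-≗ (λ g → ∑-comm (λ h j → F g h j))) (∑-comm (λ g j → sum (λ h → F g h j)))

-- Lowering the number of fake blocks

module Descent {n m : ℕ} (h : Fin n → Fin n → Fin n → Bool)
  (h12 : ∀ a b c → h a b c ≡ h b a c) (h23 : ∀ a b c → h a b c ≡ h a c b) (U : Fin n → Set)
  (p : ℕ) (p≡ : p ≡ suc m) (large : 1000000 ≤ p)
  (U-deg : ∀ v → U v → 6 * (p * p) + 3 ≤ Hypergraph.deg₂ {n} {m} h h12 h23 U v + 8 * p)
  (ore : ∀ u v w → h u v w ≡ true →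
         12 * (p * p) + 6 ≤ Hypergraph.deg₂ {n} {m} h h12 h23 U u + Hypergraph.deg₂ {n} {m} h h12 h23 U v + 16 * p) where

  open Hypergraph {n} {m} h h12 h23 U
  open FourfoldSum {m}
  module C = Counting {n} {m} h h12 h23 U p p≡ U-deg ore

  module _ {q} (none : NoCover q) {B : Fin (suc m) → Fin 3 → V} (st : State q B) (inU : ∀ k → U (B zero k)) where
    private
      s ℓ : ℕ
      s = C.s none st inU
      ℓ = C.ℓ none st inU
      lowᴮ : Fin m → ℕ
      lowᴮ = C.lowᴮ none st inU
      D4 D4′ : Weight
      D4 = C.D4 none st inU
      D4′ e f g h = sum (λ k → sum (λ a → sum (λ b → C.L none st inU e f k a b g h)))
      ∑Q : Fin 3 → ℕ
      ∑Q = C.∑Q none st inU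
      m³ : ℕ
      m³ = m * (m * m)

      six : ∀ x → x + (x + (x + (x + (x + x)))) ≡ 6 * x
      six = solve-∀

      δ-total : S4 (C.δ-sum none st inU) ≡ 6 * m³
      δ-total = trans (S4-+ F (λ e f g h → δ e g + (δ e h + (δ f g + (δ f h + δ g h)))))
        (trans (cong₂ _+_ base (trans (S4-+ (λ e f g h → δ e g) (λ e f g h → δ e h + (δ f g + (δ f h + δ g h))))
        (cong₂ _+_ (trans (egfh F) base) (trans (S4-+ (λ e f g h → δ e h) (λ e f g h → δ f g + (δ f h + δ g h)))
        (cong₂ _+_ (trans (ehfg F) base) (trans (S4-+ (λ e f g h → δ f g) (λ e f g h → δ f h + δ g h))
        (cong₂ _+_ (trans (fgeh F) base) (trans (S4-+ (λ e f g h → δ f h) (λ e f g h → δ g h))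
        (cong₂ _+_ (trans (fheg F) base) (trans (ghef F) base)))))))))) (six m³))
        where
          F : Weight
          F e f g h = δ e f
          base : S4 F ≡ m³
          base = trans (S4-const₂ δ) (cong (λ z → m * (m * z)) (∑∑-δ m))

      low-total : S4 (C.low-sum none st inU) ≡ 4 * (m * (m * (m * s)))
      low-total = trans (S4-+ F (λ e f g h → lowᴮ f + (lowᴮ g + lowᴮ h)))
        (trans (cong₂ _+_ base (trans (S4-+ F₂ (λ e f g h → lowᴮ g + lowᴮ h))
        (cong₂ _+_ (trans (swap12 F) base) (trans (S4-+ (λ e f g h → lowᴮ g) (λ e f g h → lowᴮ h))
        (cong₂ _+_ (trans (ghef F) base) (trans (ghef F₂) (trans (swap12 F) base))))))) (four (m * (m * (m * s)))))
        where
          F F₂ : Weight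
          F e f g h = lowᴮ e
          F₂ e f g h = lowᴮ f
          base : S4 F ≡ m * (m * (m * s))
          base = trans (S4-const₂ (λ e f → lowᴮ e)) (cong (λ z → m * (m * z)) (trans (sum-cong-≗ (λ e → ∑-const m (lowᴮ e))) (∑-*ˡ m lowᴮ)))
          four : ∀ x → x + (x + (x + x)) ≡ 4 * x
          four = solve-∀

      bad : ℕ
      bad = m * (m * ℓ) + m * (m * (27 * (204 * p)))

      D4-total : S4 D4 ≤ bad
      D4-total = ≤-trans (≤-reflexive (S4-+ (λ e f g h → loss B e f) D4′))
        (+-mono-≤ (≤-reflexive (S4-const₂ (loss B))) (∑-≤-const (m * (27 * (204 * p))) (λ e → ∑-≤-const (27 * (204 * p)) (λ f → inner e f))))
        where
          r = 204 * p
          L = C.L none st inU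
          inner : ∀ e f → sum (λ g → sum (λ h → D4′ e f g h)) ≤ 27 * r
          inner e f = ≤-trans (≤-reflexive (trans (∑∑-comm3 (λ g h k → sum (λ a → sum (λ b → L e f k a b g h))))
            (sum-cong-≗ (λ k → trans (∑∑-comm3 (λ g h a → sum (λ b → L e f k a b g h)))
              (sum-cong-≗ (λ a → ∑∑-comm3 (λ g h b → L e f k a b g h)))))))
            (≤-trans (∑-≤-const {3} (3 * (3 * r)) (λ k → ∑-≤-const {3} (3 * r) (λ a → ∑-≤-const {3} r (λ b → C.L-bound none st inU e f k a b))))
                     (≤-reflexive (twenty-seven r)))
            where
              twenty-seven : ∀ r → 3 * (3 * (3 * r)) ≡ 27 * r
              twenty-seven = solve-∀

      bad-total : S4 (C.bad-sum none st inU) ≤ 6 * bad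
      bad-total = ≤-trans (≤-reflexive (trans (S4-+ D4 (λ e f g h → D4 g h e f + (D4 e g f h + (D4 f h e g + (D4 e h f g + D4 f g e h)))))
        (cong (S4 D4 +_) (trans (S4-+ (λ e f g h → D4 g h e f) (λ e f g h → D4 e g f h + (D4 f h e g + (D4 e h f g + D4 f g e h))))
        (cong₂ _+_ (ghef D4) (trans (S4-+ (λ e f g h → D4 e g f h) (λ e f g h → D4 f h e g + (D4 e h f g + D4 f g e h)))
        (cong₂ _+_ (egfh D4) (trans (S4-+ (λ e f g h → D4 f h e g) (λ e f g h → D4 e h f g + D4 f g e h))
        (cong₂ _+_ (fheg D4) (trans (S4-+ (λ e f g h → D4 e h f g) (λ e f g h → D4 f g e h))
        (cong₂ _+_ (ehfg D4) (fgeh D4))))))))))))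
        (≤-trans (≤-reflexive (six (S4 D4))) (*-monoʳ-≤ 6 D4-total))

      good-total : S4 (C.good-sum none st inU) ≡ ∑Q 0F * ∑Q 0F + (∑Q 1F * ∑Q 1F + (∑Q 2F * ∑Q 2F + 0))
      good-total = trans (S4-+ (G 0F) (λ e f g h → G 1F e f g h + (G 2F e f g h + 0)))
        (cong₂ _+_ (base 0F) (trans (S4-+ (G 1F) (λ e f g h → G 2F e f g h + 0))
        (cong₂ _+_ (base 1F) (trans (S4-+ (G 2F) (λ e f g h → 0)) (cong₂ _+_ (base 2F) zeros)))))
        where
          G : Fin 3 → Weight
          G i e f g h = C.Q none st inU i e f * C.Q none st inU i g h
          base : ∀ i → S4 (G i) ≡ ∑Q i * ∑Q i
          base i = S4-prod (C.Q none st inU i) (C.Q none st inU i)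
          zeros : S4 (λ e f g h → 0) ≡ 0
          zeros = ∑-zero {m} (λ e → ∑-zero {m} (λ f → ∑-zero {m} (λ g → ∑-zero {m} (λ h → refl))))

      count : m * (m * (m * (m * 1))) ≤ 6 * m³ + 4 * (m * (m * (m * s))) + 6 * bad + (∑Q 0F * ∑Q 0F + (∑Q 1F * ∑Q 1F + (∑Q 2F * ∑Q 2F + 0)))
      count = begin
          m * (m * (m * (m * 1)))
            ≡⟨ sym (trans (∑∑-cong {m} {m} (λ e f → ∑∑-const m m 1)) (∑∑-const m m (m * (m * 1)))) ⟩
          S4 (λ e f g h → 1)
            ≤⟨ S4-mono (C.accounted none st inU) ⟩
          S4 (λ e f g h → Δ e f g h + Λ e f g h + Β e f g h + Γ e f g h)
            ≡⟨ trans (S4-+ (λ e f g h → Δ e f g h + Λ e f g h + Β e f g h) Γ) (cong (_+ S4 Γ)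
                 (trans (S4-+ (λ e f g h → Δ e f g h + Λ e f g h) Β) (cong (_+ S4 Β) (S4-+ Δ Λ)))) ⟩
          S4 Δ + S4 Λ + S4 Β + S4 Γ
            ≤⟨ +-mono-≤ (+-mono-≤ (+-mono-≤ (≤-reflexive δ-total) (≤-reflexive low-total)) bad-total) (≤-reflexive good-total) ⟩
          6 * m³ + 4 * (m * (m * (m * s))) + 6 * bad + (∑Q 0F * ∑Q 0F + (∑Q 1F * ∑Q 1F + (∑Q 2F * ∑Q 2F + 0))) ∎
        where
          open ≤-Reasoning
          Δ Λ Β Γ : Weight
          Δ = C.δ-sum none st inU
          Λ = C.low-sum none st inU
          Β = C.bad-sum none st inU
          Γ = C.good-sum none st inU

    no-state : ⊥
    no-state = finish p p≡ large count (C.loss-bound none st (C.x-high none st inU)) (C.s²-bound none st inU)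
                 (C.∑Q-bound none st inU 0F) (C.∑Q-bound none st inU 1F) (C.∑Q-bound none st inU 2F)
      where
        finish : ∀ p → p ≡ suc m → 1000000 ≤ p →
          m * (m * (m * (m * 1))) ≤ 6 * m³ + 4 * (m * (m * (m * s))) + 6 * (m * (m * ℓ) + m * (m * (27 * (204 * p)))) + (∑Q 0F * ∑Q 0F + (∑Q 1F * ∑Q 1F + (∑Q 2F * ∑Q 2F + 0))) →
          ℓ ≤ 204 * p → s * s ≤ ℓ + m →
          9 * ∑Q 0F ≤ 3 * (p * p) + 8 * p → 9 * ∑Q 1F ≤ 3 * (p * p) + 8 * p → 9 * ∑Q 2F ≤ 3 * (p * p) + 8 * p → ⊥
        finish .(suc m) refl big cnt hℓ hs h₀ h₁ h₂ =
          FinalArithmetic.contradiction m s ℓ 204 (∑Q 0F) (∑Q 1F) (∑Q 2F) cnt hℓ hs h₀ h₁ h₂ 34282 refl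
            -- The second of these three thresholds is the demanding one: it needs `p` above 861000.
            -- Here `34282 = 10 + 168 · 204`.
            (≤-trans (from-yes (24 ≤? 1000000)) big)
            (≤-trans (from-yes (729 * 34282 ≤? 29 * 1000000)) (*-monoʳ-≤ 29 big))
            (<-≤-trans (from-yes (2916 * 2916 * (204 + 1) <? 400 * 400 * 1000000)) (*-monoʳ-≤ (400 * 400) big))

  -- A fake block lies in `U`, so moved to position zero it is the leftover of a state with one fake
  -- block fewer, and `no-state` refutes that state.
  descend : ∀ {q} → NoCover q → NoCover (suc q)
  descend {q} none B cov adm few with any? (λ i → edge (B i) ≟ᵇ false)
  ... | no all = none B cov adm (≤-trans (≤-reflexive (∑-zero genuine)) z≤n)
    where
      genuine : ∀ i → fake (B i) ≡ 0
      genuine i with edge (B i) in eq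
      ... | true  = refl
      ... | false = ⊥-elim (all (i , eq))
  ... | yes (i , eq) = no-state none {B′} (state cov′ (λ j → adm (swap zero i (suc j))) few′) inU
    where
      B′ : Fin (suc m) → Fin 3 → V
      B′ j = B (swap zero i j)
      B′0 : B′ zero ≡ B i
      B′0 = cong B (swap-left zero i)
      cov′ : Cover B′
      cov′ v = let (j , a , e) = cov v in swap zero i j , a , trans (cong (λ k → B k a) (swap-involutive zero i j)) e
      few′ : sum (λ j → fake (B′ (suc j))) ≤ q
      few′ = ≤-pred (≤-trans (≤-reflexive (trans (cong (_+ sum (λ j → fake (B′ (suc j)))) (sym (trans (cong fake B′0) (cong (λ b → # (not b)) eq))))
               (∑-swap zero i (λ j → fake (B j))))) few)
      inU : ∀ k → U (B′ zero k)
      inU k with adm i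
      ... | inj₂ u = subst (λ t → U (t k)) (sym B′0) (u k)
      ... | inj₁ e = ⊥-elim (true≢false e eq)

  noCover : NoCover 0 → ∀ q → NoCover q
  noCover none zero    = none
  noCover none (suc q) = descend (noCover none q)

-- Vertices of small degree

-- Renumbering both classes makes the links of the light vertices graphs on `Fin N`, as shifting
-- requires.
record Split {n} (P : Fin n → Set) : Set where
  field
    ℓ N : ℕ
    l   : Fin ℓ → Fin n
    u   : Fin N → Fin n
    l-P : ∀ i → P (l i)
    u-P : ∀ j → ¬ P (u j)
    onto  : ∀ v → (∃ λ i → l i ≡ v) ⊎ (∃ λ j → u j ≡ v)
    ∑-split : ∀ g → sum g ≡ sum (λ i → g (l i)) + sum (λ j → g (u j))

split : ∀ {n} {P : Fin n → Set} → (∀ v → Dec (P v)) → Split P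
split {zero} P? = record { ℓ = 0 ; N = 0 ; l = λ () ; u = λ () ; l-P = λ () ; u-P = λ () ; onto = λ () ; ∑-split = λ _ → refl }
split {suc n} {P} P? = extend (P? zero)
  where
    open Split (split {n} {P ∘ suc} (P? ∘ suc))
    extend : Dec (P zero) → Split P
    extend (yes p) = record
      { ℓ = suc ℓ ; N = N
      ; l = λ { zero → zero ; (suc i) → suc (l i) } ; u = suc ∘ u
      ; l-P = λ { zero → p ; (suc i) → l-P i } ; u-P = u-P
      ; onto = λ { zero → inj₁ (zero , refl)
                 ; (suc v) → Data.Sum.map (λ (i , e) → suc i , cong suc e) (λ (j , e) → j , cong suc e) (onto v) }
      ; ∑-split = λ g → trans (cong (g zero +_) (∑-split (g ∘ suc))) (sym (+-assoc (g zero) _ _)) }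
    extend (no ¬p) = record
      { ℓ = ℓ ; N = suc N
      ; l = suc ∘ l ; u = λ { zero → zero ; (suc j) → suc (u j) }
      ; l-P = l-P ; u-P = λ { zero → ¬p ; (suc j) → u-P j }
      ; onto = λ { zero → inj₂ (zero , refl)
                 ; (suc v) → Data.Sum.map (λ (i , e) → i , cong suc e) (λ (j , e) → suc j , cong suc e) (onto v) }
      ; ∑-split = λ g → trans (cong (g zero +_) (∑-split (g ∘ suc))) (regroup (g zero) (sum (λ i → g (suc (l i)))) (sum (λ j → g (suc (u j))))) }
      where
        regroup : ∀ a b c → a + (b + c) ≡ b + (a + c)
        regroup = solve-∀

private
  arith-low-low : ∀ a b p → a + 8 * p < 6 * (p * p) + 3 → b + 8 * p < 6 * (p * p) + 3 →
                  12 * (p * p) + 6 ≤ a + b + 16 * p → ⊥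
  arith-low-low a b p h₀ h₁ h₂ = 1+n≰n {0} (lin {1} {0} 1 (+-mono-≤ h₀ (+-mono-≤ h₁ h₂)) (eq a b p))
    where
      eq : ∀ a b p → 1 + (6 * (p * p) + 3 + (6 * (p * p) + 3 + (a + b + 16 * p))) + 1
           ≡ 0 + (suc (a + 8 * p) + (suc (b + 8 * p) + (12 * (p * p) + 6)))
      eq = solve-∀

  arith-L-deg : ∀ x w p ℓ n → n ≡ p * 3 → w + (n + (n + n)) + ℓ * ℓ ≤ n * n + 2 + ℓ → 12 * (p * p) + 6 ≤ x + w + 16 * p →
                3 * (p * p) + 4 + ℓ * ℓ ≤ x + 7 * p + ℓ
  arith-L-deg x w p ℓ _ refl h₀ h₁ = lin 0 (+-mono-≤ h₀ h₁) (eq x w p ℓ)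
    where
      eq : ∀ x w p ℓ → 3 * (p * p) + 4 + ℓ * ℓ + (p * 3 * (p * 3) + 2 + ℓ + (x + w + 16 * p)) + 0
           ≡ x + 7 * p + ℓ + (w + (p * 3 + (p * 3 + p * 3)) + ℓ * ℓ + (12 * (p * p) + 6))
      eq = solve-∀

  arith-few : ∀ d p ℓ N t → ℓ ≡ p + 1 + t → N + ℓ ≡ p * 3 → 3 * (p * p) + 4 + ℓ * ℓ ≤ d + 7 * p + ℓ → d + N ≤ N * N →
              1 ≤ p → ⊥
  arith-few d p _ N t refl e h₀ h₁ h₂ = final N+t≡
    where
      N+t≡ : N + 1 + t ≡ p + p
      N+t≡ = +-cancelˡ-≡ p _ _ (trans (r₁ p N t) (trans e (r₂ p)))
        where
          r₁ : ∀ p N t → p + (N + 1 + t) ≡ N + (p + 1 + t)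
          r₁ = solve-∀
          r₂ : ∀ p → p * 3 ≡ p + (p + p)
          r₂ = solve-∀
      final : N + 1 + t ≡ p + p → ⊥
      -- The equation `N + 1 + t = 2p` is multiplied by `N`, `2p`, `1 + t` and `1` to eliminate the
      -- products with `N`.
      final e′ = 1+n≰n {0} (lin {1} {0} (1 + 4 * (p * t)) (+-mono-≤ h₀ (+-mono-≤ h₁ (+-mono-≤ e₁ (+-mono-≤ e₂ (+-mono-≤ e₃ (+-mono-≤ e₄ (*-monoʳ-≤ (2 * t) h₂))))))) (eq d p N t))
        where
          e₁ : N * (N + 1 + t) ≤ N * (p + p)
          e₁ = ≤-reflexive (cong (N *_) e′)
          e₂ : (p + p) * (N + 1 + t) ≤ (p + p) * (p + p)
          e₂ = ≤-reflexive (cong ((p + p) *_) e′)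
          e₃ : (1 + t) * (p + p) ≤ (1 + t) * (N + 1 + t)
          e₃ = ≤-reflexive (cong ((1 + t) *_) (sym e′))
          e₄ : p + p ≤ N + 1 + t
          e₄ = ≤-reflexive (sym e′)
          eq : ∀ d p N t → 1 + (d + 7 * p + (p + 1 + t) + (N * N + (N * (p + p) + ((p + p) * (p + p) + ((1 + t) * (N + 1 + t) + (N + 1 + t + 2 * t * p)))))) + (1 + 4 * (p * t))
               ≡ 0 + (3 * (p * p) + 4 + (p + 1 + t) * (p + 1 + t) + (d + N + (N * (N + 1 + t) + ((p + p) * (N + 1 + t) + ((1 + t) * (p + p) + (p + p + 2 * t * 1))))))
          eq = solve-∀

module Degrees {n : ℕ} (h : Fin n → Fin n → Fin n → Bool)
  (h12 : ∀ a b c → h a b c ≡ h b a c) (h23 : ∀ a b c → h a b c ≡ h a c b) (h-irr : ∀ a c → h a a c ≡ false)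
  (p : ℕ) (n≡ : n ≡ p * 3)
  (ore : ∀ u v w → h u v w ≡ true → 12 * (p * p) + 6 ≤
         sum (λ a → sum (λ b → # (h u a b))) + sum (λ a → sum (λ b → # (h v a b))) + 16 * p)
  (busy : ∀ v → ∃ λ a → ∃ λ b → h v a b ≡ true) where

  D : Fin n → ℕ
  D v = sum (λ a → sum (λ b → # (h v a b)))

  Light : Fin n → Set
  Light v = D v + 8 * p < 6 * (p * p) + 3

  light? : ∀ v → Dec (Light v)
  light? v = (D v + 8 * p) <? (6 * (p * p) + 3)

  open Split (split light?) public

  U : Fin n → Set
  U v = ¬ Light v

  U-deg : ∀ v → U v → 6 * (p * p) + 3 ≤ D v + 8 * p
  U-deg v = ≮⇒≥

  light-nonadjacent : ∀ {u v} → Light u → Light v → ∀ w → h u v w ≡ false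
  light-nonadjacent {u} {v} lu lv w with h u v w in eq
  ... | false = refl
  ... | true  = ⊥-elim (arith-low-low (D u) (D v) p lu lv (ore u v w eq))

  ∑∑-split : ∀ (g : Fin n → Fin n → ℕ) → sum (λ a → sum (g a)) ≡
    (sum (λ i → sum (λ i′ → g (l i) (l i′))) + sum (λ i → sum (λ j → g (l i) (u j))))
    + (sum (λ j → sum (λ i → g (u j) (l i))) + sum (λ j → sum (λ j′ → g (u j) (u j′))))
  ∑∑-split g = trans (∑-split (λ a → sum (g a))) (cong₂ _+_
    (trans (sum-cong-≗ (λ i → ∑-split (g (l i)))) (∑-distrib-+ (λ i → sum (λ i′ → g (l i) (l i′))) (λ i → sum (λ j → g (l i) (u j)))))
    (trans (sum-cong-≗ (λ j → ∑-split (g (u j)))) (∑-distrib-+ (λ j → sum (λ i → g (u j) (l i))) (λ j → sum (λ j′ → g (u j) (u j′))))))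

  link : Fin n → Graph N
  link v j j′ = h v (u j) (u j′)

  h-irr₂ : ∀ v a → h v a a ≡ false
  h-irr₂ v a = trans (h12 v a a) (trans (h23 a v a) (h-irr a v))

  link-irr : ∀ v → IrrG (link v)
  link-irr v j = h-irr₂ v (u j)

  D-light : ∀ {v} → Light v → D v ≡ size (link v)
  D-light {v} lv = trans (∑∑-split (λ a b → # (h v a b))) (cong₂ _+_
      (cong₂ _+_ (vanish (λ i i′ → left i (l i′))) (vanish (λ i j → left i (u j))))
      (cong (_+ size (link v)) (vanish (λ j i → trans (h23 v (u j) (l i)) (left i (u j))))))
    where
      left : ∀ i b → h v (l i) b ≡ false
      left i b = light-nonadjacent lv (l-P i) b
      vanish : ∀ {s t} {F : Fin s → Fin t → Bool} → (∀ i j → F i j ≡ false) → sum (λ i → sum (λ j → # (F i j))) ≡ 0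
      vanish eq = ∑-zero (λ i → ∑-zero (λ j → cong # (eq i j)))

  ℓ+N : ℓ + N ≡ p * 3
  ℓ+N = trans (sym (trans (∑-split (λ _ → 1)) (cong₂ _+_ (trans (∑-const ℓ 1) (*-identityʳ ℓ)) (trans (∑-const N 1) (*-identityʳ N)))))
              (trans (trans (∑-const n 1) (*-identityʳ n)) n≡)

  λᴸ : Fin n → ℕ
  λᴸ v = indicator (light? v)

  ∑λ : sum λᴸ ≡ ℓ
  ∑λ = trans (∑-split λᴸ) (trans (cong₂ _+_
         (trans (sum-cong-≗ (λ i → indicator-yes (light? (l i)) (l-P i))) (trans (∑-const ℓ 1) (*-identityʳ ℓ)))
         (∑-zero (λ j → indicator-no (light? (u j)) (u-P j)))) (+-identityʳ ℓ))
    where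
      indicator-no : ∀ {A : Set} (d : Dec A) → ¬ A → indicator d ≡ 0
      indicator-no (yes a) na = ⊥-elim (na a)
      indicator-no (no _)  na = refl

  -- None of the pairs (a , b) with a = b, a = w, b = w or a, b both light is an edge with w.
  D-heavy : ∀ {w} → U w → D w + (n + (n + n)) + ℓ * ℓ ≤ n * n + 2 + ℓ
  D-heavy {w} uw = subst₂ _≤_ left right (∑∑-mono pointwise)
    where
      bit : ∀ y → # y + 0 + 0 ≤ 1
      bit true  = ≤-refl
      bit false = z≤n
      pointwise : ∀ a b → # (h w a b) + (δ a b + (δ a w * 1 + 1 * δ b w)) + λᴸ a * λᴸ b ≤ 1 + 2 * (δ a w * δ b w) + λᴸ a * δ a b
      pointwise a b with light? a | light? b | a ≟ᶠ b | a ≟ᶠ w | b ≟ᶠ w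
      ... | yes la | _ | _ | yes refl | _ = ⊥-elim (uw la)
      ... | _ | yes lb | _ | _ | yes refl = ⊥-elim (uw lb)
      ... | _ | _ | no ne | yes refl | yes refl = ⊥-elim (ne refl)
      ... | _ | _ | yes refl | yes refl | no ne = ⊥-elim (ne refl)
      ... | _ | _ | yes refl | no ne | yes refl = ⊥-elim (ne refl)
      ... | yes la | no nb | yes refl | _ | _ = ⊥-elim (nb la)
      ... | no na | yes lb | yes refl | _ | _ = ⊥-elim (na lb)
      ... | yes la | yes lb | no _ | no _ | no _ rewrite trans (h12 w a b) (trans (h23 a w b) (light-nonadjacent la lb w)) = ≤-refl
      ... | yes la | no _ | no _ | no _ | no _ = bit (h w a b)
      ... | no _ | yes _ | no _ | no _ | no _ = bit (h w a b)
      ... | no _ | no _ | no _ | no _ | no _ = bit (h w a b)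
      ... | yes _ | yes _ | yes refl | no _ | no _ rewrite h-irr₂ w a = ≤-refl
      ... | no _ | no _ | yes refl | yes refl | yes refl rewrite h-irr₂ w w = ≤-refl
      ... | no _ | no _ | yes refl | no _ | no _ rewrite h-irr₂ w a = ≤-refl
      ... | no _ | no _ | no _ | yes refl | no _ rewrite h-irr w b = ≤-refl
      ... | yes _ | no _ | no _ | no _ | yes refl rewrite trans (h23 w a w) (h-irr w a) = ≤-refl
      ... | no _ | yes _ | no _ | yes refl | no _ rewrite h-irr w b = ≤-refl
      ... | no _ | no _ | no _ | no _ | yes refl rewrite trans (h23 w a w) (h-irr w a) = ≤-refl
      n1 : ∀ k → sum {k} (λ _ → 1) ≡ k
      n1 k = trans (∑-const k 1) (*-identityʳ k)
      left : sum (λ a → sum (λ b → # (h w a b) + (δ a b + (δ a w * 1 + 1 * δ b w)) + λᴸ a * λᴸ b)) ≡ D w + (n + (n + n)) + ℓ * ℓ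
      left = trans (∑∑-+ (λ a b → # (h w a b) + (δ a b + (δ a w * 1 + 1 * δ b w))) (λ a b → λᴸ a * λᴸ b)) (cong₂ _+_
        (trans (∑∑-+ (λ a b → # (h w a b)) (λ a b → δ a b + (δ a w * 1 + 1 * δ b w))) (cong (D w +_)
          (trans (∑∑-+ δ (λ a b → δ a w * 1 + 1 * δ b w)) (cong₂ _+_ (∑∑-δ n)
            (trans (∑∑-+ {n} {n} (λ a b → δ a w * 1) (λ a b → 1 * δ b w)) (cong₂ _+_
              (trans (∑-prod {n} {n} (λ a → δ a w) (λ _ → 1)) (trans (cong₂ _*_ (∑-δ1 w) (n1 n)) (*-identityˡ n)))
              (trans (∑-prod {n} {n} (λ _ → 1) (λ b → δ b w)) (trans (cong₂ _*_ (n1 n) (∑-δ1 w)) (*-identityʳ n)))))))))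
        (trans (∑-prod λᴸ λᴸ) (cong₂ _*_ ∑λ ∑λ)))
      right : sum (λ a → sum (λ b → 1 + 2 * (δ a w * δ b w) + λᴸ a * δ a b)) ≡ n * n + 2 + ℓ
      right = trans (∑∑-+ (λ a b → 1 + 2 * (δ a w * δ b w)) (λ a b → λᴸ a * δ a b)) (cong₂ _+_
        (trans (∑∑-+ {n} {n} (λ _ _ → 1) (λ a b → 2 * (δ a w * δ b w))) (cong₂ _+_ (trans (∑∑-const n n 1) (cong (n *_) (*-identityʳ n)))
          (trans (sum-cong-≗ {n} (λ a → ∑-*ˡ 2 (λ b → δ a w * δ b w))) (trans (∑-*ˡ 2 (λ a → sum (λ b → δ a w * δ b w)))
            (cong (2 *_) (trans (∑-prod (λ a → δ a w) (λ b → δ b w)) (cong₂ _*_ (∑-δ1 w) (∑-δ1 w))))))))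
        (trans (sum-cong-≗ (λ a → trans (∑-*ˡ (λᴸ a) (δ a)) (trans (cong (λᴸ a *_) (∑-δʳ a)) (*-identityʳ (λᴸ a))))) ∑λ))

  -- A light vertex has a neighbour, which cannot be light. The upper bound `D-heavy` for the
  -- neighbour turns the degree-sum condition into a lower bound for `x`.
  L-deg : ∀ {x} → Light x → 3 * (p * p) + 4 + ℓ * ℓ ≤ D x + 7 * p + ℓ
  L-deg {x} lx = let (a , b , e) = busy x in
    arith-L-deg (D x) (D a) p ℓ n n≡ (D-heavy (λ la → true≢false e (light-nonadjacent lx la b))) (ore x a b e)

  size≤ : ∀ v → size (link v) + N ≤ N * N
  size≤ v = ≤-trans (≤-reflexive (trans (cong (size (link v) +_) (sym (∑∑-δ N))) (sym (∑∑-+ (λ j j′ → # (link v j j′)) δ))))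
                    (≤-trans (∑∑-mono pointwise) (≤-reflexive (trans (∑∑-const N N 1) (cong (N *_) (*-identityʳ N)))))
    where
      pointwise : ∀ j j′ → # (link v j j′) + δ j j′ ≤ 1
      pointwise j j′ with j ≟ᶠ j′
      ... | yes refl = ≤-reflexive (cong (λ y → # y + 1) (link-irr v j))
      ... | no _     = ≤-trans (≤-reflexive (+-identityʳ _)) (#≤1 (link v j j′))

  D-light≤ : ∀ {v} → Light v → D v + N ≤ N * N
  D-light≤ {v} lv = ≤-trans (≤-reflexive (cong (_+ N) (D-light lv))) (size≤ v)

  -- With more light vertices, the link of one of them has too few vertices for `L-deg`. The margin
  -- is tight: for `ℓ = p + 1`, the shape of `H*`, the degree is at least `4p² − 6p + 4` and at most
  -- `(2p − 1)(2p − 2) = 4p² − 6p + 2`.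
  ℓ≤p : 1 ≤ p → ℓ ≤ p
  ℓ≤p 1≤p with ℓ ≤? p
  ... | yes le = le
  ... | no ¬le = ⊥-elim (arith-few (D x) p ℓ N (ℓ ∸ suc p)
        (sym (trans (cong (_+ (ℓ ∸ suc p)) (+-comm p 1)) (m+[n∸m]≡n p<ℓ))) (trans (+-comm N ℓ) ℓ+N)
        (L-deg (l-P first)) (D-light≤ (l-P first)) 1≤p)
    where
      p<ℓ : p < ℓ
      p<ℓ = ≰⇒> ¬le
      first : Fin ℓ
      first = fromℕ< {0} (≤-trans (s≤s z≤n) p<ℓ)
      x : Fin n
      x = l first

-- Covering the light vertices by a rainbow matching

module Slots (k r : ℕ) where

  -- The nested matching with pairs `{i, 2k − 1 − i}` on the first `2k` vertices: graphs with a
  -- larger `lo` have a smaller `hi`, which balances the two ways in which a stable graph can avoid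
  -- its pair.
  lo hi : Fin k → Fin (k + (k + r))
  lo i = i ↑ˡ (k + r)
  hi i = k ↑ʳ (opposite i ↑ˡ r)

  rest : Fin r → Fin (k + (k + r))
  rest t = k ↑ʳ (k ↑ʳ t)

  slots : ∀ x → (∃ λ i → lo i ≡ x) ⊎ (∃ λ i → hi i ≡ x) ⊎ (∃ λ t → rest t ≡ x)
  slots x with splitAt k x in eq
  ... | inj₁ i = inj₁ (i , trans (cong (join k (k + r)) (sym eq)) (join-splitAt k (k + r) x))
  ... | inj₂ y with splitAt k y in eq′
  ...   | inj₁ i = inj₂ (inj₁ (opposite i , trans (cong (λ z → k ↑ʳ (z ↑ˡ r)) (opposite-involutive i)) (trans (cong (k ↑ʳ_) (trans (cong (join k r) (sym eq′)) (join-splitAt k r y)))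
                      (trans (cong (join k (k + r)) (sym eq)) (join-splitAt k (k + r) x)))))
  ...   | inj₂ t = inj₂ (inj₂ (t , trans (cong (k ↑ʳ_) (trans (cong (join k r) (sym eq′)) (join-splitAt k r y)))
                      (trans (cong (join k (k + r)) (sym eq)) (join-splitAt k (k + r) x))))

  toℕ-lo : ∀ i → toℕ (lo i) ≡ toℕ i
  toℕ-lo i = toℕ-↑ˡ i (k + r)

  toℕ-hi : ∀ i → toℕ (hi i) ≡ k + toℕ (opposite i)
  toℕ-hi i = trans (toℕ-↑ʳ k (opposite i ↑ˡ r)) (cong (k +_) (toℕ-↑ˡ (opposite i) r))

  i+opposite : ∀ i → suc (toℕ i) + toℕ (opposite i) ≡ k
  i+opposite i = trans (cong (suc (toℕ i) +_) (opposite-prop i)) (m+[n∸m]≡n (toℕ<n i))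

  lo<k : ∀ i → toℕ (lo i) < k
  lo<k i = subst (_< k) (sym (toℕ-lo i)) (toℕ<n i)

  k≤hi : ∀ i → k ≤ toℕ (hi i)
  k≤hi i = subst (k ≤_) (sym (toℕ-hi i)) (m≤m+n k _)

  lo≢hi : ∀ i j → lo i ≢ hi j
  lo≢hi i j eq = <-irrefl (cong toℕ eq) (<-≤-trans (lo<k i) (k≤hi j))

  lo-injective : ∀ {i j} → lo i ≡ lo j → i ≡ j
  lo-injective {i} {j} = ↑ˡ-injective (k + r) i j

  hi-injective : ∀ {i j} → hi i ≡ hi j → i ≡ j
  hi-injective {i} {j} eq = trans (sym (opposite-involutive i)) (trans (cong opposite
    (↑ˡ-injective r (opposite i) (opposite j) (↑ʳ-injective k _ _ eq))) (opposite-involutive j))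

  open Rainbow lo hi (λ i → <-≤-trans (lo<k i) (k≤hi i)) lo-injective hi-injective lo≢hi public using (NoRainbow)

  rainbow : ∀ (F : Fin k → Graph (k + (k + r))) → (∀ i → SymG (F i)) → (∀ i → IrrG (F i)) →
            (∀ i a j → suc a + j ≡ k → (k + j) * (k + j) + 2 * (a * (k + (k + r))) < size (F i) + 2 * (a * (k + j))) →
            ¬ NoRainbow F
  rainbow F symF irrF big = Rainbow.rainbow lo hi (λ i → <-≤-trans (lo<k i) (k≤hi i)) lo-injective hi-injective lo≢hi F symF irrF
    (λ i → subst₂ (λ a b → b * b + 2 * (a * (k + (k + r))) < size (F i) + 2 * (a * b)) (sym (toℕ-lo i)) (sym (toℕ-hi i))
             (big i (toℕ i) (toℕ (opposite i)) (i+opposite i)))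

private
  arith-many : ∀ i j s d → 15 ≤ i + j + s → let k = suc i + j ; p = k + suc s in
    3 * (p * p) + 4 + k * k ≤ d + 7 * p + k → (k + j) * (k + j) + 2 * (i * (k + (k + suc s * 3))) < d + 2 * (i * (k + j))
  arith-many i j s d big h₀ = lin (3 * (s * s) + 6 * (s * j) + 4 * (i * j)) (+-mono-≤ h₀ quad) (eq i j s d)
    where
      -- All other terms compare directly. Here `i²` suffices for `i ≥ 4`; for `i ≤ 3` the
      -- assumption gives `j + s ≥ 12`.
      quad : 4 * i ≤ i * i + 5 * s + 2 * j
      quad with 4 ≤? i
      ... | yes le = ≤-trans (*-monoˡ-≤ i le) (≤-trans (m≤m+n (i * i) (5 * s)) (m≤m+n _ (2 * j)))
      ... | no nle = ≤-trans (*-monoʳ-≤ 4 i≤3) (lin (12 + 3 * s + i * i) (+-mono-≤ (*-monoʳ-≤ 2 big) (*-monoʳ-≤ 2 i≤3)) (eq₁ i j s))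
        where
          i≤3 : i ≤ 3
          i≤3 = ≤-pred (≰⇒> nle)
          eq₁ : ∀ i j s → 4 * 3 + (2 * (i + j + s) + 2 * 3) + (12 + 3 * s + i * i) ≡ i * i + 5 * s + 2 * j + (2 * 15 + 2 * i)
          eq₁ = solve-∀
      eq : ∀ i j s d → let k = suc i + j ; p = k + suc s in
        suc ((k + j) * (k + j) + 2 * (i * (k + (k + suc s * 3)))) + (d + 7 * p + k + (i * i + 5 * s + 2 * j)) + (3 * (s * s) + 6 * (s * j) + 4 * (i * j))
        ≡ d + 2 * (i * (k + j)) + (3 * (p * p) + 4 + k * k + 4 * i)
      eq = solve-∀

module FewLight {n : ℕ} (h : Fin n → Fin n → Fin n → Bool)
  (h23 : ∀ a b c → h a b c ≡ h a c b) (h-irr₂ : ∀ v a → h v a a ≡ false) (U : Fin n → Set) (ℓ s : ℕ)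
  (l : Fin ℓ → Fin n) (u : Fin (ℓ + (ℓ + suc s * 3)) → Fin n) (uU : ∀ j → U (u j))
  (onto : ∀ v → (∃ λ i → l i ≡ v) ⊎ (∃ λ j → u j ≡ v))
  (deg : ∀ i → 3 * ((ℓ + suc s) * (ℓ + suc s)) + 4 + ℓ * ℓ ≤ size (λ j j′ → h (l i) (u j) (u j′)) + 7 * (ℓ + suc s) + ℓ)
  (large : 20 ≤ ℓ + suc s) where

  open Slots ℓ (suc s * 3)

  Good : (Fin 3 → Fin n) → Set
  Good t = h (t zero) (t (suc zero)) (t (suc (suc zero))) ≡ true ⊎ (∀ a → U (t a))

  some-cover : (∀ (B : Fin (ℓ + suc s) → Fin 3 → Fin n) → Cover B → (∀ i → Good (B i)) → ⊥) → ⊥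
  some-cover none = rainbow (λ i j j′ → h (l i) (u j) (u j′)) (λ i j j′ → h23 (l i) (u j) (u j′)) (λ i j → h-irr₂ (l i) (u j)) big cover
    where
      big : ∀ i a j → suc a + j ≡ ℓ → (ℓ + j) * (ℓ + j) + 2 * (a * (ℓ + (ℓ + suc s * 3))) < size (λ j j′ → h (l i) (u j) (u j′)) + 2 * (a * (ℓ + j))
      big i a j eq = go ℓ (size (λ j j′ → h (l i) (u j) (u j′))) (deg i) large eq
        where
          go : ∀ ℓ d → 3 * ((ℓ + suc s) * (ℓ + suc s)) + 4 + ℓ * ℓ ≤ d + 7 * (ℓ + suc s) + ℓ → 20 ≤ ℓ + suc s → suc a + j ≡ ℓ →
               (ℓ + j) * (ℓ + j) + 2 * (a * (ℓ + (ℓ + suc s * 3))) < d + 2 * (a * (ℓ + j))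
          go _ d dg lg refl = arith-many a j s d (≤-trans (from-yes (15 ≤? 18)) (≤-pred (≤-pred (subst (20 ≤_) (eq₂ a j s) lg)))) dg
            where
              eq₂ : ∀ a j s → suc a + j + suc s ≡ suc (suc (a + j + s))
              eq₂ = solve-∀
      cover : NoRainbow (λ i j j′ → h (l i) (u j) (u j′))
      cover π rainbow-edges = none B cov good
        where
          at : Fin ℓ ⊎ Fin (suc s) → Fin 3 → Fin n
          at (inj₁ i) = tri (l i) (u (π ⟨$⟩ʳ lo i)) (u (π ⟨$⟩ʳ hi i))
          at (inj₂ t) a = u (π ⟨$⟩ʳ rest (combine t a))
          B : Fin (ℓ + suc s) → Fin 3 → Fin n
          B x = at (splitAt ℓ x)
          B-left : ∀ i a → B (i ↑ˡ suc s) a ≡ at (inj₁ i) a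
          B-left i a = cong (λ z → at z a) (splitAt-↑ˡ ℓ i (suc s))
          B-right : ∀ t a → B (ℓ ↑ʳ t) a ≡ at (inj₂ t) a
          B-right t a = cong (λ z → at z a) (splitAt-↑ʳ ℓ (suc s) t)
          good : ∀ x → Good (B x)
          good x with splitAt ℓ x
          ... | inj₁ i = inj₁ (rainbow-edges i)
          ... | inj₂ t = inj₂ (λ a → uU _)
          cov : Cover B
          cov v with onto v
          ... | inj₁ (i , refl) = i ↑ˡ suc s , zero , B-left i zero
          ... | inj₂ (j , refl) with slots (π ⟨$⟩ˡ j)
          ...   | inj₁ (i , eq) = i ↑ˡ suc s , suc zero , trans (B-left i (suc zero)) (cong u (trans (cong (π ⟨$⟩ʳ_) eq) (inverseʳ π)))
          ...   | inj₂ (inj₁ (i , eq)) = i ↑ˡ suc s , suc (suc zero) , trans (B-left i (suc (suc zero))) (cong u (trans (cong (π ⟨$⟩ʳ_) eq) (inverseʳ π)))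
          ...   | inj₂ (inj₂ (c , eq)) = ℓ ↑ʳ proj₁ (remQuot {suc s} 3 c) , proj₂ (remQuot {suc s} 3 c) ,
                    trans (B-right (proj₁ (remQuot {suc s} 3 c)) (proj₂ (remQuot {suc s} 3 c))) (cong u (trans (cong (λ z → π ⟨$⟩ʳ rest z) (combine-remQuot {suc s} 3 c)) (trans (cong (π ⟨$⟩ʳ_) eq) (inverseʳ π))))

∑-injective : ∀ {a b} (φ : Fin a → Fin b) → (∀ {i j} → φ i ≡ φ j → i ≡ j) → ∀ (g : Fin b → ℕ) → sum (λ i → g (φ i)) ≤ sum g
∑-injective φ inj g = ≤-trans (≤-reflexive (trans (sum-cong-≗ (λ i → sym (∑-δ g (φ i)))) (∑-comm (λ i j → δ j (φ i) * g j))))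
    (∑-mono (λ j → ≤-trans (≤-reflexive (∑-*ʳ (g j) (λ i → δ j (φ i)))) (≤-trans (*-monoˡ-≤ (g j) (once φ inj j)) (≤-reflexive (*-identityˡ (g j))))))
  where
    once : ∀ {a b} (φ : Fin a → Fin b) → (∀ {i j} → φ i ≡ φ j → i ≡ j) → ∀ j → sum (λ i → δ j (φ i)) ≤ 1
    once {zero} φ inj j = z≤n
    once {suc a} φ inj j with j ≟ᶠ φ zero
    ... | no _ = once (φ ∘ suc) (λ eq → suc-inj (inj eq)) j
      where
        suc-inj : ∀ {x y : Fin a} → Fin.suc x ≡ suc y → x ≡ y
        suc-inj refl = refl
    ... | yes refl = ≤-reflexive (cong suc (∑-zero {a} {λ i → δ (φ zero) (φ (suc i))} (λ i → δ-≢ (λ eq → zero≢suc {i} (inj eq)))))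
      where
        zero≢suc : ∀ {i : Fin a} → zero ≢ suc i
        zero≢suc ()

∑∑-injective : ∀ {a b c d} (φ : Fin a → Fin b) (ψ : Fin c → Fin d) → (∀ {i j} → φ i ≡ φ j → i ≡ j) → (∀ {i j} → ψ i ≡ ψ j → i ≡ j) →
               ∀ (g : Fin b → Fin d → ℕ) → sum (λ i → sum (λ j → g (φ i) (ψ j))) ≤ sum (λ i → sum (g i))
∑∑-injective φ ψ φ-inj ψ-inj g = ≤-trans (∑-mono (λ i → ∑-injective ψ ψ-inj (g (φ i)))) (∑-injective φ φ-inj (λ i → sum (g i)))

private
  arith-last : ∀ i j d → let k = suc i + j ; p = suc k in 3 * (p * p) + 4 + p * p ≤ d + 7 * p + p →
    (k + j) * (k + j) + 2 * (i * (k + (k + 2))) < d + 2 * (i * (k + j))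
  arith-last i j d h₀ = lin (i * i + 2 + 4 * (i * j) + 4 * j) h₀ (eq i j d)
    where
      eq : ∀ i j d → let k = suc i + j ; p = suc k in
        suc ((k + j) * (k + j) + 2 * (i * (k + (k + 2)))) + (d + 7 * p + p) + (i * i + 2 + 4 * (i * j) + 4 * j)
        ≡ d + 2 * (i * (k + j)) + (3 * (p * p) + 4 + p * p)
      eq = solve-∀

  arith-triples : ∀ m → 100 ≤ m → ¬ (m * (m * m) ≤ 3 * (m * m) + m * (7 * suc m) + m * (7 * suc m) + m * (8 * suc m) + m * (8 * suc m))
  arith-triples m big h₀ = 1+n≰n {0} (lin {1} {0} (66 * (m * m) + 69 * m + 99)
      (+-mono-≤ h₀ (+-mono-≤ (*-monoˡ-≤ (m * m) big) (+-mono-≤ (*-monoˡ-≤ m big) big))) (eq m))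
    where
      eq : ∀ m → 1 + (3 * (m * m) + m * (7 * suc m) + m * (7 * suc m) + m * (8 * suc m) + m * (8 * suc m) + (m * (m * m) + (m * m + m)))
           + (66 * (m * m) + 69 * m + 99) ≡ 0 + (m * (m * m) + (100 * (m * m) + (100 * m + 100)))
      eq = solve-∀

update₃ : ∀ {A : Set} {m} → (Fin (suc m) → A) → (e f g : Fin m) → (t₀ t₁ t₂ t₃ : A) → Fin (suc m) → A
update₃ B e f g t₀ t₁ t₂ t₃ zero = t₀
update₃ B e f g t₀ t₁ t₂ t₃ (suc i) with i ≟ᶠ e | i ≟ᶠ f | i ≟ᶠ g
... | yes _ | _     | _     = t₁
... | no _  | yes _ | _     = t₂
... | no _  | no _  | yes _ = t₃
... | no _  | no _  | no _  = B (suc i)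

module _ {A : Set} {m} (B : Fin (suc m) → A) {e f g : Fin m} (ef : e ≢ f) (eg : e ≢ g) (fg : f ≢ g) (t₀ t₁ t₂ t₃ : A) where

  private
    B′ : Fin (suc m) → A
    B′ = update₃ B e f g t₀ t₁ t₂ t₃

  update₃-e : B′ (suc e) ≡ t₁
  update₃-e with e ≟ᶠ e
  ... | yes _ = refl
  ... | no ne = ⊥-elim (ne refl)

  update₃-f : B′ (suc f) ≡ t₂
  update₃-f with f ≟ᶠ e | f ≟ᶠ f
  ... | yes p | _     = ⊥-elim (ef (sym p))
  ... | no _  | yes _ = refl
  ... | no _  | no ne = ⊥-elim (ne refl)

  update₃-g : B′ (suc g) ≡ t₃
  update₃-g with g ≟ᶠ e | g ≟ᶠ f | g ≟ᶠ g
  ... | yes p | _     | _     = ⊥-elim (eg (sym p))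
  ... | no _  | yes p | _     = ⊥-elim (fg (sym p))
  ... | no _  | no _  | yes _ = refl
  ... | no _  | no _  | no ne = ⊥-elim (ne refl)

  update₃-other : ∀ {i} → i ≢ e → i ≢ f → i ≢ g → B′ (suc i) ≡ B (suc i)
  update₃-other {i} p q r with i ≟ᶠ e | i ≟ᶠ f | i ≟ᶠ g
  ... | yes p′ | _      | _      = ⊥-elim (p p′)
  ... | no _   | yes q′ | _      = ⊥-elim (q q′)
  ... | no _   | no _   | yes r′ = ⊥-elim (r r′)
  ... | no _   | no _   | no _   = refl

  update₃-all : (P : A → Set) → (∀ i → P (B (suc i))) → P t₀ → P t₁ → P t₂ → P t₃ → ∀ i → P (B′ i)
  update₃-all P old p₀ p₁ p₂ p₃ zero = p₀
  update₃-all P old p₀ p₁ p₂ p₃ (suc i) with i ≟ᶠ e | i ≟ᶠ f | i ≟ᶠ g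
  ... | yes _ | _     | _     = p₁
  ... | no _  | yes _ | _     = p₂
  ... | no _  | no _  | yes _ = p₃
  ... | no _  | no _  | no _  = old i

-- The case of exactly p light vertices

module ManyLight {n : ℕ} (h : Fin n → Fin n → Fin n → Bool)
  (h23 : ∀ a b c → h a b c ≡ h a c b) (h-irr₂ : ∀ v a → h v a a ≡ false) (m : ℕ)
  (l : Fin (suc m) → Fin n) (u : Fin (m + (m + 2)) → Fin n)
  (onto : ∀ v → (∃ λ i → l i ≡ v) ⊎ (∃ λ j → u j ≡ v))
  (deg : ∀ i → 3 * (suc m * suc m) + 4 + suc m * suc m ≤ size (λ j j′ → h (l i) (u j) (u j′)) + 7 * suc m + suc m)
  (missL : ∀ i → sum (λ j → sum (λ j′ → # (not (h (l i) (u j) (u j′))))) ≤ 8 * suc m)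
  (missU : ∀ j → sum (λ j′ → sum (λ i → # (not (h (u j) (u j′) (l i))))) ≤ 7 * suc m)
  (large : 100 ≤ m) where

  open Slots m 2

  edge : (Fin 3 → Fin n) → Bool
  edge t = h (t zero) (t (suc zero)) (t (suc (suc zero)))

  -- For all `p` light vertices the pair with `lo = 0` would need size above `(2p − 1)²`, but only
  -- `4p² − 8p + 4 = 4m²` is known. For `m` of them `(2m − 1)²` is enough. The omitted vertex
  -- `l zero` and the two unmatched vertices form one block that may fail to be an edge.
  some-cover : (∀ (B : Fin (suc m) → Fin 3 → Fin n) → Cover B → (∀ i → edge (B i) ≡ true) → ⊥) → ⊥
  some-cover none = rainbow (λ i j j′ → h (l (suc i)) (u j) (u j′)) (λ i j j′ → h23 (l (suc i)) (u j) (u j′))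
                            (λ i j → h-irr₂ (l (suc i)) (u j)) big augment
    where
      big : ∀ i a j → suc a + j ≡ m → (m + j) * (m + j) + 2 * (a * (m + (m + 2))) < size (λ j j′ → h (l (suc i)) (u j) (u j′)) + 2 * (a * (m + j))
      big i a j eq = go m (size (λ j j′ → h (l (suc i)) (u j) (u j′))) (deg (suc i)) eq
        where
          go : ∀ m d → 3 * (suc m * suc m) + 4 + suc m * suc m ≤ d + 7 * suc m + suc m → suc a + j ≡ m →
               (m + j) * (m + j) + 2 * (a * (m + (m + 2))) < d + 2 * (a * (m + j))
          go _ d dg refl = arith-last a j d dg
      augment : NoRainbow (λ i j j′ → h (l (suc i)) (u j) (u j′))
      augment π rainbow-edges = arith-triples m large count
        where
          φ ψ : Fin m → Fin (m + (m + 2))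
          φ i = π ⟨$⟩ʳ lo i
          ψ i = π ⟨$⟩ʳ hi i
          φ-inj : ∀ {i j} → φ i ≡ φ j → i ≡ j
          φ-inj eq = lo-injective (permutation-injective π eq)
          ψ-inj : ∀ {i j} → ψ i ≡ ψ j → i ≡ j
          ψ-inj eq = hi-injective (permutation-injective π eq)
          x w₀ w₁ : Fin n
          x  = l zero
          w₀ = u (π ⟨$⟩ʳ rest zero)
          w₁ = u (π ⟨$⟩ʳ rest (suc zero))
          B : Fin (suc m) → Fin 3 → Fin n
          B zero    = tri x w₀ w₁
          B (suc i) = tri (l (suc i)) (u (φ i)) (u (ψ i))
          back : ∀ {j s} → s ≡ π ⟨$⟩ˡ j → u (π ⟨$⟩ʳ s) ≡ u j
          back eq = cong u (trans (cong (π ⟨$⟩ʳ_) eq) (inverseʳ π))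
          cov : Cover B
          cov v with onto v
          ... | inj₁ (zero , refl) = zero , zero , refl
          ... | inj₁ (suc i , refl) = suc i , zero , refl
          ... | inj₂ (j , refl) with slots (π ⟨$⟩ˡ j)
          ...   | inj₁ (i , eq) = suc i , suc zero , back eq
          ...   | inj₂ (inj₁ (i , eq)) = suc i , suc (suc zero) , back eq
          ...   | inj₂ (inj₂ (zero , eq)) = zero , suc zero , back eq
          ...   | inj₂ (inj₂ (suc zero , eq)) = zero , suc (suc zero) , back eq
          -- The link of a vertex of `U` is known to be nearly complete only between `U` and `L`,
          -- that of a light vertex only inside `U`. The new triples respect this: each has one
          -- light vertex, and `w₀`, `w₁` go with one vertex of each kind.
          α β γ : Fin m → Fin m → ℕ
          α e f = # (not (h w₀ (u (φ e)) (l (suc f))))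
          β f g = # (not (h w₁ (u (φ f)) (l (suc g))))
          γ e g = # (not (h x (u (φ g)) (u (ψ e))))
          ε₃ : Fin m → Fin m → Fin m → ℕ
          ε₃ e f g = # (not (h (l (suc e)) (u (ψ f)) (u (ψ g))))

          -- Otherwise the blocks {x, w₀, w₁}, e, f, g could be replaced by t₀, …, t₃.
          blocked : ∀ e f g → e ≢ f → e ≢ g → f ≢ g → α e f + β f g + γ e g + ε₃ e f g ≢ 0
          blocked e f g ef eg fg eq = none B′ cov′ (update₃-all B ef eg fg t₀ t₁ t₂ t₃ (λ t → edge t ≡ true) rainbow-edges
              (#-zero _ (m+n≡0⇒m≡0 _ (m+n≡0⇒m≡0 _ (m+n≡0⇒m≡0 _ eq)))) (#-zero _ (m+n≡0⇒n≡0 (α e f) (m+n≡0⇒m≡0 _ (m+n≡0⇒m≡0 _ eq))))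
              (#-zero _ (m+n≡0⇒n≡0 (α e f + β f g) (m+n≡0⇒m≡0 _ eq))) (#-zero _ (m+n≡0⇒n≡0 (α e f + β f g + γ e g) eq)))
            where
              t₀ t₁ t₂ t₃ : Fin 3 → Fin n
              t₀ = tri w₀ (u (φ e)) (l (suc f))
              t₁ = tri w₁ (u (φ f)) (l (suc g))
              t₂ = tri x (u (φ g)) (u (ψ e))
              t₃ = tri (l (suc e)) (u (ψ f)) (u (ψ g))
              B′ : Fin (suc m) → Fin 3 → Fin n
              B′ = update₃ B e f g t₀ t₁ t₂ t₃
              Located : Fin n → Set
              Located v = ∃ λ i → ∃ λ a → B′ i a ≡ v
              at₁ : ∀ a → Located (t₁ a)
              at₁ a = suc e , a , cong (λ t → t a) (update₃-e B ef eg fg t₀ t₁ t₂ t₃)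
              at₂ : ∀ a → Located (t₂ a)
              at₂ a = suc f , a , cong (λ t → t a) (update₃-f B ef eg fg t₀ t₁ t₂ t₃)
              at₃ : ∀ a → Located (t₃ a)
              at₃ a = suc g , a , cong (λ t → t a) (update₃-g B ef eg fg t₀ t₁ t₂ t₃)
              move : ∀ i a → Located (B i a)
              move zero 0F = at₂ 0F
              move zero 1F = zero , 0F , refl
              move zero 2F = at₁ 0F
              move (suc i) a = go (i ≟ᶠ e) (i ≟ᶠ f) (i ≟ᶠ g) a
                where
                  go : Dec (i ≡ e) → Dec (i ≡ f) → Dec (i ≡ g) → ∀ a → Located (B (suc i) a)
                  go (yes refl) _ _ 0F = at₃ 0F
                  go (yes refl) _ _ 1F = zero , 1F , refl
                  go (yes refl) _ _ 2F = at₂ 2F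
                  go (no _) (yes refl) _ 0F = zero , 2F , refl
                  go (no _) (yes refl) _ 1F = at₁ 1F
                  go (no _) (yes refl) _ 2F = at₃ 1F
                  go (no _) (no _) (yes refl) 0F = at₁ 2F
                  go (no _) (no _) (yes refl) 1F = at₂ 1F
                  go (no _) (no _) (yes refl) 2F = at₃ 2F
                  go (no p) (no q) (no r) a = suc i , a , cong (λ t → t a) (update₃-other B ef eg fg t₀ t₁ t₂ t₃ p q r)
              cov′ : Cover B′
              cov′ v with cov v
              ... | i , a , refl = move i a

          pointwise : ∀ e f g → 1 ≤ (δ e f + (δ e g + δ f g)) + (α e f + β f g + γ e g + ε₃ e f g)
          pointwise e f g with e ≟ᶠ f | e ≟ᶠ g | f ≟ᶠ g
          ... | yes _ | _     | _     = s≤s z≤n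
          ... | no _  | yes _ | _     = s≤s z≤n
          ... | no _  | no _  | yes _ = s≤s z≤n
          ... | no p  | no q  | no r  = n≢0⇒n>0 (blocked e f g p q r)

          S3 : (Fin m → Fin m → Fin m → ℕ) → ℕ
          S3 F = sum (λ e → sum (λ f → sum (λ g → F e f g)))
          S3-+ : ∀ F G → S3 (λ e f g → F e f g + G e f g) ≡ S3 F + S3 G
          S3-+ F G = trans (sum-cong-≗ (λ e → ∑∑-+ (F e) (G e))) (∑-distrib-+ (λ e → sum (λ f → sum (F e f))) (λ e → sum (λ f → sum (G e f))))
          S3-ef : ∀ (F : Fin m → Fin m → ℕ) → S3 (λ e f g → F e f) ≡ m * sum (λ e → sum (F e))
          S3-ef F = trans (∑∑-cong (λ e f → ∑-const m (F e f))) (trans (sum-cong-≗ (λ e → ∑-*ˡ m (F e))) (∑-*ˡ m (λ e → sum (F e))))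
          S3-eg : ∀ (F : Fin m → Fin m → ℕ) → S3 (λ e f g → F e g) ≡ m * sum (λ e → sum (F e))
          S3-eg F = trans (sum-cong-≗ (λ e → ∑-const m (sum (F e)))) (∑-*ˡ m (λ e → sum (F e)))
          S3-fg : ∀ (F : Fin m → Fin m → ℕ) → S3 (λ e f g → F f g) ≡ m * sum (λ e → sum (F e))
          S3-fg F = ∑-const m _

          α-bound : S3 (λ e f g → α e f) ≤ m * (7 * suc m)
          α-bound = ≤-trans (≤-reflexive (S3-ef α)) (*-monoʳ-≤ m (≤-trans
            (∑∑-injective φ suc φ-inj (λ { refl → refl }) (λ j i → # (not (h w₀ (u j) (l i))))) (missU (π ⟨$⟩ʳ rest zero))))
          β-bound : S3 (λ e f g → β f g) ≤ m * (7 * suc m)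
          β-bound = ≤-trans (≤-reflexive (S3-fg β)) (*-monoʳ-≤ m (≤-trans
            (∑∑-injective φ suc φ-inj (λ { refl → refl }) (λ j i → # (not (h w₁ (u j) (l i))))) (missU (π ⟨$⟩ʳ rest (suc zero)))))
          γ-bound : S3 (λ e f g → γ e g) ≤ m * (8 * suc m)
          γ-bound = ≤-trans (≤-reflexive (trans (S3-eg γ) (cong (m *_) (∑-comm γ)))) (*-monoʳ-≤ m (≤-trans
            (∑∑-injective φ ψ φ-inj ψ-inj (λ j j′ → # (not (h x (u j) (u j′))))) (missL zero)))
          ε-bound : S3 ε₃ ≤ m * (8 * suc m)
          ε-bound = ∑-≤-const (8 * suc m) (λ e → ≤-trans (∑∑-injective ψ ψ ψ-inj ψ-inj (λ j j′ → # (not (h (l (suc e)) (u j) (u j′))))) (missL (suc e)))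
          δ-total : S3 (λ e f g → δ e f + (δ e g + δ f g)) ≡ 3 * (m * m)
          δ-total = trans (S3-+ (λ e f g → δ e f) (λ e f g → δ e g + δ f g)) (trans (cong₂ _+_ (trans (S3-ef δ) base)
            (trans (S3-+ (λ e f g → δ e g) (λ e f g → δ f g)) (cong₂ _+_ (trans (S3-eg δ) base) (trans (S3-fg δ) base)))) (three (m * m)))
            where
              base : m * sum {m} (λ e → sum {m} (δ e)) ≡ m * m
              base = cong (m *_) (∑∑-δ m)
              three : ∀ x → x + (x + x) ≡ 3 * x
              three = solve-∀
          -- Every one of the `m³` triples of blocks is degenerate or blocked, but both kinds
          -- together number only about `33m²`.
          count : m * (m * m) ≤ 3 * (m * m) + m * (7 * suc m) + m * (7 * suc m) + m * (8 * suc m) + m * (8 * suc m)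
          count = begin
              m * (m * m)
                ≡⟨ sym (trans (sum-cong-≗ {m} (λ e → ∑∑-const m m 1)) (trans (∑-const m _) (cong (λ z → m * (m * z)) (*-identityʳ m)))) ⟩
              S3 (λ e f g → 1)
                ≤⟨ ∑-mono (λ e → ∑∑-mono (pointwise e)) ⟩
              S3 (λ e f g → Δ e f g + (α e f + β f g + γ e g + ε₃ e f g))
                ≡⟨ trans (S3-+ Δ (λ e f g → α e f + β f g + γ e g + ε₃ e f g)) (cong (S3 Δ +_)
                     (trans (S3-+ (λ e f g → α e f + β f g + γ e g) ε₃) (cong (_+ S3 ε₃)
                       (trans (S3-+ (λ e f g → α e f + β f g) (λ e f g → γ e g)) (cong (_+ S3 (λ e f g → γ e g)) (S3-+ (λ e f g → α e f) (λ e f g → β f g))))))) ⟩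
              S3 Δ + (S3 (λ e f g → α e f) + S3 (λ e f g → β f g) + S3 (λ e f g → γ e g) + S3 ε₃)
                ≤⟨ +-mono-≤ (≤-reflexive δ-total) (+-mono-≤ (+-mono-≤ (+-mono-≤ α-bound β-bound) γ-bound) ε-bound) ⟩
              3 * (m * m) + (m * (7 * suc m) + m * (7 * suc m) + m * (8 * suc m) + m * (8 * suc m))
                ≡⟨ regroup (3 * (m * m)) (m * (7 * suc m)) (m * (8 * suc m)) ⟩
              3 * (m * m) + m * (7 * suc m) + m * (7 * suc m) + m * (8 * suc m) + m * (8 * suc m) ∎
            where
              open ≤-Reasoning
              Δ : Fin m → Fin m → Fin m → ℕ
              Δ e f g = δ e f + (δ e g + δ f g)
              regroup : ∀ a b c → a + (b + b + c + c) ≡ a + b + b + c + c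
              regroup = solve-∀

private
  arith-adjacent : ∀ w N p → N + p ≡ p * 3 → 3 ≤ p → 6 * (p * p) + 3 ≤ w + 8 * p → w + N ≤ N * N → ⊥
  arith-adjacent w N p e big h₀ h₁ = go N N≡ h₁
    where
      N≡ : N ≡ p + p
      N≡ = +-cancelʳ-≡ p N (p + p) (trans e (r p))
        where
          r : ∀ p → p * 3 ≡ p + p + p
          r = solve-∀
      go : ∀ N → N ≡ p + p → w + N ≤ N * N → ⊥
      go _ refl h = 1+n≰n {0} (lin {1} {0} 2 (+-mono-≤ h₀ (+-mono-≤ h (*-monoˡ-≤ (2 * p) big))) (eq w p))
        where
          eq : ∀ w p → 1 + (w + 8 * p + ((p + p) * (p + p) + p * (2 * p))) + 2 ≡ 0 + (6 * (p * p) + 3 + (w + (p + p) + 3 * (2 * p)))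
          eq = solve-∀

  arith-missU : ∀ x w d N p n → n ≡ p * 3 → N + p ≡ p * 3 → p * p + (x + x) + w ≤ n * n →
    12 * (p * p) + 6 ≤ w + d + 16 * p → d + N ≤ N * N → x ≤ 7 * p
  arith-missU x w d N p _ refl e h₀ h₁ h₂ = go N N≡ h₂
    where
      N≡ : N ≡ p + p
      N≡ = +-cancelʳ-≡ p N (p + p) (trans e (r p))
        where
          r : ∀ p → p * 3 ≡ p + p + p
          r = solve-∀
      go : ∀ N → N ≡ p + p → d + N ≤ N * N → x ≤ 7 * p
      go _ refl h = *-cancelˡ-≤ 2 (lin 6 (+-mono-≤ h₀ (+-mono-≤ h₁ h)) (eq x w d p))
        where
          eq : ∀ x w d p → 2 * x + (p * 3 * (p * 3) + (w + d + 16 * p + (p + p) * (p + p))) + 6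
               ≡ 2 * (7 * p) + (p * p + (x + x) + w + (12 * (p * p) + 6 + (d + (p + p))))
          eq = solve-∀

  arith-missL : ∀ x d m → 3 * (suc m * suc m) + 4 + suc m * suc m ≤ d + 7 * suc m + suc m → d + x ≡ (m + (m + 2)) * (m + (m + 2)) → x ≤ 8 * suc m
  arith-missL x d m h₀ e = lin 4 (+-mono-≤ h₀ (≤-reflexive e)) (eq x d m)
    where
      eq : ∀ x d m → x + (d + 7 * suc m + suc m + (m + (m + 2)) * (m + (m + 2))) + 4
           ≡ 8 * suc m + (3 * (suc m * suc m) + 4 + suc m * suc m + (d + x))
      eq = solve-∀

complement : ∀ {s t} (F : Fin s → Fin t → Bool) → sum (λ i → sum (λ j → # (F i j))) + sum (λ i → sum (λ j → # (not (F i j)))) ≡ s * t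
complement {s} {t} F = trans (sym (∑∑-+ (λ i j → # (F i j)) (λ i j → # (not (F i j)))))
  (trans (∑∑-cong (λ i j → #-not (F i j))) (trans (∑∑-const s t 1) (cong (s *_) (*-identityʳ t))))

-- Combining the two cases for symmetric Boolean hypergraphs

module Theorem {n m : ℕ} (h : Fin n → Fin n → Fin n → Bool)
  (h12 : ∀ a b c → h a b c ≡ h b a c) (h23 : ∀ a b c → h a b c ≡ h a c b) (h-irr : ∀ a c → h a a c ≡ false)
  (n≡ : n ≡ suc m * 3) (large : 1000000 ≤ suc m)
  (ore : ∀ u v w → h u v w ≡ true → 12 * (suc m * suc m) + 6 ≤
         sum (λ a → sum (λ b → # (h u a b))) + sum (λ a → sum (λ b → # (h v a b))) + 16 * suc m)
  (busy : ∀ v → ∃ λ a → ∃ λ b → h v a b ≡ true) where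

  p : ℕ
  p = suc m

  open Degrees h h12 h23 h-irr p n≡ ore busy
  open Hypergraph {n} {m} h h12 h23 U using (edge; fake; Admissible; NoCover)

  rot : ∀ a b c → h a b c ≡ h b c a
  rot a b c = trans (h12 a b c) (h23 b a c)

  missUL : Fin n → ℕ
  missUL w = sum (λ j → sum (λ i → # (not (h w (u j) (l i)))))

  light-pair : ∀ w i i′ → h w (l i) (l i′) ≡ false
  light-pair w i i′ = trans (rot w (l i) (l i′)) (light-nonadjacent (l-P i) (l-P i′) w)

  -- All ordered pairs inside `L` are missed by `w`, and the mixed pairs are counted in both orders.
  missUL-bound : ∀ w → ℓ * ℓ + (missUL w + missUL w) + D w ≤ n * n
  missUL-bound w = begin
      ℓ * ℓ + (missUL w + missUL w) + D w
        ≡⟨ cong (λ z → z + (missUL w + missUL w) + D w) (sym LL) ⟩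
      LLsum + (missUL w + missUL w) + D w
        ≡⟨ cong (λ z → LLsum + (z + missUL w) + D w) (sym LU) ⟩
      LLsum + (LUsum + missUL w) + D w
        ≤⟨ +-monoˡ-≤ (D w) (≤-trans (m≤m+n _ UUsum) (≤-reflexive (regroup LLsum LUsum (missUL w) UUsum))) ⟩
      (LLsum + LUsum + (missUL w + UUsum)) + D w
        ≡⟨ cong (_+ D w) (sym (∑∑-split (λ a b → # (not (h w a b))))) ⟩
      sum (λ a → sum (λ b → # (not (h w a b)))) + D w
        ≡⟨ trans (+-comm _ (D w)) (complement (h w)) ⟩
      n * n ∎
    where
      open ≤-Reasoning
      LLsum LUsum UUsum : ℕ
      LLsum = sum (λ i → sum (λ i′ → # (not (h w (l i) (l i′)))))
      LUsum = sum (λ i → sum (λ j → # (not (h w (l i) (u j)))))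
      UUsum = sum (λ j → sum (λ j′ → # (not (h w (u j) (u j′)))))
      LL : LLsum ≡ ℓ * ℓ
      LL = trans (∑∑-cong {ℓ} {ℓ} {_} {λ _ _ → 1} (λ i i′ → cong (λ y → # (not y)) (light-pair w i i′))) (trans (∑∑-const ℓ ℓ 1) (cong (ℓ *_) (*-identityʳ ℓ)))
      LU : LUsum ≡ missUL w
      LU = trans (∑-comm (λ i j → # (not (h w (l i) (u j))))) (∑∑-cong (λ j i → cong (λ y → # (not y)) (h23 w (l i) (u j))))
      regroup : ∀ a b c d → a + (b + c) + d ≡ a + b + (c + d)
      regroup = solve-∀

  adjUL : Fin n → ℕ
  adjUL w = sum (λ j → sum (λ i → # (h w (u j) (l i))))

  D-apart : ∀ w → adjUL w ≡ 0 → D w ≡ size (link w)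
  D-apart w eq = trans (∑∑-split (λ a b → # (h w a b))) (cong₂ _+_
    (cong₂ _+_ (∑-zero (λ i → ∑-zero (λ i′ → cong # (light-pair w i i′))))
       (trans (trans (∑-comm (λ i j → # (h w (l i) (u j)))) (∑∑-cong (λ j i → cong # (h23 w (l i) (u j))))) eq))
    (cong (_+ size (link w)) eq))

  -- Sharing no edge with a light vertex, `w` would have its link on the `2p` vertices of `U`; then
  -- `D w ≤ 4p² − 2p`, below `6p² − 8p + 3`.
  heavy-adjacent : ℓ ≡ p → ∀ {w} → U w → ∃ λ i → 12 * (p * p) + 6 ≤ D w + D (l i) + 16 * p
  heavy-adjacent ℓ≡p {w} uw with adjUL w in eq
  ... | zero = ⊥-elim (arith-adjacent (D w) N p (trans (+-comm N p) (subst (λ z → z + N ≡ p * 3) ℓ≡p ℓ+N)) (≤-trans (from-yes (3 ≤? 1000000)) large) (U-deg w uw)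
                 (≤-trans (≤-reflexive (cong (_+ N) (D-apart w eq))) (size≤ w)))
  ... | suc _ = let (j , pj) = ∑-positive (λ j → sum (λ i → # (h w (u j) (l i)))) (subst (0 <_) (sym eq) (s≤s z≤n))
                    (i , pi) = ∑-positive (λ i → # (h w (u j) (l i))) pj
                in i , ore w (l i) (u j) (trans (h23 w (l i) (u j)) (#-positive pi))

  -- The light neighbour has `D ≤ 4p² − 2p`, so `D w ≥ 8p² − 14p + 6`. Only `8p²` ordered pairs are
  -- not inside `L`, so the missed mixed pairs, in both orders, number at most `14p`.
  missU : ℓ ≡ p → ∀ {w} → U w → missUL w ≤ 7 * p
  missU ℓ≡p {w} uw = let (i , adj) = heavy-adjacent ℓ≡p uw in
    arith-missU (missUL w) (D w) (D (l i)) N p n n≡ (trans (+-comm N p) (subst (λ z → z + N ≡ p * 3) ℓ≡p ℓ+N))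
      (subst (λ z → z * z + (missUL w + missUL w) + D w ≤ n * n) ℓ≡p (missUL-bound w)) adj (D-light≤ (l-P i))

  L-size : ∀ i → 3 * (p * p) + 4 + ℓ * ℓ ≤ size (link (l i)) + 7 * p + ℓ
  L-size i = subst (λ d → 3 * (p * p) + 4 + ℓ * ℓ ≤ d + 7 * p + ℓ) (D-light (l-P i)) (L-deg (l-P i))

  -- The numbers of blocks and of vertices in `U` are variables here so that the equations for them
  -- can be matched with `refl`.
  few-light : ∀ k ℓ N s (l : Fin ℓ → Fin n) (u : Fin N → Fin n) → k ≡ ℓ + suc s → N ≡ ℓ + (ℓ + suc s * 3) → (∀ j → U (u j)) →
    (∀ v → (∃ λ i → l i ≡ v) ⊎ (∃ λ j → u j ≡ v)) →
    (∀ i → 3 * (k * k) + 4 + ℓ * ℓ ≤ size (λ j j′ → h (l i) (u j) (u j′)) + 7 * k + ℓ) → 20 ≤ k →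
    (∀ (B : Fin k → Fin 3 → Fin n) → Cover B → (∀ i → Admissible (B i)) → ⊥) → ⊥
  few-light _ ℓ _ s l u refl refl uU onto deg big none =
    FewLight.some-cover h h23 h-irr₂ U ℓ s l u uU onto deg big none

  many-light : ∀ ℓ N (l : Fin ℓ → Fin n) (u : Fin N → Fin n) → ℓ ≡ suc m → N ≡ m + (m + 2) →
    (∀ v → (∃ λ i → l i ≡ v) ⊎ (∃ λ j → u j ≡ v)) →
    (∀ i → 3 * (suc m * suc m) + 4 + ℓ * ℓ ≤ size (λ j j′ → h (l i) (u j) (u j′)) + 7 * suc m + ℓ) →
    (∀ j → sum (λ j′ → sum (λ i → # (not (h (u j) (u j′) (l i))))) ≤ 7 * suc m) →
    (∀ (B : Fin (suc m) → Fin 3 → Fin n) → Cover B → (∀ i → edge (B i) ≡ true) → ⊥) → ⊥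
  many-light _ _ l u refl refl onto deg missU none =
    ManyLight.some-cover h h23 h-irr₂ m l u onto deg
      (λ i → arith-missL _ _ m (deg i) (complement (λ j j′ → h (l i) (u j) (u j′)))) missU
      (≤-pred (≤-trans (from-yes (101 ≤? 1000000)) large)) none

  perfect : (∀ (B : Fin (suc m) → Fin 3 → Fin n) → Cover B → (∀ i → edge (B i) ≡ true) → ⊥) → ⊥
  perfect none = go (m≤n⇒m<n∨m≡n (ℓ≤p (s≤s z≤n)))
    where
      none₀ : NoCover 0
      none₀ B cov adm few = none B cov (λ i → genuine (B i) (n≤0⇒n≡0 (≤-trans (term≤∑ (λ i → fake (B i)) i) few)))
        where
          genuine : ∀ t → fake t ≡ 0 → edge t ≡ true
          genuine t eq with edge t
          ... | true = refl
          genuine t () | false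
      none∞ : ∀ q → NoCover q
      none∞ = Descent.noCover h h12 h23 U p refl large U-deg ore none₀
      go : ℓ < suc m ⊎ ℓ ≡ suc m → ⊥
      go (inj₁ ℓ<p) = few-light (suc m) ℓ N (m ∸ ℓ) l u eqk eqN (λ j → u-P j) onto L-size (≤-trans (from-yes (20 ≤? 1000000)) large)
                        -- At the start every block may be fake, so `q = p` is enough.
                        (λ B cov adm → none∞ (suc m * 1) B cov adm (∑-≤-const 1 (λ i → #≤1 (not (edge (B i))))))
        where
          eqk : suc m ≡ ℓ + suc (m ∸ ℓ)
          eqk = sym (trans (+-suc ℓ (m ∸ ℓ)) (cong suc (m+[n∸m]≡n (≤-pred ℓ<p))))
          r : ∀ ℓ s → (ℓ + s) * 3 ≡ ℓ + (ℓ + (ℓ + s * 3))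
          r = solve-∀
          eqN : N ≡ ℓ + (ℓ + suc (m ∸ ℓ) * 3)
          eqN = +-cancelˡ-≡ ℓ N _ (trans ℓ+N (trans (cong (_* 3) eqk) (r ℓ (suc (m ∸ ℓ)))))
      go (inj₂ ℓ≡p) = many-light ℓ N l u ℓ≡p eqN onto L-size (λ j → missU ℓ≡p (u-P j)) none
        where
          r : ∀ m → suc m * 3 ≡ suc m + (m + (m + 2))
          r = solve-∀
          eqN : N ≡ m + (m + 2)
          eqN = +-cancelˡ-≡ (suc m) N _ (trans (cong (_+ N) (sym ℓ≡p)) (trans ℓ+N (r m)))

-- From sorted edge lists to a symmetric Boolean relation

does-true : ∀ {A : Set} (d : Dec A) → A → does d ≡ true
does-true (yes _) a = refl
does-true (no na) a = ⊥-elim (na a)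

does-false : ∀ {A : Set} (d : Dec A) → ¬ A → does d ≡ false
does-false (yes a) na = ⊥-elim (na a)
does-false (no _)  na = refl

from-does : ∀ {A : Set} (d : Dec A) → does d ≡ true → A
from-does (yes a) _ = a

does-⇔ : ∀ {A B : Set} (d : Dec A) (d′ : Dec B) → (A → B) → (B → A) → does d ≡ does d′
does-⇔ (yes a) d′ f g = sym (does-true d′ (f a))
does-⇔ (no na) (yes b) f g = ⊥-elim (na (g b))
does-⇔ (no na) (no _) f g = refl

module _ {n : ℕ} where

  Ordered : Triple n → Set
  Ordered (a , b , c) = (a <ᶠ b) × (b <ᶠ c)

  nth : Triple n → Fin 3 → Fin n
  nth (a , b , c) = tri a b c

  position : ∀ {v} e → v ∈ₑ e → ∃ λ i → v ≡ nth e i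
  position e (inj₁ p)        = 0F , p
  position e (inj₂ (inj₁ p)) = 1F , p
  position e (inj₂ (inj₂ p)) = 2F , p

  nth-∈ : ∀ e i → nth e i ∈ₑ e
  nth-∈ e 0F = inj₁ refl
  nth-∈ e 1F = inj₂ (inj₁ refl)
  nth-∈ e 2F = inj₂ (inj₂ refl)

  Distinct : Fin n → Fin n → Fin n → Set
  Distinct a b c = (a ≢ b) × (a ≢ c) × (b ≢ c)

  Inside : Fin n → Fin n → Fin n → Triple n → Set
  Inside a b c e = a ∈ₑ e × b ∈ₑ e × c ∈ₑ e

  in? : ∀ (v : Fin n) (e : Triple n) → Dec (v ∈ₑ e)
  in? v (a , b , c) = (v ≟ᶠ a) ⊎-dec ((v ≟ᶠ b) ⊎-dec (v ≟ᶠ c))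

  inside? : ∀ a b c e → Dec (Inside a b c e)
  inside? a b c e = in? a e ×-dec (in? b e ×-dec in? c e)

  distinct? : ∀ a b c → Dec (Distinct a b c)
  distinct? a b c = ¬? (a ≟ᶠ b) ×-dec (¬? (a ≟ᶠ c) ×-dec ¬? (b ≟ᶠ c))

  abstract
    exhaust : ∀ (i j k t : Fin 3) → i ≢ j → i ≢ k → j ≢ k → t ≡ i ⊎ t ≡ j ⊎ t ≡ k
    exhaust = from-yes (all? {3} λ i → all? {3} λ j → all? {3} λ k → all? {3} λ t → ¬? (i ≟ᶠ j) →-dec (¬? (i ≟ᶠ k) →-dec (¬? (j ≟ᶠ k) →-dec
                ((t ≟ᶠ i) ⊎-dec ((t ≟ᶠ j) ⊎-dec (t ≟ᶠ k))))))

  inside-full : ∀ {a b c e v} → Distinct a b c → Inside a b c e → v ∈ₑ e → v ≡ a ⊎ v ≡ b ⊎ v ≡ c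
  inside-full {e = e} (ab , ac , bc) (pa , pb , pc) pv
    with position e pa | position e pb | position e pc | position e pv
  ... | i , refl | j , refl | k , refl | t , refl
    with exhaust i j k t (λ eq → ab (cong (nth e) eq)) (λ eq → ac (cong (nth e) eq)) (λ eq → bc (cong (nth e) eq))
  ... | inj₁ eq        = inj₁ (cong (nth e) eq)
  ... | inj₂ (inj₁ eq) = inj₂ (inj₁ (cong (nth e) eq))
  ... | inj₂ (inj₂ eq) = inj₂ (inj₂ (cong (nth e) eq))

  ordered-≥ : ∀ {v} e → Ordered e → v ∈ₑ e → toℕ (nth e 0F) ≤ toℕ v
  ordered-≥ e (p , q) (inj₁ refl)        = ≤-refl
  ordered-≥ e (p , q) (inj₂ (inj₁ refl)) = <⇒≤ p
  ordered-≥ e (p , q) (inj₂ (inj₂ refl)) = <⇒≤ (<-trans p q)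

  ordered-≤ : ∀ {v} e → Ordered e → v ∈ₑ e → toℕ v ≤ toℕ (nth e 2F)
  ordered-≤ e (p , q) (inj₁ refl)        = <⇒≤ (<-trans p q)
  ordered-≤ e (p , q) (inj₂ (inj₁ refl)) = <⇒≤ q
  ordered-≤ e (p , q) (inj₂ (inj₂ refl)) = ≤-refl

  ordered-unique : ∀ e e′ → Ordered e → Ordered e′ → (∀ {v} → v ∈ₑ e → v ∈ₑ e′) → (∀ {v} → v ∈ₑ e′ → v ∈ₑ e) → e ≡ e′
  ordered-unique e@(x , y , z) e′@(x′ , y′ , z′) o@(x<y , y<z) o′@(x′<y′ , y′<z′) sub sub′
    with toℕ-injective (≤-antisym (ordered-≥ e o (sub′ (inj₁ refl))) (ordered-≥ e′ o′ (sub (inj₁ refl))))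
       | toℕ-injective (≤-antisym (ordered-≤ e′ o′ (sub (inj₂ (inj₂ refl)))) (ordered-≤ e o (sub′ (inj₂ (inj₂ refl)))))
       | sub (inj₂ (inj₁ refl))
  ... | refl | refl | inj₁ refl        = ⊥-elim (<-irrefl refl x<y)
  ... | refl | refl | inj₂ (inj₂ refl) = ⊥-elim (<-irrefl refl y<z)
  ... | refl | refl | inj₂ (inj₁ refl) = refl

  inside-unique : ∀ {a b c e e′} → Distinct a b c → Ordered e → Ordered e′ → Inside a b c e → Inside a b c e′ → e ≡ e′
  inside-unique {a} {b} {c} d o o′ i i′ = ordered-unique _ _ o o′ (transfer i i′) (transfer i′ i)
    where
      transfer : ∀ {e e′ v} → Inside a b c e → Inside a b c e′ → v ∈ₑ e → v ∈ₑ e′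
      transfer i (pa , pb , pc) pv with inside-full d i pv
      ... | inj₁ refl        = pa
      ... | inj₂ (inj₁ refl) = pb
      ... | inj₂ (inj₂ refl) = pc

  -- For distinct vertices, `Inside` says that the edge is exactly `{a, b, c}`. Edges are stored
  -- sorted, but this relation is symmetric.
  Joined : List (Triple n) → Fin n → Fin n → Fin n → Set
  Joined es a b c = Distinct a b c × Any (Inside a b c) es

  joined? : ∀ es a b c → Dec (Joined es a b c)
  joined? es a b c = distinct? a b c ×-dec Any.any? (inside? a b c) es

  joined : List (Triple n) → Fin n → Fin n → Fin n → Bool
  joined es a b c = does (joined? es a b c)

  joined-12 : ∀ es a b c → joined es a b c ≡ joined es b a c
  joined-12 es a b c = does-⇔ (joined? es a b c) (joined? es b a c) flip flip
    where
      flip : ∀ {a b c} → Joined es a b c → Joined es b a c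
      flip ((ab , ac , bc) , any) = (ab ∘ sym , bc , ac) , Any.map (λ (pa , pb , pc) → pb , pa , pc) any

  joined-23 : ∀ es a b c → joined es a b c ≡ joined es a c b
  joined-23 es a b c = does-⇔ (joined? es a b c) (joined? es a c b) flip flip
    where
      flip : ∀ {a b c} → Joined es a b c → Joined es a c b
      flip ((ab , ac , bc) , any) = (ac , ab , bc ∘ sym) , Any.map (λ (pa , pb , pc) → pa , pc , pb) any

  joined-irr : ∀ es a c → joined es a a c ≡ false
  joined-irr es a c = does-false (joined? es a a c) (λ ((aa , _) , _) → aa refl)

  pairs : List (Triple n) → Fin n → ℕ
  pairs es v = sum (λ a → sum (λ b → # (joined es v a b)))

  pairs-single : ∀ {e v y z} → Distinct v y z → Inside v y z e → 2 ≤ pairs (e ∷ []) v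
  pairs-single {e} {v} {y} {z} (vy , vz , yz) (pv , py , pz) =
    subst (_≤ pairs (e ∷ []) v) total (∑∑-mono pointwise)
    where
      pointwise : ∀ a b → δ a y * δ b z + δ a z * δ b y ≤ # (joined (e ∷ []) v a b)
      pointwise a b with a ≟ᶠ y | b ≟ᶠ z | a ≟ᶠ z | b ≟ᶠ y
      ... | yes refl | yes refl | yes eq   | _        = ⊥-elim (yz eq)
      ... | yes refl | yes refl | no _     | _        = ≤-reflexive (sym (cong # (does-true (joined? (e ∷ []) v a b) ((vy , vz , yz) , here (pv , py , pz)))))
      ... | yes refl | no _     | yes refl | _        = ⊥-elim (yz refl)
      ... | no _     | yes refl | yes refl | yes eq   = ⊥-elim (yz (sym eq))
      ... | no _     | no _     | yes refl | yes refl = ≤-reflexive (sym (cong # (does-true (joined? (e ∷ []) v a b) ((vz , vy , yz ∘ sym) , here (pv , pz , py)))))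
      ... | yes _    | no _     | no _     | _        = z≤n
      ... | no _     | _        | no _     | _        = z≤n
      ... | no _     | _        | yes _    | no _     = z≤n
      total : sum (λ a → sum (λ b → δ a y * δ b z + δ a z * δ b y)) ≡ 2
      total = trans (∑∑-+ (λ a b → δ a y * δ b z) (λ a b → δ a z * δ b y)) (cong₂ _+_
        (trans (∑-prod (λ a → δ a y) (λ b → δ b z)) (cong₂ _*_ (∑-δ1 y) (∑-δ1 z)))
        (trans (∑-prod (λ a → δ a z) (λ b → δ b y)) (cong₂ _*_ (∑-δ1 z) (∑-δ1 y))))

  pairs-edge : ∀ {v} e → Ordered e → v ∈ₑ e → 2 ≤ pairs (e ∷ []) v
  pairs-edge e@(x , y , z) (x<y , y<z) = λ
    { (inj₁ refl)        → pairs-single {e} (xy , xz , yz) (px , py , pz)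
    ; (inj₂ (inj₁ refl)) → pairs-single {e} (xy ∘ sym , yz , xz) (py , px , pz)
    ; (inj₂ (inj₂ refl)) → pairs-single {e} (xz ∘ sym , yz ∘ sym , xy) (pz , px , py) }
    where
      lt⇒≢ : ∀ {i j : Fin n} → i <ᶠ j → i ≢ j
      lt⇒≢ lt refl = <-irrefl refl lt
      xy = lt⇒≢ x<y
      yz = lt⇒≢ y<z
      xz = lt⇒≢ (<-trans x<y y<z)
      px : x ∈ₑ e
      px = nth-∈ e 0F
      py : y ∈ₑ e
      py = nth-∈ e 1F
      pz : z ∈ₑ e
      pz = nth-∈ e 2F

  pairs-∷ : ∀ {e es} → Ordered e → All Ordered es → All (e ≢_) es → ∀ v → pairs (e ∷ []) v + pairs es v ≤ pairs (e ∷ es) v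
  pairs-∷ {e} {es} o os new v = ≤-trans (≤-reflexive (sym (∑∑-+ (λ a b → # (joined (e ∷ []) v a b)) (λ a b → # (joined es v a b)))))
                                   (∑∑-mono pointwise)
    where
      add : ∀ {A B C : Set} (a : Dec A) (b : Dec B) (c : Dec C) → (A → C) → (B → C) → (A → B → ⊥) → # (does a) + # (does b) ≤ # (does c)
      add (yes a) (yes b) c f g ex = ⊥-elim (ex a b)
      add (yes a) (no _)  c f g ex = ≤-reflexive (sym (cong # (does-true c (f a))))
      add (no _)  (yes b) c f g ex = ≤-reflexive (sym (cong # (does-true c (g b))))
      add (no _)  (no _)  c f g ex = z≤n
      pointwise : ∀ a b → # (joined (e ∷ []) v a b) + # (joined es v a b) ≤ # (joined (e ∷ es) v a b)
      pointwise a b = add (joined? (e ∷ []) v a b) (joined? es v a b) (joined? (e ∷ es) v a b)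
        (λ { (d , here p) → d , here p }) (λ { (d , any) → d , there any })
        (λ { (d , here p) (_ , any) → let (e′ , e′∈ , p′) = find any in
               All.lookup new e′∈ (inside-unique d o (All.lookup os e′∈) p p′) })

  -- Each edge at `v` yields two ordered pairs, and by `inside-unique` different edges yield
  -- different ones. The predicate is abstract so that the anonymous one inside `deg` fits.
  degree-pairs : ∀ {P : Triple n → Set} (P? : Decidable P) v → (∀ e → P e → v ∈ₑ e) → ∀ es → All Ordered es → Unique es →
                 2 * length (filter P? es) ≤ pairs es v
  degree-pairs P? v in-P [] _ _ = z≤n
  degree-pairs P? v in-P (e ∷ es) (o ∷ os) (new ∷ uniq) with P? e
  ... | yes pe = ≤-trans (≤-reflexive (*-distribˡ-+ 2 1 (length (filter P? es)))) (≤-trans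
                   (+-mono-≤ (pairs-edge e o (in-P e pe)) (degree-pairs P? v in-P es os uniq)) (pairs-∷ o os new v))
  ... | no _ = ≤-trans (degree-pairs P? v in-P es os uniq) (≤-trans (m≤n+m _ _) (pairs-∷ o os new v))

-- From covers to perfect matchings

two-terms : ∀ {k} (f : Fin k → ℕ) {i j} → i ≢ j → 1 ≤ f i → 1 ≤ f j → 2 ≤ sum f
two-terms f {i} {j} i≢j fi fj = subst (_≤ sum f) (trans (∑-distrib-+ (λ t → δ t i) (λ t → δ t j)) (cong₂ _+_ (∑-δ1 i) (∑-δ1 j))) (∑-mono pointwise)
  where
    pointwise : ∀ t → δ t i + δ t j ≤ f t
    pointwise t with t ≟ᶠ i | t ≟ᶠ j
    ... | yes refl | yes refl = ⊥-elim (i≢j refl)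
    ... | yes refl | no _     = fi
    ... | no _     | yes refl = fj
    ... | no _     | no _     = z≤n

-- The `3p = n` entries of the blocks reach all `n` vertices, so no vertex is reached twice.
cover-injective : ∀ {n p} {B : Fin p → Fin 3 → Fin n} → n ≡ p * 3 → Cover B → ∀ {i j a b} → B i a ≡ B j b → i ≡ j
cover-injective {n} {p} {B} n≡ cov {i} {j} {a} {b} eq with i ≟ᶠ j
... | yes e = e
... | no i≢j = ⊥-elim (<-irrefl (trans (∑-const n 1) (trans (*-identityʳ n) (trans n≡ (sym total)))) (∑-mono-< once (B i a) twice))
  where
    hits : Fin n → Fin p → ℕ
    hits v i = sum (λ a → δ v (B i a))
    hit : ∀ i a → 1 ≤ hits (B i a) i
    hit i a = ≤-trans (≤-reflexive (sym (δ-refl (B i a)))) (term≤∑ (λ a′ → δ (B i a) (B i a′)) a)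
    once : ∀ v → 1 ≤ sum (hits v)
    once v with cov v
    ... | i , a , refl = ≤-trans (hit i a) (term≤∑ (hits (B i a)) i)
    twice : 1 < sum (hits (B i a))
    twice = two-terms (hits (B i a)) i≢j (hit i a) (subst (λ v → 1 ≤ hits v j) (sym eq) (hit j b))
    total : sum (λ v → sum (hits v)) ≡ p * 3
    total = trans (∑-comm hits) (trans (sum-cong-≗ {p} {_} {λ _ → 3} (λ i → trans (∑-comm (λ v a → δ v (B i a))) (sum-cong-≗ {3} {_} {λ _ → 1} (λ a → ∑-δ1 (B i a))))) (∑-const p 3))

-- Families of `p` triples are coded by the numbers below `n ^ (3p)`, and a finite search removes
-- the double negation. Decoding returns a family only pointwise equal to the given one, hence the
-- condition that `P` respects pointwise equality.
decide-cover : ∀ {n p} (P : (Fin p → Fin 3 → Fin n) → Set) → (∀ B → Dec (P B)) →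
               (∀ B B′ → (∀ i a → B i a ≡ B′ i a) → P B → P B′) → ¬ ¬ (∃ P) → ∃ P
decide-cover {n} {p} P P? resp ¬¬ex = go (any? (λ t → P? (decode t)))
  where
    decode : Fin (n ^ (p * 3)) → Fin p → Fin 3 → Fin n
    decode t i a = finToFun t (combine i a)
    flatten : (Fin p → Fin 3 → Fin n) → Fin (p * 3) → Fin n
    flatten B c = B (proj₁ (remQuot {p} 3 c)) (proj₂ (remQuot {p} 3 c))
    decode-flatten : ∀ B i a → B i a ≡ decode (funToFin (flatten B)) i a
    decode-flatten B i a = sym (trans (finToFun-funToFin (flatten B) (combine i a)) (cong (λ ia → B (proj₁ ia) (proj₂ ia)) (remQuot-combine i a)))
    go : Dec (∃ λ t → P (decode t)) → ∃ P
    go (yes (t , pt)) = decode t , pt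
    go (no none)      = ⊥-elim (¬¬ex (λ (B , pB) → none (funToFin (flatten B) , resp B _ (decode-flatten B) pB)))

-- The matching must be a sublist of `edges H`, so the edge list is filtered by the blocks instead
-- of listing the blocks; uniqueness is inherited.
cover-matching : ∀ {n p} (H : Hypergraph3 n) → n ≡ p * 3 → (B : Fin p → Fin 3 → Fin n) → Cover B →
                 (∀ i → Joined (edges H) (B i 0F) (B i 1F) (B i 2F)) → PerfectMatching H
cover-matching {n} {p} H n≡ B cov block =
    record { M = M ; sub = filter-⊆ used? (edges H) ; disjoint = pairwise M M-unique apart ; covers = covers }
  where
    Used : Triple n → Set
    Used e = ∃ λ i → Inside (B i 0F) (B i 1F) (B i 2F) e
    used? : ∀ e → Dec (Used e)
    used? e = any? (λ i → inside? (B i 0F) (B i 1F) (B i 2F) e)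
    M : List (Triple n)
    M = filter used? (edges H)
    M-unique : Unique M
    M-unique = unique-filter⁺ used? (unique H)
    covers : ∀ v → ∃[ e ] (e ∈ M × v ∈ₑ e)
    covers v with cov v
    ... | i , a , refl = let (e , e∈ , inside) = find (proj₂ (block i)) in e , ∈-filter⁺ used? e∈ (i , inside) , member a inside
      where
        member : ∀ {e} a → Inside (B i 0F) (B i 1F) (B i 2F) e → B i a ∈ₑ e
        member 0F (p , _ , _) = p
        member 1F (_ , p , _) = p
        member 2F (_ , _ , p) = p
    locate : ∀ {e v} i → Inside (B i 0F) (B i 1F) (B i 2F) e → v ∈ₑ e → ∃ λ a → B i a ≡ v
    locate i inside p with inside-full (proj₁ (block i)) inside p
    ... | inj₁ eq        = 0F , sym eq
    ... | inj₂ (inj₁ eq) = 1F , sym eq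
    ... | inj₂ (inj₂ eq) = 2F , sym eq
    apart : ∀ {e f} → e ∈ M → f ∈ M → e ≢ f → Disjoint e f
    apart {e} {f} e∈ f∈ e≢f v ve vf with ∈-filter⁻ used? {xs = edges H} e∈ | ∈-filter⁻ used? {xs = edges H} f∈
    ... | e∈E , i , ie | f∈E , j , jf with locate i ie ve | locate j jf vf
    ... | a , eqa | b , eqb with cover-injective n≡ cov {i} {j} {a} {b} (trans eqa (sym eqb))
    ... | refl = e≢f (inside-unique (proj₁ (block i)) (All.lookup (ordered H) e∈E) (All.lookup (ordered H) f∈E) ie jf)
    pairwise : ∀ es → Unique es → (∀ {e f} → e ∈ es → f ∈ es → e ≢ f → Disjoint e f) → PairwiseDisjoint es
    pairwise [] _ _ = []
    pairwise (e ∷ es) (new ∷ uniq) ap =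
      All.tabulate (λ f∈ → ap (here refl) (there f∈) (All.lookup new f∈)) ∷ pairwise es uniq (λ p q → ap (there p) (there q))

module FromDefs {n m : ℕ} (H : Hypergraph3 n) (n≡ : n ≡ suc m * 3) (large : 1000000 ≤ suc m)
  (no-isolated : ∀ v → ¬ Isolated H v) (σ : σ₂'-large H) where

  h : Fin n → Fin n → Fin n → Bool
  h = joined (edges H)

  all-ordered : All Ordered (edges H)
  all-ordered = ordered H

  deg≤pairs : ∀ v → 2 * deg H v ≤ pairs (edges H) v
  deg≤pairs v = degree-pairs _ v (λ e p → p) (edges H) all-ordered (unique H)

  busy : ∀ v → ∃ λ a → ∃ λ b → h v a b ≡ true
  busy v = let (a , pa) = ∑-positive (λ a → sum (λ b → # (h v a b))) (≤-trans (≤-trans (n≢0⇒n>0 (no-isolated v)) (m≤m+n _ _)) (deg≤pairs v))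
               (b , pb) = ∑-positive (λ b → # (h v a b)) pa
           in a , b , #-positive pb

  ore : ∀ u v w → h u v w ≡ true → 12 * (suc m * suc m) + 6 ≤ pairs (edges H) u + pairs (edges H) v + 16 * suc m
  ore u v w e = arith (deg H u) (deg H v) (pairs (edges H) u) (pairs (edges H) v) n (suc m) n≡ (σ u v adjacent) (deg≤pairs u) (deg≤pairs v)
    where
      adjacent : Adjacent H u v
      adjacent = let ((uv , _) , any) = from-does (joined? (edges H) u v w) e
                     (f , f∈ , (pu , pv , _)) = find any
                 in uv , f , f∈ , pu , pv
      arith : ∀ a b x y n p → n ≡ p * 3 → 3 * (a + b) + 8 * n > 2 * (n * n) + 6 → 2 * a ≤ x → 2 * b ≤ y → 12 * (p * p) + 6 ≤ x + y + 16 * p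
      arith a b x y _ p refl big ax by = lin 0 (+-mono-≤ (*-monoʳ-≤ 2 s) (+-mono-≤ ax by)) (eq₃ a b x y p)
        where
          eq₁ : ∀ p → 2 * (p * 3 * (p * 3)) + 6 ≡ 3 * (6 * (p * p) + 2)
          eq₁ = solve-∀
          eq₂ : ∀ a b p → 3 * (a + b) + 8 * (p * 3) ≡ 3 * (a + b + 8 * p)
          eq₂ = solve-∀
          -- Both sides of the hypothesis are multiples of 3, so after division the strict
          -- inequality gives the constant `3`, doubled to `6` in `ore`.
          s : suc (6 * (p * p) + 2) ≤ a + b + 8 * p
          s = *-cancelˡ-< 3 _ _ (subst₂ _<_ (eq₁ p) (eq₂ a b p) big)
          eq₃ : ∀ a b x y p → 12 * (p * p) + 6 + (2 * (a + b + 8 * p) + (x + y)) + 0 ≡ x + y + 16 * p + (2 * suc (6 * (p * p) + 2) + (2 * a + 2 * b))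
          eq₃ = solve-∀

  open Theorem h (joined-12 (edges H)) (joined-23 (edges H)) (joined-irr (edges H)) n≡ large ore busy using (perfect)

  Perfect : (Fin (suc m) → Fin 3 → Fin n) → Set
  Perfect B = Cover B × (∀ i → h (B i 0F) (B i 1F) (B i 2F) ≡ true)

  perfect-cover : ∃ Perfect
  perfect-cover = decide-cover Perfect
    (λ B → all? (λ v → any? (λ i → any? (λ a → B i a ≟ᶠ v))) ×-dec all? (λ i → h (B i 0F) (B i 1F) (B i 2F) ≟ᵇ true))
    (λ B B′ eq (cov , es) → (λ v → let (i , a , e) = cov v in i , a , trans (sym (eq i a)) e) ,
       λ i → trans (sym (trans (cong₂ (λ x y → h x y (B i 2F)) (eq i 0F) (eq i 1F)) (cong (h (B′ i 0F) (B′ i 1F)) (eq i 2F)))) (es i))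
    (λ none → perfect (λ B cov es → none (B , cov , es)))

  matching : PerfectMatching H
  matching = let (B , cov , es) = perfect-cover in
    cover-matching H n≡ B cov (λ i → from-does (joined? (edges H) (B i 0F) (B i 1F) (B i 2F)) (es i))

theorem1p1 : ∃[ n₀ ] ∀ (n : ℕ) → n ≥ n₀ → 3 ∣ n →
    (H : Hypergraph3 n) → (∀ v → ¬ Isolated H v) → σ₂'-large H →
    PerfectMatching H
theorem1p1 = 3000000 , main
  where
    main : ∀ n → n ≥ 3000000 → 3 ∣ n → (H : Hypergraph3 n) → (∀ v → ¬ Isolated H v) → σ₂'-large H → PerfectMatching H
    main n big (divides q n≡) = go q n≡ (*-cancelʳ-≤ 1000000 q 3 (subst (3000000 ≤_) n≡ big))
      where
        go : ∀ q → n ≡ q * 3 → 1000000 ≤ q → (H : Hypergraph3 n) → (∀ v → ¬ Isolated H v) → σ₂'-large H → PerfectMatching H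
        go zero _ ()
        go (suc m) eq large H iso σ = FromDefs.matching H eq large iso σ
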